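{- Let $m,n\ge1$ be integers, let $r\in\mathbb{Z}/n\mathbb{Z}$, let $\lambda$ be a partition with at most $m$ parts, and let $k$ be a positive integer. Then $$p_k(\mathbf{x}_1,\ldots,\mathbf{x}_m)\,s_\lambda^{(r)}(\mathbf{x}_1,\ldots,\mathbf{x}_m)=\sum_{\mu}(-1)^{\mathrm{ht}(\mu/\lambda)}s_\mu^{(r)}(\mathbf{x}_1,\ldots,\mathbf{x}_m),$$ where the sum is over all partitions $\mu$ with at most $m$ parts such that $\lambda\subset\mu$ and $\mu/\lambda$ is a ribbon of size $kn$.
   Context: Fix integers $m,n\ge 1$. For $i\in\{1,\dots,m\}$ and $j\in\mathbb{Z}/n\mathbb{Z}$ let $x_i^{(j)}$ be an indeterminate (over $\mathbb{Q}$). All superscripts in parentheses are read modulo $n$. Write $\mathbf{x}_i=(x_i^{(1)},\dots,x_i^{(n)})$. **Loop power sums.** Let $\pi_i=x_i^{(1)}x_i^{(2)}\cdots x_i^{(n)}$ and, for $k\ge1$, $p_k(\mathbf{x}_1,\ldots,\mathbf{x}_m)=\sum_{i=1}^m\pi_i^k$. **Loop Schur functions.** Boxes of a Young diagram are indexed by (row, column) $=(i,j)$ with $i,j\ge1$. A semistandard tableau $T$ of shape $\lambda$ is a filling of the Young diagram of $\lambda$ with positive integers that is weakly increasing along rows and strictly increasing down columns. For $r\in\mathbb{Z}/n\mathbb{Z}$ define $$s_\lambda^{(r)}(\mathbf{x}_1,\dots,\mathbf{x}_m)=\sum_T\ \prod_{(i,j)\in\lambda} x_{T(i,j)}^{(r+i-j)},$$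 the sum being over semistandard tableaux $T$ of shape $\lambda$ with entries in $\{1,\dots,m\}$; $s_\emptyset^{(r)}=1$. **Ribbons.** For partitions $\lambda\subset\mu$ (containment of Young diagrams), $\mu/\lambda$ is the skew diagram obtained by removing the boxes of $\lambda$ from the diagram of $\mu$. A ribbon is a connected skew diagram containing no $2\times2$ square of boxes; here connectedness is via boxes sharing an edge (two boxes sharing only a vertex are not considered connected). The size of a ribbon is its number of boxes, and its height $\mathrm{ht}$ is one less than the number of rows it contains (i.e. in which it has boxes). -}

module Defs where

open import Algebra.Bundles.Raw using (RawRing)
import Algebra.Definitions.RawSemiring as RawSemiringDefinitions
open import Data.Bool.Base using (if_then_else_)
open import Data.Fin.Base as Fin using (Fin; toℕ; fromℕ<; combine)
import Data.Fin.Properties as Fin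
open import Data.Integer.Base using (+_; _-_) renaming (_+_ to _+ℤ_)
open import Data.Integer.DivMod using (_%ℕ_; n%ℕd<d)
open import Data.List.Base using (List; []; _∷_; _++_; map; foldr; filter; length; concatMap; cartesianProductWith; upTo; applyUpTo; allFin; deduplicate)
open import Data.List.Membership.Propositional using (_∈_; lose; find)
open import Data.List.Membership.Propositional.Properties using (∈-cartesianProductWith⁺; ∈-filter⁺; ∈-filter⁻; ∈-allFin; ∈-upTo⁺; ∈-upTo⁻; ∈-map⁺; ∈-map⁻; ∈-concatMap⁺; ∈-concatMap⁻; ∈-applyUpTo⁻; ∈-∃++; ∈-++⁺ˡ; ∈-++⁺ʳ; ∈-++⁻)
open import Data.List.Properties using (length-++; length-applyUpTo)
open import Data.List.Relation.Binary.Subset.Propositional using (_⊆_)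
open import Data.List.Relation.Unary.All as All using ([]; _∷_)
open import Data.List.Relation.Unary.AllPairs using ([]; _∷_)
open import Data.List.Relation.Unary.Any using (here; there; any?; satisfied)
open import Data.List.Relation.Unary.Unique.Propositional using (Unique)
import Data.List.Relation.Unary.Unique.Propositional.Properties as Unique
open import Data.Nat.Base using (ℕ; zero; suc; _+_; _∸_; _*_; _≤_; _<_; _≥_; ∣_-_∣; NonZero; s≤s; z≤n)
import Data.Nat.Properties as ℕ
open import Data.Product using (_×_; _,_; proj₁; proj₂; ∃)
open import Data.Product.Properties using (≡-dec; ,-injectiveʳ)
open import Data.Rational.Base using (ℚ; 0ℚ; 1ℚ) renaming (_+_ to _+ℚ_; _*_ to _*ℚ_; -_ to -ℚ_)
open import Data.Sum.Base using (_⊎_; inj₁; inj₂)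
open import Data.Vec.Base as Vec using (Vec; []; _∷_; lookup; zipWith; replicate; updateAt)
import Data.Vec.Properties as Vec
open import Data.Vec.Relation.Unary.All as VecAll using ([]; _∷_)
open import Data.Vec.Relation.Unary.All.Properties using (lookup⁺)
open import Function.Base using (_∘_)
open import Function.Bundles using (_⇔_; mk⇔; Equivalence)
open import Level using (0ℓ)
open import Relation.Binary.Construct.Closure.ReflexiveTransitive using (Star; ε; _◅_; _◅◅_)
open import Relation.Binary.Definitions using (DecidableEquality)
open import Relation.Binary.PropositionalEquality using (_≡_; refl; sym; trans; cong; subst)
open import Relation.Nullary using (¬_; Dec; does; contradiction)
open import Relation.Nullary.Decidable using (map′; _×-dec_; _⊎-dec_; _→-dec_; ¬?)

Monomial : ℕ → Set
Monomial v = Vec ℕ v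

-- A formal sum of terms; terms may repeat a monomial or have coefficient 0,
-- and polynomials are compared by their coefficients only.
Polynomial : ℕ → Set
Polynomial v = List (ℚ × Monomial v)

coefficient : ∀ {v} → Polynomial v → Monomial v → ℚ
coefficient []            e = 0ℚ
coefficient ((c , d) ∷ p) e =
  (if does (Vec.≡-dec ℕ._≟_ d e) then c else 0ℚ) +ℚ coefficient p e

mulTerm : ∀ {v} → ℚ × Monomial v → ℚ × Monomial v → ℚ × Monomial v
mulTerm (c , d) (c′ , d′) = c *ℚ c′ , zipWith _+_ d d′

polynomialRing : ℕ → RawRing 0ℓ 0ℓ
polynomialRing v = record
  { Carrier = Polynomial v
  ; _≈_     = λ p q → ∀ e → coefficient p e ≡ coefficient q e
  ; _+_     = _++_
  ; _*_     = cartesianProductWith mulTerm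
  ; -_      = map λ (c , d) → -ℚ c , d
  ; 0#      = []
  ; 1#      = (1ℚ , replicate v 0) ∷ []
  }

variable-at : ∀ {v} → Fin v → Polynomial v
variable-at {v} i = (1ℚ , updateAt (replicate v 0) i suc) ∷ []

-- A partition with at most ℓ parts is a weakly decreasing vector of length
-- ℓ, padded with zeros.
IsPartition : ∀ {ℓ} → Vec ℕ ℓ → Set
IsPartition α = ∀ i j → i Fin.≤ j → lookup α i ≥ lookup α j

isPartition? : ∀ {ℓ} (α : Vec ℕ ℓ) → Dec (IsPartition α)
isPartition? α = Fin.all? λ i → Fin.all? λ j → (i Fin.≤? j) →-dec (lookup α j ℕ.≤? lookup α i)

-- (row , column), both counted from 0; contents, adjacency and heights are
-- the same as with both counted from 1.
Box : Set
Box = ℕ × ℕ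

_≟ᵇ_ : DecidableEquality Box
_≟ᵇ_ = ≡-dec ℕ._≟_ ℕ._≟_

open import Data.List.Membership.DecPropositional _≟ᵇ_ using (_∈?_; _∉?_)
open import Data.List.Relation.Binary.Subset.DecPropositional _≟ᵇ_ using (_⊆?_)

diagram : ∀ {ℓ} → Vec ℕ ℓ → List Box
diagram {ℓ} α = concatMap (λ i → map (toℕ i ,_) (upTo (lookup α i))) (allFin ℓ)

infix 8 _/_
_/_ : ∀ {ℓ} → Vec ℕ ℓ → Vec ℕ ℓ → List Box
μ / α = filter (_∉? diagram α) (diagram μ)

ShareEdge : Box → Box → Set
ShareEdge (i , j) (i′ , j′) = ∣ i - i′ ∣ + ∣ j - j′ ∣ ≡ 1

Step : List Box → Box → Box → Set
Step S a b = a ∈ S × b ∈ S × ShareEdge a b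

Connected : List Box → Set
Connected S = ∀ a b → a ∈ S → b ∈ S → Star (Step S) a b

SquareAt : List Box → Box → Set
SquareAt S (i , j) =
  (i , j) ∈ S × (i , suc j) ∈ S × (suc i , j) ∈ S × (suc i , suc j) ∈ S

HasSquare : List Box → Set
HasSquare S = ∃ (SquareAt S)

IsRibbon : List Box → Set
IsRibbon S = Connected S × ¬ HasSquare S

height : List Box → ℕ
height S = length (deduplicate ℕ._≟_ (map proj₁ S)) ∸ 1

-- Reachability through intermediate boxes taken from a given list, as in
-- Warshall's algorithm; used to decide connectedness.
module Reachability (S : List Box) where

  Via : List Box → Box → Box → Set
  Via []      a b = a ≡ b ⊎ Step S a b
  Via (v ∷ L) a b = Via L a b ⊎ (Via L a v × Via L v b)

  via? : ∀ L a b → Dec (Via L a b)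
  via? []      a b = (a ≟ᵇ b) ⊎-dec ((a ∈? S) ×-dec (b ∈? S) ×-dec (_ ℕ.≟ 1))
  via? (v ∷ L) a b = via? L a b ⊎-dec (via? L a v ×-dec via? L v b)

  via⇒star : ∀ L {a b} → Via L a b → Star (Step S) a b
  via⇒star []      (inj₁ refl)    = ε
  via⇒star []      (inj₂ s)       = s ◅ ε
  via⇒star (v ∷ L) (inj₁ p)       = via⇒star L p
  via⇒star (v ∷ L) (inj₂ (p , q)) = via⇒star L p ◅◅ via⇒star L q

  base : ∀ L {a b} → a ≡ b ⊎ Step S a b → Via L a b
  base []      p = p
  base (v ∷ L) p = inj₁ (base L p)

  join : ∀ L {a c b} → c ∈ L → Via L a c → Via L c b → Via L a b
  join (v ∷ L) (here refl) p q = inj₂ (to p , from q)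
    where
    to : ∀ {a} → Via L a v ⊎ (Via L a v × Via L v v) → Via L a v
    to (inj₁ p)       = p
    to (inj₂ (p , _)) = p
    from : ∀ {b} → Via L v b ⊎ (Via L v v × Via L v b) → Via L v b
    from (inj₁ q)       = q
    from (inj₂ (_ , q)) = q
  join (v ∷ L) (there c∈L) (inj₁ p)       (inj₁ q)       = inj₁ (join L c∈L p q)
  join (v ∷ L) (there c∈L) (inj₁ p)       (inj₂ (q , s)) = inj₂ (join L c∈L p q , s)
  join (v ∷ L) (there c∈L) (inj₂ (p , q)) (inj₁ s)       = inj₂ (p , join L c∈L q s)
  join (v ∷ L) (there c∈L) (inj₂ (p , _)) (inj₂ (_ , s)) = inj₂ (p , s)

  star⇒via : ∀ {a b} → Star (Step S) a b → Via S a b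
  star⇒via ε        = base S (inj₁ refl)
  star⇒via (s ◅ ss) = join S (proj₁ (proj₂ s)) (base S (inj₂ s)) (star⇒via ss)

connected? : ∀ S → Dec (Connected S)
connected? S = map′
  (λ h a b a∈S b∈S → via⇒star S (All.lookup (All.lookup h a∈S) b∈S))
  (λ c → All.tabulate λ a∈S → All.tabulate λ b∈S → star⇒via (c _ _ a∈S b∈S))
  (All.all? (λ a → All.all? (λ b → via? S a b) S) S)
  where open Reachability S

hasSquare? : ∀ S → Dec (HasSquare S)
hasSquare? S = map′ satisfied (λ (_ , sq) → lose (proj₁ sq) sq) (any? squareAt? S)
  where
  squareAt? : ∀ b → Dec (SquareAt S b)
  squareAt? (i , j) = (_ ∈? S) ×-dec (_ ∈? S) ×-dec (_ ∈? S) ×-dec (_ ∈? S)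

isRibbon? : ∀ S → Dec (IsRibbon S)
isRibbon? S = connected? S ×-dec ¬? (hasSquare? S)

vectors : ∀ {A : Set} → List A → ∀ ℓ → List (Vec A ℓ)
vectors xs zero    = [] ∷ []
vectors xs (suc ℓ) = cartesianProductWith _∷_ xs (vectors xs ℓ)

∈-vectors : ∀ {A : Set} {xs : List A} {ℓ} (v : Vec A ℓ) →
            (∀ i → lookup v i ∈ xs) → v ∈ vectors xs ℓ
∈-vectors []      h = here refl
∈-vectors (x ∷ v) h = ∈-cartesianProductWith⁺ _∷_ (h Fin.zero) (∈-vectors v (h ∘ Fin.suc))

vectors-unique : ∀ {A : Set} {xs : List A} → Unique xs → ∀ ℓ → Unique (vectors xs ℓ)
vectors-unique u zero    = [] ∷ []
vectors-unique u (suc ℓ) =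
  Unique.cartesianProductWith⁺ _∷_ Vec.∷-injective u (vectors-unique u ℓ)

RibbonExtension : ∀ {ℓ} → Vec ℕ ℓ → ℕ → Vec ℕ ℓ → Set
RibbonExtension α N μ =
  IsPartition μ × diagram α ⊆ diagram μ × IsRibbon (μ / α) × length (μ / α) ≡ N

ribbonExtension? : ∀ {ℓ} (α : Vec ℕ ℓ) N μ → Dec (RibbonExtension α N μ)
ribbonExtension? α N μ =
  isPartition? μ ×-dec (diagram α ⊆? diagram μ) ×-dec isRibbon? (μ / α) ×-dec (_ ℕ.≟ N)

-- Each part of μ is at most ∣α∣ + N, so the enumeration below is exhaustive:
-- see ∈-ribbonExtensions and ribbonExtensions-unique.
ribbonExtensions : ∀ {ℓ} → Vec ℕ ℓ → ℕ → List (Vec ℕ ℓ)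
ribbonExtensions {ℓ} α N =
  filter (ribbonExtension? α N) (vectors (upTo (suc (Vec.sum α + N))) ℓ)

unique-length-≤ : ∀ {A : Set} {xs ys : List A} → Unique xs → xs ⊆ ys → length xs ≤ length ys
unique-length-≤ {xs = []}     _       _ = z≤n
unique-length-≤ {xs = x ∷ xs} (x∉ ∷ u) s with as , bs , refl ← ∈-∃++ (s (here refl)) =
  subst (suc (length xs) ≤_)
    (sym (trans (length-++ as) (trans (ℕ.+-suc _ _) (cong suc (sym (length-++ as))))))
    (s≤s (unique-length-≤ u λ z∈xs → remove (All.lookup x∉ z∈xs) (∈-++⁻ as (s (there z∈xs)))))
  where
  remove : ∀ {z} → ¬ x ≡ z → z ∈ as ⊎ z ∈ x ∷ bs → z ∈ as ++ bs
  remove x≢z (inj₁ z∈as)         = ∈-++⁺ˡ z∈as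
  remove x≢z (inj₂ (here z≡x))   = contradiction (sym z≡x) x≢z
  remove x≢z (inj₂ (there z∈bs)) = ∈-++⁺ʳ as z∈bs

∈-diagram : ∀ {ℓ} (α : Vec ℕ ℓ) i {j} → (toℕ i , j) ∈ diagram α ⇔ j < lookup α i
∈-diagram {ℓ} α i {j} = mk⇔ to from
  where
  row : Fin ℓ → List Box
  row i = map (toℕ i ,_) (upTo (lookup α i))
  to : (toℕ i , j) ∈ diagram α → j < lookup α i
  to b∈ with i′ , _ , b∈row ← find (∈-concatMap⁻ row {xs = allFin ℓ} b∈)
        with j′ , j′∈ , eq ← ∈-map⁻ (toℕ i′ ,_) b∈row
        with refl ← Fin.toℕ-injective {i = i} {i′} (cong proj₁ eq)
        with refl ← cong proj₂ eq = ∈-upTo⁻ j′∈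
  from : j < lookup α i → (toℕ i , j) ∈ diagram α
  from j< = ∈-concatMap⁺ row (lose (∈-allFin i) (∈-map⁺ (toℕ i ,_) (∈-upTo⁺ j<)))

row-length-≤ : ∀ {ℓ} (α μ : Vec ℕ ℓ) i → lookup μ i ≤ lookup α i + length (μ / α)
row-length-≤ α μ i = ℕ.≤-trans (ℕ.m≤n+m∸n _ (lookup α i)) (ℕ.+-monoʳ-≤ (lookup α i)
  (subst (_≤ length (μ / α)) (length-applyUpTo box size)
    (unique-length-≤ (Unique.applyUpTo⁺₁ box size λ i<j _ eq →
        ℕ.<⇒≢ i<j (ℕ.+-cancelˡ-≡ (lookup α i) _ _ (,-injectiveʳ eq)))
      λ b∈ → inside (∈-applyUpTo⁻ box b∈))))
  where
  open Equivalence
  size : ℕ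
  size = lookup μ i ∸ lookup α i
  box : ℕ → Box
  box t = toℕ i , lookup α i + t
  inside : ∀ {b} → (∃ λ t → t < size × b ≡ box t) → b ∈ μ / α
  inside (t , t< , refl) = ∈-filter⁺ (_∉? diagram α)
    (from (∈-diagram μ i) (subst (lookup α i + t <_)
      (ℕ.m+[n∸m]≡n {lookup α i} (ℕ.<⇒≤ (ℕ.m∸n≢0⇒n<m λ z → ℕ.n≮0 (subst (t <_) z t<))))
      (ℕ.+-monoʳ-< (lookup α i) t<)))
    (λ b∈ → ℕ.m+n≮m _ t (to (∈-diagram α i) b∈))

lookup≤sum : ∀ {ℓ} (α : Vec ℕ ℓ) i → lookup α i ≤ Vec.sum α
lookup≤sum (a ∷ α) Fin.zero    = ℕ.m≤m+n a _
lookup≤sum (a ∷ α) (Fin.suc i) = ℕ.≤-trans (lookup≤sum α i) (ℕ.m≤n+m _ a)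

∈-ribbonExtensions : ∀ {ℓ} (α : Vec ℕ ℓ) N μ → μ ∈ ribbonExtensions α N ⇔ RibbonExtension α N μ
∈-ribbonExtensions {ℓ} α N μ = mk⇔
  (λ μ∈ → proj₂ (∈-filter⁻ (ribbonExtension? α N) {xs = vectors (upTo (suc (Vec.sum α + N))) ℓ} μ∈))
  (λ e@(_ , _ , _ , size≡N) → ∈-filter⁺ (ribbonExtension? α N)
    (∈-vectors μ λ i → ∈-upTo⁺ (s≤s (ℕ.≤-trans (row-length-≤ α μ i)
      (ℕ.+-mono-≤ (lookup≤sum α i) (ℕ.≤-reflexive size≡N)))))
    e)

ribbonExtensions-unique : ∀ {ℓ} (α : Vec ℕ ℓ) N → Unique (ribbonExtensions α N)
ribbonExtensions-unique {ℓ} α N =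
  Unique.filter⁺ (ribbonExtension? α N) (vectors-unique (Unique.upTo⁺ _) ℓ)

Filling : ∀ (m : ℕ) {ℓ} → Vec ℕ ℓ → Set
Filling m α = VecAll.All (Vec (Fin m)) α

entry : ∀ {m ℓ} {α : Vec ℕ ℓ} → Filling m α → ∀ i → Fin (lookup α i) → Fin m
entry T i j = lookup (lookup⁺ T i) j

IsSemistandard : ∀ {m ℓ} {α : Vec ℕ ℓ} → Filling m α → Set
IsSemistandard T =
  (∀ i j j′ → j Fin.≤ j′ → entry T i j Fin.≤ entry T i j′) ×
  (∀ i i′ j j′ → i Fin.< i′ → toℕ j ≡ toℕ j′ → entry T i j Fin.< entry T i′ j′)

isSemistandard? : ∀ {m ℓ} {α : Vec ℕ ℓ} (T : Filling m α) → Dec (IsSemistandard T)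
isSemistandard? T =
  (Fin.all? λ i → Fin.all? λ j → Fin.all? λ j′ →
    (j Fin.≤? j′) →-dec (entry T i j Fin.≤? entry T i j′))
  ×-dec
  (Fin.all? λ i → Fin.all? λ i′ → Fin.all? λ j → Fin.all? λ j′ →
    (i Fin.<? i′) →-dec (toℕ j ℕ.≟ toℕ j′) →-dec (entry T i j Fin.<? entry T i′ j′))

fillings : ∀ m {ℓ} (α : Vec ℕ ℓ) → List (Filling m α)
fillings m []      = [] ∷ []
fillings m (a ∷ α) = cartesianProductWith _∷_ (vectors (allFin m) a) (fillings m α)

tableaux : ∀ m {ℓ} (α : Vec ℕ ℓ) → List (Filling m α)
tableaux m α = filter isSemistandard? (fillings m α)

∈-fillings : ∀ {m ℓ} {α : Vec ℕ ℓ} (T : Filling m α) → T ∈ fillings m α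
∈-fillings []      = here refl
∈-fillings (R ∷ T) =
  ∈-cartesianProductWith⁺ _∷_ (∈-vectors R λ i → ∈-allFin _) (∈-fillings T)

fillings-unique : ∀ m {ℓ} (α : Vec ℕ ℓ) → Unique (fillings m α)
fillings-unique m []      = [] ∷ []
fillings-unique m (a ∷ α) = Unique.cartesianProductWith⁺ _∷_ (λ { refl → refl , refl })
  (vectors-unique (Unique.allFin⁺ m) a) (fillings-unique m α)

∈-tableaux : ∀ {m ℓ} {α : Vec ℕ ℓ} (T : Filling m α) → T ∈ tableaux m α ⇔ IsSemistandard T
∈-tableaux {m} {α = α} T = mk⇔
  (λ T∈ → proj₂ (∈-filter⁻ isSemistandard? {xs = fillings m α} T∈))
  (λ s → ∈-filter⁺ isSemistandard? (∈-fillings T) s)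

tableaux-unique : ∀ m {ℓ} (α : Vec ℕ ℓ) → Unique (tableaux m α)
tableaux-unique m α = Unique.filter⁺ isSemistandard? (fillings-unique m α)

-- r + i - j in ℤ/nℤ, with Fin n as the set of residues (the class of n is 0).
superscript : ∀ {n} .{{_ : NonZero n}} → Fin n → ℕ → ℕ → Fin n
superscript {n} r i j = fromℕ< (n%ℕd<d (+ toℕ r +ℤ + i - + j) n)

-- x i j is x_{i+1}^{(j)}: alphabets and tableau entries are counted from 0.
module Loop {c e} (R : RawRing c e) {m n : ℕ} (x : Fin m → Fin n → RawRing.Carrier R) where

  open RawRing R renaming (_+_ to _+ᴿ_; _*_ to _*ᴿ_; -_ to -ᴿ_)
  open RawSemiringDefinitions rawSemiring using (_^_)

  ∑ : ∀ {a} {A : Set a} → List A → (A → Carrier) → Carrier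
  ∑ as f = foldr (λ a s → f a +ᴿ s) 0# as

  ∏ : ∀ {a} {A : Set a} → List A → (A → Carrier) → Carrier
  ∏ as f = foldr (λ a s → f a *ᴿ s) 1# as

  π : Fin m → Carrier
  π i = ∏ (allFin n) λ j → x i j

  p : ℕ → Carrier
  p k = ∑ (allFin m) λ i → π i ^ k

  weight : .{{_ : NonZero n}} → Fin n → ∀ {ℓ} {α : Vec ℕ ℓ} → Filling m α → Carrier
  weight r {ℓ} {α} T = ∏ (allFin ℓ) λ i → ∏ (allFin (lookup α i)) λ j →
    x (entry T i j) (superscript r (toℕ i) (toℕ j))

  s : .{{_ : NonZero n}} → Fin n → ∀ {ℓ} → Vec ℕ ℓ → Carrier
  s r α = ∑ (tableaux m α) (weight r)

  sign : ℕ → Carrier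
  sign h = (-ᴿ 1#) ^ h

indeterminate : ∀ {m n} → Fin m → Fin n → Polynomial (m * n)
indeterminate i j = variable-at (combine i j)

module LoopPolynomials (m n : ℕ) where
  open RawRing (polynomialRing (m * n)) public using (_≈_) renaming (_*_ to _·_)
  open Loop (polynomialRing (m * n)) (indeterminate {m} {n}) public using (∑; p; s; sign)

{-# OPTIONS --safe #-}

-- Place a particle at α_i + (number of rows below row i) for every row i of α.
-- Removing the largest letter of a tableau makes the particles interlace, so
-- s_α^{(r)} is the value at these positions of an alternating function, built
-- one letter at a time: the particles are transported by a transfer matrix, and
-- a wedge with its vector of path weights adds a new particle. All weights are
-- n-periodic in the position. Hence moving a particle by N = kn places commutes
-- with the transfer matrix up to a multiple of the path vector, which the wedge
-- kills, and it multiplies the path vector of the letter i by π_i^k. So the sum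
-- over all particles of the effect of moving one of them by N is
-- multiplication by p_k. On the other hand, moving a particle by N adds a ribbon
-- of size N, whose height is the number of particles that are overtaken, or else
-- makes two particles collide, where an alternating function vanishes.

module Submission where

open import Algebra.Bundles using (CommutativeRing; RawRing)
import Algebra.Definitions.RawSemiring
import Algebra.Properties.CommutativeMonoid.Sum
import Algebra.Properties.CommutativeSemigroup
import Algebra.Properties.Ring
open import Data.Bool.Base using (Bool; true; false; if_then_else_; T; _∧_)
open import Data.Bool.Properties using (T-≡; ∧-assoc; ∧-comm; ∧-conicalˡ; ∧-conicalʳ)
open import Data.Fin.Base as Fin using (Fin; toℕ; fromℕ<)
open import Data.Fin.Permutation using (Permutation′; permutation)
import Data.Fin.Properties as Fin
open import Data.Integer.DivMod using (_/ℕ_; n%ℕd<d; a≡a%ℕn+[a/ℕn]*n)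
import Data.Integer.Properties as ℤ
import Data.Integer.Solver as ℤ
open import Data.List.Base using (List; []; _∷_; _++_; length; replicate; _∷ʳ_; map; filter; concatMap; cartesianProductWith; allFin; tabulate; upTo; applyUpTo; deduplicate)
open import Data.List.Membership.Propositional using (_∈_; lose; find)
open import Data.List.Membership.Propositional.Properties using (∈-concatMap⁺; ∈-concatMap⁻; ∈-map⁺; ∈-map⁻; ∈-filter⁺; ∈-filter⁻; ∈-++⁺ˡ; ∈-++⁺ʳ; ∈-++⁻; ∈-applyUpTo⁺; ∈-applyUpTo⁻; ∈-deduplicate⁺; ∈-deduplicate⁻)
open import Data.List.Membership.Propositional.Properties.WithK using (unique∧set⇒bag)
open import Data.List.Properties using (length-++; length-map; length-upTo; length-applyUpTo; map-++; ++-assoc; ++-identityʳ)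
open import Data.List.Relation.Binary.BagAndSetEquality using (∼bag⇒↭)
open import Data.List.Relation.Binary.Permutation.Propositional as ↭ using (_↭_)
open import Data.List.Relation.Binary.Subset.Propositional using (_⊆_)
open import Data.List.Relation.Unary.All as All using (All; []; _∷_)
import Data.List.Relation.Unary.All.Properties as All
open import Data.List.Relation.Unary.AllPairs as AllPairs using ([]; _∷_)
import Data.List.Relation.Unary.AllPairs.Properties as AllPairs
open import Data.List.Relation.Unary.Any using (here; there)
import Data.List.Relation.Unary.Unique.DecPropositional.Properties as UniqueDec
open import Data.List.Relation.Unary.Unique.Propositional using (Unique)
import Data.List.Relation.Unary.Unique.Propositional.Properties as Unique
open import Data.Nat.Base using (ℕ; zero; suc; pred; _∸_; _≤_; _<_; _≤ᵇ_; _<ᵇ_; _≤′_; ≤′-refl; ≤′-step; z≤n; s≤s; s≤s⁻¹; ∣_-_∣; NonZero; >-nonZero⁻¹)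
import Data.Nat.Properties as ℕ
import Data.Nat.Solver as ℕ
open import Data.Product using (∃; ∃₂; _×_; _,_; proj₁; proj₂)
open import Data.Rational.Base using (ℚ; 0ℚ; 1ℚ) renaming (_+_ to _+ℚ_; _*_ to _*ℚ_; -_ to -ℚ_)
import Data.Rational.Properties as ℚ
open import Data.Sum.Base using (inj₁; inj₂)
open import Data.Unit.Base using (tt)
open import Data.Vec.Base as Vec using (Vec; []; _∷_; lookup; toList; zipWith)
import Data.Vec.Properties as Vec
open import Data.Vec.Relation.Unary.All using ([]; _∷_)
open import Function.Base using (_∘_; id; const)
open import Function.Bundles using (_⇔_; mk⇔; Equivalence)
open import Level using (_⊔_; 0ℓ)
open import Relation.Binary.Construct.Closure.ReflexiveTransitive using (Star; ε; _◅_; _◅◅_; reverse)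
open import Relation.Binary.Definitions using (tri<; tri≈; tri>)
open import Relation.Binary.PropositionalEquality as ≡ using (_≡_)
import Relation.Binary.Reasoning.Setoid
open import Relation.Nullary using (¬_; Dec; yes; no; does; contradiction)
open import Relation.Nullary.Decidable using (dec-true; dec-false)
open import Defs
open import Data.List.Membership.DecPropositional _≟ᵇ_ using (_∈?_; _∉?_)

-- Moving particles leads out of the decreasing lists of positions that belong to partitions, so the
-- Schur function has to be extended to all lists before the moves can be summed. The extension
-- divides by no Vandermonde determinant: letters are added one at a time, over an arbitrary
-- commutative ring.
--
-- A superscript depends on row and column only through their difference. At the level of the letter
-- `e`, the position of a particle fixes this difference for the next box of its row, by a rule that
-- is the same for every row. Hence a single weight function `y e` serves all particles, and an
-- exterior product can arise at all.
--
-- Tableaux confine each old particle to the interval between two new ones, whereas the transfer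
-- matrix does not. The surplus terms cancel by alternation, which is the content of
-- `wedge-transferAll`.
--
-- At each level there are as many rows as letters. The row that arrives with a letter is the lowest
-- one, all of its boxes carry that letter, and its particle starts at 0. Over n consecutive
-- positions every superscript occurs once, which is why the path weight over one period is π.

module Shapes where

  open import Data.Nat.Base using (_+_; _*_)
  open ≡ using (refl; sym; trans; cong; cong₂; subst; module ≡-Reasoning)

  ≤⇒≤ᵇ-true : ∀ {a b} → a ≤ b → (a ≤ᵇ b) ≡ true
  ≤⇒≤ᵇ-true a≤b = Equivalence.to T-≡ (ℕ.≤⇒≤ᵇ a≤b)

  ≰⇒≤ᵇ-false : ∀ {a b} → ¬ a ≤ b → (a ≤ᵇ b) ≡ false
  ≰⇒≤ᵇ-false {a} {b} a≰b with a ≤ᵇ b in eq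
  ... | false = refl
  ... | true  with () ← a≰b (ℕ.≤ᵇ⇒≤ a b (subst T (sym eq) tt))

  -- Partitions as descending lists, and the conditions on the rows of a tableau.

  data Descending : ℕ → List ℕ → Set where
    []  : ∀ {M} → Descending M []
    _∷_ : ∀ {M a α} → a ≤ M → Descending a α → Descending M (a ∷ α)

  positions : List ℕ → List ℕ
  positions []      = []
  positions (a ∷ α) = a + length α ∷ positions α

  positions-length : ∀ α → length (positions α) ≡ length α
  positions-length []      = refl
  positions-length (a ∷ α) = cong suc (positions-length α)

  positions-descending : ∀ {M} α → Descending M α → Descending (M + length α) (positions α)
  positions-descending []          []              = []
  positions-descending (a ∷ [])     (a≤M ∷ [])      = ℕ.+-mono-≤ a≤M z≤n ∷ []
  positions-descending (a ∷ b ∷ α) (a≤M ∷ b≤a ∷ d) =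
    ℕ.+-mono-≤ a≤M (ℕ.n≤1+n _) ∷ ℕ.+-mono-≤ b≤a (ℕ.n≤1+n _) ∷ rest (positions-descending (b ∷ α) (b≤a ∷ d))
    where
    rest : ∀ {M q qs} → Descending M (q ∷ qs) → Descending q qs
    rest (_ ∷ d) = d

  descending-weaken : ∀ {M M′ α} → M ≤ M′ → Descending M α → Descending M′ α
  descending-weaken M≤M′ []        = []
  descending-weaken M≤M′ (a≤M ∷ d) = ℕ.≤-trans a≤M M≤M′ ∷ d

  -- Serves to show that a shape with more nonempty rows than letters has no tableau.
  descending-∷ʳ-suc : ∀ {M} ν p → Descending M (ν ∷ʳ suc p) → All (1 ≤_) (ν ∷ʳ suc p)
  descending-∷ʳ-suc ν p d = go ν d
    where
    bounded : ∀ ν {M} → Descending M (ν ∷ʳ suc p) → 1 ≤ M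
    bounded []      (p<M ∷ []) = ℕ.≤-trans (s≤s z≤n) p<M
    bounded (a ∷ ν) (a≤M ∷ d)  = ℕ.≤-trans (bounded ν d) a≤M
    go : ∀ ν {M} → Descending M (ν ∷ʳ suc p) → All (1 ≤_) (ν ∷ʳ suc p)
    go []      _       = s≤s z≤n ∷ []
    go (a ∷ ν) (_ ∷ d) = bounded ν d ∷ go ν d

  leHead : ℕ → List ℕ → Bool
  leHead e []      = true
  leHead e (f ∷ _) = e ≤ᵇ f

  increasing : List ℕ → Bool
  increasing []      = true
  increasing (e ∷ v) = leHead e v ∧ increasing v

  -- A row is never above a longer one; with this convention above-++ needs no
  -- hypothesis on lengths.
  above : List ℕ → List ℕ → Bool
  above _       []      = true
  above []      (_ ∷ _) = false
  above (e ∷ u) (f ∷ v) = (e <ᵇ f) ∧ above u v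

  ≤ᵇ-suc : ∀ a b → (suc a ≤ᵇ suc b) ≡ (a ≤ᵇ b)
  ≤ᵇ-suc zero    b = refl
  ≤ᵇ-suc (suc a) b = refl

  ≤ᵇ-+ʳ : ∀ a b k → (a + k ≤ᵇ b + k) ≡ (a ≤ᵇ b)
  ≤ᵇ-+ʳ a b zero rewrite ℕ.+-identityʳ a | ℕ.+-identityʳ b = refl
  ≤ᵇ-+ʳ a b (suc k) rewrite ℕ.+-suc a k | ℕ.+-suc b k = trans (≤ᵇ-suc (a + k) (b + k)) (≤ᵇ-+ʳ a b k)

  leHead-++ : ∀ {e m} v d → e < m → leHead e (v ++ replicate d m) ≡ leHead e v
  leHead-++ []      zero    _   = refl
  leHead-++ []      (suc d) e<m = ≤⇒≤ᵇ-true (ℕ.<⇒≤ e<m)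
  leHead-++ (f ∷ v) d       _   = refl

  -- Origin of the interlacing condition. No letter present exceeds `m`, so nothing may stand below
  -- an `m`: the lower row must fit under the part `u` of the upper row. There, an `m` of the lower
  -- row is automatically larger than the letter above it.
  above-++ : ∀ {m} u v c d → All (_< m) u → All (_< m) v →
    above (u ++ replicate c m) (v ++ replicate d m) ≡ (length v + d ≤ᵇ length u) ∧ above u v
  above-++         []      []      c       zero    _           _           = refl
  above-++         (_ ∷ _) []      c       zero    _           _           = refl
  above-++         []      []      zero    (suc d) _           _           = refl
  above-++ {m}     []      []      (suc c) (suc d) _           _           rewrite ≰⇒≤ᵇ-false (ℕ.n≮n m) = refl
  above-++         []      (f ∷ v) zero    d       _           _           = refl
  above-++ {m}     []      (f ∷ v) (suc c) d       _           (f<m ∷ _)   rewrite ≰⇒≤ᵇ-false (ℕ.<⇒≯ f<m) = refl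
  above-++         (e ∷ u) []      c       (suc d) (e<m ∷ u<m) _           rewrite ≤⇒≤ᵇ-true e<m =
    trans (above-++ u [] c d u<m []) (cong₂ _∧_ (sym (≤ᵇ-suc d (length u))) refl)
  above-++         (e ∷ u) (f ∷ v) c       d       (_ ∷ u<m)   (_ ∷ v<m)   = begin
    (e <ᵇ f) ∧ above (u ++ replicate c _) (v ++ replicate d _) ≡⟨ cong ((e <ᵇ f) ∧_) (above-++ u v c d u<m v<m) ⟩
    (e <ᵇ f) ∧ (n ∧ above u v)                             ≡⟨ ∧-assoc (e <ᵇ f) n _ ⟨
    ((e <ᵇ f) ∧ n) ∧ above u v                             ≡⟨ cong (_∧ above u v) (∧-comm (e <ᵇ f) n) ⟩
    (n ∧ (e <ᵇ f)) ∧ above u v                             ≡⟨ ∧-assoc n _ _ ⟩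
    n ∧ ((e <ᵇ f) ∧ above u v)                             ≡⟨ cong (_∧ _) (≤ᵇ-suc (length v + d) (length u)) ⟨
    (suc (length v + d) ≤ᵇ suc (length u)) ∧ ((e <ᵇ f) ∧ above u v) ∎
    where
    open ≡-Reasoning
    n = length v + d ≤ᵇ length u

  open Algebra.Properties.CommutativeSemigroup ℕ.+-commutativeSemigroup public using (xy∙z≈xz∙y)

  exchange-suc : ∀ a b s → b + (suc a + s) ≡ a + (suc b + s)
  exchange-suc = solve 3 (λ a b s → b :+ (con 1 :+ a :+ s) := a :+ (con 1 :+ b :+ s)) refl
    where open ℕ.+-*-Solver

  -- Moving one particle, and the inductive description of the outcome as a ribbon.

  module _ {ℓ : ℕ} where
    -- Parts are particles at positions (part + number of rows below). A moved
    -- particle overtaking the particle of a part a turns the parts a , suc b into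
    -- b , suc a; the first component counts the overtakings.
    data Push (a : ℕ) : ℕ × Vec ℕ (suc ℓ) → ℕ × Vec ℕ (suc (suc ℓ)) → Set where
      keep : ∀ {h b β} → b ≤ a → Push a (h , b ∷ β) (h , a ∷ b ∷ β)
      pass : ∀ {h b β} → a < b → Push a (h , suc b ∷ β) (suc h , b ∷ suc a ∷ β)

    push : ℕ → ℕ × Vec ℕ (suc ℓ) → List (ℕ × Vec ℕ (suc (suc ℓ)))
    push a (h , b ∷ β) with ℕ.<-cmp b (suc a)
    ... | tri< _ _ _ = (h , a ∷ b ∷ β) ∷ []
    -- The part `a` has one more row below it than `b`, so for `b ≡ suc a` the two particles
    -- collide.
    ... | tri≈ _ _ _ = []
    ... | tri> _ _ _ = (suc h , pred b ∷ suc a ∷ β) ∷ []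

    push⁻ : ∀ a x {z} → z ∈ push a x → Push a x z
    push⁻ a (h , b ∷ β) z∈ with ℕ.<-cmp b (suc a)
    push⁻ a (h , b ∷ β)     (here refl) | tri< b≤a _ _ = keep (s≤s⁻¹ b≤a)
    push⁻ a (h , suc b ∷ β) (here refl) | tri> _ _ a<b = pass (s≤s⁻¹ a<b)

    push⁺ : ∀ {a x z} → Push a x z → z ∈ push a x
    push⁺ {a} (keep {b = b} b≤a) with ℕ.<-cmp b (suc a)
    ... | tri< _ _ _   = here refl
    ... | tri≈ b≮ _ _  = contradiction (s≤s b≤a) b≮
    ... | tri> b≮ _ _  = contradiction (s≤s b≤a) b≮
    push⁺ {a} (pass {b = b} a<b) with ℕ.<-cmp (suc b) (suc a)
    ... | tri< _ _ a≮ = contradiction (s≤s a<b) a≮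
    ... | tri≈ _ _ a≮ = contradiction (s≤s a<b) a≮
    ... | tri> _ _ _  = here refl

    -- The first part of the result reveals the case: it is `a` after `keep` and larger than `a`
    -- after `pass`.
    push-injective : ∀ {a x x′ z z′} → Push a x z → Push a x′ z′ → proj₂ z ≡ proj₂ z′ → proj₂ x ≡ proj₂ x′
    push-injective (keep _)   (keep _)   refl = refl
    push-injective (keep _)   (pass a<b) refl = contradiction a<b (ℕ.n≮n _)
    push-injective (pass a<b) (keep _)   refl = contradiction a<b (ℕ.n≮n _)
    push-injective (pass _)   (pass _)   refl = refl

  moves : ∀ {ℓ} → ℕ → Vec ℕ ℓ → List (ℕ × Vec ℕ ℓ)
  moves N []          = []
  moves N (a ∷ [])    = (0 , a + N ∷ []) ∷ []
  moves N (a ∷ b ∷ α) = (0 , a + N ∷ b ∷ α) ∷ concatMap (push a) (moves N (b ∷ α))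

  -- RibbonTail c α μ h: the rows below a ribbon row whose α-part is c; the next
  -- ribbon row must overlap it in exactly one column, so its μ-part is suc c.
  -- The last index h counts these rows, i.e. it is the height of the ribbon.
  data RibbonTail : ∀ {ℓ} → ℕ → Vec ℕ ℓ → Vec ℕ ℓ → ℕ → Set where
    stop : ∀ {ℓ c} {α : Vec ℕ ℓ} → RibbonTail c α α 0
    next : ∀ {ℓ c a h} {α μ : Vec ℕ ℓ} → RibbonTail a α μ h → RibbonTail c (a ∷ α) (suc c ∷ μ) (suc h)

  data Ribbon : ∀ {ℓ} → Vec ℕ ℓ → Vec ℕ ℓ → ℕ → Set where
    skip  : ∀ {ℓ a h} {α μ : Vec ℕ ℓ} → Ribbon α μ h → Ribbon (a ∷ α) (a ∷ μ) h
    start : ∀ {ℓ a b h} {α μ : Vec ℕ ℓ} → a < b → RibbonTail a α μ h → Ribbon (a ∷ α) (b ∷ μ) h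

  Part : ∀ {ℓ} → ℕ → Vec ℕ ℓ → Set
  Part M α = Descending M (toList α)

  tail-part : ∀ {ℓ c b h} {α μ : Vec ℕ ℓ} → RibbonTail c α μ h → Part c α → Part b μ → Part (suc c) μ
  tail-part stop     d _       = descending-weaken (ℕ.n≤1+n _) d
  tail-part (next t) _ (_ ∷ d) = ℕ.≤-refl ∷ d

  push-sound : ∀ {ℓ M a x z} N (α : Vec ℕ (suc ℓ)) → Push a x z → a ≤ M → Part a α →
    Ribbon α (proj₂ x) (proj₁ x) × Part (a + N) (proj₂ x) × Vec.sum (proj₂ x) ≡ Vec.sum α + N →
    Ribbon (a ∷ α) (proj₂ z) (proj₁ z) × Part (M + N) (proj₂ z) × Vec.sum (proj₂ z) ≡ Vec.sum (a ∷ α) + N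
  push-sound {a = a} N α (keep b≤a) a≤M d (rib , _ ∷ dβ , size) =
    skip rib , (ℕ.m≤n⇒m≤n+o N a≤M ∷ b≤a ∷ dβ) , trans (cong (a +_) size) (sym (ℕ.+-assoc a _ N))
  -- The next particle was not the one moved, so its part is still at most `a` and it cannot
  -- overtake.
  push-sound N α (pass a<b) a≤M (b<a ∷ _) (skip _ , _) =
    contradiction (ℕ.≤-trans (ℕ.n≤1+n _) b<a) (ℕ.<⇒≱ a<b)
  -- The ribbon began one row lower. Overtaking lifts its beginning into the row of `a` and leaves
  -- the part `suc a` below, which is exactly the overlap that `next` demands.
  push-sound {a = a} N (a₁ ∷ α) (pass {b = b} {β} a<b) a≤M (a₁≤a ∷ d) (start _ t , b<a+N ∷ dβ , size) =
    start a<b (next t) ,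
    (ℕ.≤-trans (ℕ.n≤1+n b) (ℕ.≤-trans b<a+N (ℕ.+-monoˡ-≤ N a≤M)) ∷ a<b ∷ descending-weaken (s≤s a₁≤a) (tail-part t d dβ)) ,
    trans (exchange-suc a b (Vec.sum β)) (trans (cong (a +_) size) (sym (ℕ.+-assoc a _ N)))

  moves-sound : ∀ {ℓ M} N .{{_ : NonZero N}} (α : Vec ℕ ℓ) → Part M α → ∀ {h μ} → (h , μ) ∈ moves N α →
    Ribbon α μ h × Part (M + N) μ × Vec.sum μ ≡ Vec.sum α + N
  moves-sound N (a ∷ []) (a≤M ∷ d) (here refl) =
    start (ℕ.m<m+n a (>-nonZero⁻¹ N)) stop , ℕ.+-monoˡ-≤ N a≤M ∷ [] , xy∙z≈xz∙y a N 0
  moves-sound N (a ∷ b ∷ α) (a≤M ∷ d) (here refl) =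
    start (ℕ.m<m+n a (>-nonZero⁻¹ N)) stop , ℕ.+-monoˡ-≤ N a≤M ∷ descending-weaken (ℕ.m≤m+n a N) d , xy∙z≈xz∙y a N (b + Vec.sum α)
  moves-sound N (a ∷ α@(_ ∷ _)) (a≤M ∷ d) (there z∈)
    with x , x∈ , z∈′ ← find (∈-concatMap⁻ (push a) {xs = moves N α} z∈) =
    push-sound N α (push⁻ a x z∈′) a≤M d (moves-sound N α d x∈)

  -- The ribbon dictates which case of `push` to undo in each row. The size equation then fixes the
  -- distance of the move in the lowest row of the ribbon.
  moves-complete : ∀ {ℓ M M′ h} N (α μ : Vec ℕ ℓ) → Ribbon α μ h → Part M α → Part M′ μ →
    Vec.sum μ ≡ Vec.sum α + N → (h , μ) ∈ moves N α
  moves-complete N (a ∷ []) (b ∷ []) (start _ stop) _ _ size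
    with refl ← trans (sym (ℕ.+-identityʳ b)) (trans size (cong (_+ N) (ℕ.+-identityʳ a))) = here refl
  moves-complete N (a ∷ α@(_ ∷ _)) (_ ∷ μ@(_ ∷ _)) (skip rib) (_ ∷ d) (_ ∷ b≤a ∷ dμ) size =
    there (∈-concatMap⁺ (push a) (lose
      (moves-complete N α μ rib d (b≤a ∷ dμ) (ℕ.+-cancelˡ-≡ a _ _ (trans size (ℕ.+-assoc a _ N))))
      (push⁺ (keep b≤a))))
  moves-complete N (a ∷ α@(_ ∷ _)) (b ∷ _) (start _ stop) _ _ size
    with refl ← ℕ.+-cancelʳ-≡ (Vec.sum α) b (a + N) (trans size (xy∙z≈xz∙y a (Vec.sum α) N)) = here refl
  -- Undoing the overtaking gives the row below the part `suc b`, so the shorter ribbon begins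
  -- there.
  moves-complete N (a ∷ α@(a₁ ∷ α₁)) (b ∷ _ ∷ β) (start a<b (next t)) (_ ∷ a₁≤a ∷ d) (_ ∷ _ ∷ dβ) size =
    there (∈-concatMap⁺ (push a) (lose
      (moves-complete N α (suc b ∷ β) (start (s≤s (ℕ.≤-trans a₁≤a (ℕ.<⇒≤ a<b))) t) (a₁≤a ∷ d)
        (ℕ.≤-refl ∷ descending-weaken (ℕ.≤-trans a<b (ℕ.n≤1+n b)) dβ)
        (ℕ.+-cancelˡ-≡ a _ _ (trans (exchange-suc b a (Vec.sum β)) (trans size (ℕ.+-assoc a _ N)))))
      (push⁺ (pass a<b))))

  moves-unique : ∀ {ℓ M} N .{{_ : NonZero N}} (α : Vec ℕ ℓ) → Part M α → Unique (map proj₂ (moves N α))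
  moves-unique N []          _        = []
  moves-unique N (a ∷ [])    _        = [] ∷ []
  moves-unique N (a ∷ b ∷ α) (_ ∷ d@(b≤a ∷ _)) =
    All.tabulate (λ z∈ eq → distinct z∈ (sym eq)) ∷ rest (moves N (b ∷ α)) (moves-unique N (b ∷ α) d)
    where
    origin : ∀ xs {μ} → μ ∈ map proj₂ (concatMap (push a) xs) →
      ∃₂ λ x z → x ∈ xs × Push a x z × μ ≡ proj₂ z
    origin xs μ∈ with z , z∈ , refl ← ∈-map⁻ proj₂ μ∈
                 with x , x∈ , z∈′ ← find (∈-concatMap⁻ (push a) {xs = xs} z∈) = x , z , x∈ , push⁻ a x z∈′ , refl
    distinct : ∀ {μ} → μ ∈ map proj₂ (concatMap (push a) (moves N (b ∷ α))) → ¬ μ ≡ a + N ∷ b ∷ α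
    distinct μ∈ eq with origin (moves N (b ∷ α)) μ∈
    ... | _ , _ , _ , keep _ , refl = ℕ.<⇒≢ (ℕ.m<m+n a (>-nonZero⁻¹ N)) (proj₁ (Vec.∷-injective eq))
    ... | _ , _ , _ , pass _ , refl = ℕ.<⇒≢ (s≤s b≤a) (sym (proj₁ (Vec.∷-injective (proj₂ (Vec.∷-injective eq)))))
    rest : ∀ xs → Unique (map proj₂ xs) → Unique (map proj₂ (concatMap (push a) xs))
    rest []       _         = []
    rest (x ∷ xs) (x∉ ∷ u) = subst Unique (sym (map-++ proj₂ (push a x) _))
      (Unique.++⁺ (single x) (rest xs u) λ (μ∈ , μ∈′) → clash μ∈ (origin xs μ∈′))
      where
      single : ∀ x → Unique (map proj₂ (push a x))
      single (h , c ∷ β) with ℕ.<-cmp c (suc a)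
      ... | tri< _ _ _ = [] ∷ []
      ... | tri≈ _ _ _ = []
      ... | tri> _ _ _ = [] ∷ []
      clash : ∀ {μ} → μ ∈ map proj₂ (push a x) → ¬ (∃₂ λ x′ z → x′ ∈ xs × Push a x′ z × μ ≡ proj₂ z)
      clash μ∈ (x′ , z , x′∈ , p , refl) with z′ , z′∈ , eq ← ∈-map⁻ proj₂ μ∈ =
        All.lookup x∉ (∈-map⁺ proj₂ x′∈) (push-injective (push⁻ a x z′∈) p (sym eq))

  -- Young diagrams and skew diagrams, row by row.

  -- Rows past the end have length 0, so statements about the row `suc i` need no bound on `i`.
  at : ∀ {ℓ} → Vec ℕ ℓ → ℕ → ℕ
  at []      _       = 0
  at (a ∷ α) zero    = a
  at (a ∷ α) (suc i) = at α i

  lookup≡at : ∀ {ℓ} (α : Vec ℕ ℓ) i → lookup α i ≡ at α (toℕ i)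
  lookup≡at (a ∷ α) Fin.zero    = refl
  lookup≡at (a ∷ α) (Fin.suc i) = lookup≡at α i

  at-extensional : ∀ {ℓ} (α μ : Vec ℕ ℓ) → (∀ i → at α i ≡ at μ i) → α ≡ μ
  at-extensional []      []      eq = refl
  at-extensional (a ∷ α) (b ∷ μ) eq = cong₂ _∷_ (eq 0) (at-extensional α μ (eq ∘ suc))

  at-beyond : ∀ {ℓ} (α : Vec ℕ ℓ) {i} → ℓ ≤ i → at α i ≡ 0
  at-beyond []      _         = refl
  at-beyond (a ∷ α) (s≤s ℓ≤i) = at-beyond α ℓ≤i

  part-at : ∀ {ℓ M} (α : Vec ℕ ℓ) → Part M α → ∀ i → at α (suc i) ≤ at α i
  part-at []          _               i       = z≤n
  part-at (a ∷ [])    _               i       = z≤n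
  part-at (a ∷ b ∷ α) (_ ∷ b≤a ∷ _)   zero    = b≤a
  part-at (a ∷ b ∷ α) (_ ∷ d)         (suc i) = part-at (b ∷ α) d i

  isPartition⇒part : ∀ {ℓ} (α : Vec ℕ ℓ) → IsPartition α → Part (Vec.sum α) α
  isPartition⇒part α p = go α p λ i → lookup≤sum α i
    where
    go : ∀ {ℓ M} (α : Vec ℕ ℓ) → IsPartition α → (∀ i → lookup α i ≤ M) → Part M α
    go []      p α≤M = []
    go (a ∷ α) p α≤M = α≤M Fin.zero ∷
      go α (λ i j i≤j → p (Fin.suc i) (Fin.suc j) (s≤s i≤j)) (λ i → p Fin.zero (Fin.suc i) z≤n)

  part⇒isPartition : ∀ {ℓ M} (α : Vec ℕ ℓ) → Part M α → IsPartition α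
  part⇒isPartition α d i j i≤j rewrite lookup≡at α i | lookup≡at α j = go (ℕ.≤⇒≤′ i≤j)
    where
    go : ∀ {i j} → i ≤′ j → at α j ≤ at α i
    go ≤′-refl           = ℕ.≤-refl
    go (≤′-step {j} i≤j) = ℕ.≤-trans (part-at α d j) (go i≤j)

  ∈-diagram-at : ∀ {ℓ} (α : Vec ℕ ℓ) {i j} → (i , j) ∈ diagram α ⇔ j < at α i
  ∈-diagram-at {ℓ} α {i} {j} with i ℕ.<? ℓ
  ... | yes i<ℓ = subst (λ i → (i , j) ∈ diagram α ⇔ j < at α i) (Fin.toℕ-fromℕ< i<ℓ)
    (subst (λ a → (toℕ (Fin.fromℕ< i<ℓ) , j) ∈ diagram α ⇔ j < a) (lookup≡at α (Fin.fromℕ< i<ℓ)) (∈-diagram α (Fin.fromℕ< i<ℓ)))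
  ... | no i≮ℓ = mk⇔ (λ b∈ → contradiction (row< b∈) i≮ℓ)
    (λ j< → contradiction (subst (j <_) (at-beyond α (ℕ.≮⇒≥ i≮ℓ)) j<) ℕ.n≮0)
    where
    row< : (i , j) ∈ diagram α → i < ℓ
    row< b∈ with i′ , _ , b∈row ← find (∈-concatMap⁻ (λ i → map (toℕ i ,_) (upTo (lookup α i))) {xs = allFin ℓ} b∈)
            with _ , _ , refl ← ∈-map⁻ (toℕ i′ ,_) b∈row = Fin.toℕ<n i′

  ∈-skew : ∀ {ℓ} (α μ : Vec ℕ ℓ) {i j} → (i , j) ∈ μ / α ⇔ (at α i ≤ j × j < at μ i)
  ∈-skew α μ = mk⇔
    (λ b∈ → let b∈μ , b∉α = ∈-filter⁻ (_∉? diagram α) {xs = diagram μ} b∈ in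
      ℕ.≮⇒≥ (b∉α ∘ from (∈-diagram-at α)) , to (∈-diagram-at μ) b∈μ)
    (λ (α≤j , j<μ) → ∈-filter⁺ (_∉? diagram α) (from (∈-diagram-at μ) j<μ)
      (λ b∈α → ℕ.<⇒≱ (to (∈-diagram-at α) b∈α) α≤j))
    where open Equivalence

  concatMap-tabulate-length : ∀ {A B : Set} {ℓ} (f : A → List B) (g : Fin ℓ → A) →
    length (concatMap f (tabulate g)) ≡ Vec.sum (Vec.tabulate (length ∘ f ∘ g))
  concatMap-tabulate-length {ℓ = zero}  f g = refl
  concatMap-tabulate-length {ℓ = suc ℓ} f g = trans (length-++ (f (g Fin.zero)))
    (cong (length (f (g Fin.zero)) +_) (concatMap-tabulate-length f (g ∘ Fin.suc)))

  diagram-length : ∀ {ℓ} (α : Vec ℕ ℓ) → length (diagram α) ≡ Vec.sum α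
  diagram-length {ℓ} α = trans (concatMap-tabulate-length (λ (i : Fin ℓ) → map (toℕ i ,_) (upTo (lookup α i))) id) (cong Vec.sum (trans
    (Vec.tabulate-cong λ i → trans (length-map (toℕ i ,_) (upTo (lookup α i))) (length-upTo (lookup α i)))
    (Vec.tabulate∘lookup α)))

  diagram-unique : ∀ {ℓ} (α : Vec ℕ ℓ) → Unique (diagram α)
  diagram-unique {ℓ} α = Unique.concat⁺
    (All.map⁺ (All.tabulate λ {i} _ → Unique.map⁺ (cong proj₂) (Unique.upTo⁺ (lookup α i))))
    (AllPairs.map⁺ (AllPairs.map disjoint (Unique.allFin⁺ ℓ)))
    where
    disjoint : ∀ {i i′} → ¬ i ≡ i′ →
      ∀ {b} → ¬ (b ∈ map (toℕ i ,_) (upTo (lookup α i)) × b ∈ map (toℕ i′ ,_) (upTo (lookup α i′)))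
    disjoint {i} {i′} i≢i′ (b∈ , b∈′) with _ , _ , refl ← ∈-map⁻ (toℕ i ,_) b∈
                               with _ , _ , eq ← ∈-map⁻ (toℕ i′ ,_) b∈′ = i≢i′ (Fin.toℕ-injective (cong proj₁ eq))

  unique-length-≡ : ∀ {A : Set} {xs ys : List A} → Unique xs → Unique ys → xs ⊆ ys → ys ⊆ xs → length xs ≡ length ys
  unique-length-≡ u u′ s s′ = ℕ.≤-antisym (unique-length-≤ u s) (unique-length-≤ u′ s′)

  skew-size : ∀ {ℓ} (α μ : Vec ℕ ℓ) → diagram α ⊆ diagram μ → length (μ / α) + Vec.sum α ≡ Vec.sum μ
  skew-size α μ α⊆μ = begin
    length (μ / α) + Vec.sum α            ≡⟨ cong (length (μ / α) +_) (diagram-length α) ⟨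
    length (μ / α) + length (diagram α)   ≡⟨ length-++ (μ / α) ⟨
    length (μ / α ++ diagram α)           ≡⟨ unique-length-≡ unique (diagram-unique μ) only all ⟩
    length (diagram μ)                    ≡⟨ diagram-length μ ⟩
    Vec.sum μ                             ∎
    where
    open ≡-Reasoning
    skew⁻ : ∀ {b} → b ∈ μ / α → b ∈ diagram μ × ¬ b ∈ diagram α
    skew⁻ = ∈-filter⁻ (_∉? diagram α) {xs = diagram μ}
    unique : Unique (μ / α ++ diagram α)
    unique = Unique.++⁺ (Unique.filter⁺ (_∉? diagram α) (diagram-unique μ)) (diagram-unique α)
      λ (b∈ , b∈α) → proj₂ (skew⁻ b∈) b∈α
    only : μ / α ++ diagram α ⊆ diagram μ
    only b∈ with ∈-++⁻ (μ / α) b∈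
    ... | inj₁ b∈skew = proj₁ (skew⁻ b∈skew)
    ... | inj₂ b∈α    = α⊆μ b∈α
    all : diagram μ ⊆ μ / α ++ diagram α
    all {b} b∈μ with b ∈? diagram α
    ... | yes b∈α = ∈-++⁺ʳ (μ / α) b∈α
    ... | no b∉α  = ∈-++⁺ˡ (∈-filter⁺ (_∉? diagram α) b∈μ b∉α)

  -- Inductive ribbons are connected and contain no square.

  -- A ribbon in the rows from `t` to `t + h`. By `link`, the last box of each lower row lies in the
  -- column of the first box of the row above it.
  record Strip {ℓ} (α μ : Vec ℕ ℓ) (t h : ℕ) : Set where
    field
      inside : ∀ i → t ≤ i → i ≤ t + h → at α i < at μ i
      before : ∀ i → i < t → at α i ≡ at μ i
      after  : ∀ i → t + h < i → at α i ≡ at μ i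
      link   : ∀ i → t ≤ i → i < t + h → at μ (suc i) ≡ suc (at α i)

  open Strip

  tail⇒strip : ∀ {ℓ a b h} {α μ : Vec ℕ ℓ} → a < b → Part a α → RibbonTail a α μ h → Strip (a ∷ α) (b ∷ μ) 0 h
  tail⇒strip a<b d stop = record
    { inside = λ { zero _ _ → a<b }
    ; before = λ _ ()
    ; after  = λ { (suc i) _ → refl }
    ; link   = λ _ _ ()
    }
  tail⇒strip a<b (a₁≤a ∷ d) (next t) = record
    { inside = λ { zero _ _ → a<b ; (suc i) _ i≤h → inside rest i z≤n (s≤s⁻¹ i≤h) }
    ; before = λ _ ()
    ; after  = λ { (suc i) h<i → after rest i (s≤s⁻¹ h<i) }
    ; link   = λ { zero _ _ → refl ; (suc i) _ i<h → link rest i z≤n (s≤s⁻¹ i<h) }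
    }
    where rest = tail⇒strip (s≤s a₁≤a) d t

  ribbon⇒strip : ∀ {ℓ M h} {α μ : Vec ℕ ℓ} → Part M α → Ribbon α μ h → ∃ λ t → Strip α μ t h
  ribbon⇒strip (_ ∷ d) (start a<b t) = 0 , tail⇒strip a<b d t
  ribbon⇒strip (_ ∷ d) (skip rib) with t , strip ← ribbon⇒strip d rib = suc t , record
    { inside = λ { (suc i) t≤i i≤t+h → inside strip i (s≤s⁻¹ t≤i) (s≤s⁻¹ i≤t+h) }
    ; before = λ { zero _ → refl ; (suc i) i<t → before strip i (s≤s⁻¹ i<t) }
    ; after  = λ { (suc i) t+h<i → after strip i (s≤s⁻¹ t+h<i) }
    ; link   = λ { (suc i) t≤i i<t+h → link strip i (s≤s⁻¹ t≤i) (s≤s⁻¹ i<t+h) }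
    }

  module FromStrip {ℓ t h M} (α μ : Vec ℕ ℓ) (d : Part M α) (strip : Strip α μ t h) where
    open Equivalence

    at-≤ : ∀ i → at α i ≤ at μ i
    at-≤ i with i ℕ.<? t | t + h ℕ.<? i
    ... | yes i<t | _         = ℕ.≤-reflexive (before strip i i<t)
    ... | no _    | yes t+h<i = ℕ.≤-reflexive (after strip i t+h<i)
    ... | no i≮t  | no t+h≮i  = ℕ.<⇒≤ (inside strip i (ℕ.≮⇒≥ i≮t) (ℕ.≮⇒≥ t+h≮i))

    contained : diagram α ⊆ diagram μ
    contained b∈ = from (∈-diagram-at μ) (ℕ.≤-trans (to (∈-diagram-at α) b∈) (at-≤ _))

    row-bounds : ∀ {i j} → (i , j) ∈ μ / α → t ≤ i × i ≤ t + h
    row-bounds {i} b∈ with α≤j , j<μ ← to (∈-skew α μ) b∈ =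
      ℕ.≮⇒≥ (λ i<t → ℕ.<⇒≢ (ℕ.≤-<-trans α≤j j<μ) (before strip i i<t)) ,
      ℕ.≮⇒≥ (λ t+h<i → ℕ.<⇒≢ (ℕ.≤-<-trans α≤j j<μ) (after strip i t+h<i))

    -- By `link` two consecutive rows share a single column, while a square needs two.
    noSquare : ¬ HasSquare (μ / α)
    noSquare ((i , j) , b∈ , _ , _ , b∈′) with t≤i , _ ← row-bounds b∈ | _ , i<t+h ← row-bounds b∈′ =
      ℕ.<⇒≱ (proj₂ (to (∈-skew α μ) b∈′))
        (subst (_≤ suc j) (sym (link strip i t≤i i<t+h)) (s≤s (proj₁ (to (∈-skew α μ) b∈))))

    S = μ / α

    step-sym : ∀ {a b} → Step S a b → Step S b a
    step-sym {i , j} {i′ , j′} (a∈ , b∈ , edge) =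
      b∈ , a∈ , trans (cong₂ _+_ (ℕ.∣-∣-comm i′ i) (ℕ.∣-∣-comm j′ j)) edge

    leftward : ∀ i e → (i , at α i + e) ∈ S → Star (Step S) (i , at α i + e) (i , at α i)
    leftward i zero    b∈ rewrite ℕ.+-identityʳ (at α i) = ε
    leftward i (suc e) b∈ = (b∈ , b∈′ , edge) ◅ leftward i e b∈′
      where
      b∈′ : (i , at α i + e) ∈ S
      b∈′ = from (∈-skew α μ) (ℕ.m≤m+n _ e , ℕ.<-trans (ℕ.+-monoʳ-< (at α i) ℕ.≤-refl) (proj₂ (to (∈-skew α μ) b∈)))
      edge : ∣ i - i ∣ + ∣ at α i + suc e - at α i + e ∣ ≡ 1
      edge = cong₂ _+_ (ℕ.∣n-n∣≡0 i) (trans (ℕ.∣m+n-m+o∣≡∣n-o∣ (at α i) (suc e) e)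
        (trans (ℕ.∣-∣-comm (suc e) e) (trans (ℕ.m≤n⇒∣m-n∣≡n∸m (ℕ.n≤1+n e)) (ℕ.m+n∸n≡m 1 e))))

    -- Every box is joined to the lower left end of the ribbon: left to the start of its row, down
    -- the shared column, and so on. The number `g` counts the rows still to descend, which makes
    -- the recursion well founded.
    to-tail : ∀ g {i j} → i + g ≡ t + h → (i , j) ∈ S → Star (Step S) (i , j) (t + h , at α (t + h))
    to-tail g {i} {j} eq b∈ with e , refl ← ℕ.m≤n⇒∃[o]m+o≡n (proj₁ (to (∈-skew α μ) b∈)) =
      leftward i e b∈ ◅◅ go g eq
      where
      t≤i = proj₁ (row-bounds b∈)
      go : ∀ g → i + g ≡ t + h → Star (Step S) (i , at α i) (t + h , at α (t + h))
      go zero    eq rewrite sym eq | ℕ.+-identityʳ i = ε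
      go (suc g) eq = (start∈ , below∈ , edge) ◅ to-tail g (trans (sym (ℕ.+-suc i g)) eq) below∈
        where
        i<t+h : i < t + h
        i<t+h = subst (i <_) eq (ℕ.m<m+n i (s≤s z≤n))
        start∈ : (i , at α i) ∈ S
        start∈ = from (∈-skew α μ) (ℕ.≤-refl , inside strip i t≤i (ℕ.<⇒≤ i<t+h))
        below∈ : (suc i , at α i) ∈ S
        below∈ = from (∈-skew α μ) (part-at α d i , subst (at α i <_) (sym (link strip i t≤i i<t+h)) ℕ.≤-refl)
        edge : ∣ i - suc i ∣ + ∣ at α i - at α i ∣ ≡ 1
        edge = cong₂ _+_ (trans (ℕ.m≤n⇒∣m-n∣≡n∸m (ℕ.n≤1+n i)) (ℕ.m+n∸n≡m 1 i)) (ℕ.∣n-n∣≡0 (at α i))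

    connected : Connected S
    connected a b a∈ b∈ = path a∈ ◅◅ reverse step-sym (path b∈)
      where
      path : ∀ {b} → b ∈ S → Star (Step S) b (t + h , at α (t + h))
      path b∈ with g , eq ← ℕ.m≤n⇒∃[o]m+o≡n (proj₂ (row-bounds b∈)) = to-tail g eq b∈

    height≡ : height S ≡ h
    height≡ = cong (_∸ 1) (trans
      (unique-length-≡ (UniqueDec.deduplicate-! ℕ._≟_ (map proj₁ S))
        (Unique.applyUpTo⁺₁ (t +_) (suc h) λ i<j _ eq → ℕ.<⇒≢ i<j (ℕ.+-cancelˡ-≡ t _ _ eq)) only all)
      (length-applyUpTo (t +_) (suc h)))
      where
      only : deduplicate ℕ._≟_ (map proj₁ S) ⊆ applyUpTo (t +_) (suc h)
      only i∈ with (i , j) , b∈ , refl ← ∈-map⁻ proj₁ (∈-deduplicate⁻ ℕ._≟_ (map proj₁ S) i∈)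
              with t≤i , i≤t+h ← row-bounds b∈
              with g , refl ← ℕ.m≤n⇒∃[o]m+o≡n t≤i = ∈-applyUpTo⁺ (t +_) (s≤s (ℕ.+-cancelˡ-≤ t _ _ i≤t+h))
      all : applyUpTo (t +_) (suc h) ⊆ deduplicate ℕ._≟_ (map proj₁ S)
      all i∈ with g , g≤h , refl ← ∈-applyUpTo⁻ (t +_) i∈ = ∈-deduplicate⁺ ℕ._≟_
        (∈-map⁺ proj₁ (from (∈-skew α μ) (ℕ.≤-refl , inside strip (t + g) (ℕ.m≤m+n t g) (ℕ.+-monoʳ-≤ t (s≤s⁻¹ g≤h)))))

  -- Connected skew shapes without squares are inductive ribbons.

  -- What the geometry says about row lengths: `narrow` comes from the absence of squares and
  -- `joined` from connectedness. Together they force the one-column overlap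
  -- `at μ (suc i) ≡ suc (at α i)` wherever the ribbon continues.
  record RibbonRows {ℓ} (α μ : Vec ℕ ℓ) : Set where
    field
      contained : ∀ i → at α i ≤ at μ i
      narrow    : ∀ i → at μ (suc i) ≤ suc (at α i)
      joined    : ∀ {i₁ i₂} i → i₁ ≤ i → i < i₂ → at α i₁ < at μ i₁ → at α i₂ < at μ i₂ → at α i < at μ (suc i)

  open RibbonRows

  tail-rows : ∀ {ℓ a b} {α μ : Vec ℕ ℓ} → RibbonRows (a ∷ α) (b ∷ μ) → RibbonRows α μ
  tail-rows rows = record
    { contained = λ i → contained rows (suc i)
    ; narrow    = λ i → narrow rows (suc i)
    ; joined    = λ i i₁≤i i<i₂ → joined rows (suc i) (s≤s i₁≤i) (s≤s i<i₂)
    }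

  rows⇒tail : ∀ {ℓ a b} (α μ : Vec ℕ ℓ) → Part a α → RibbonRows (a ∷ α) (b ∷ μ) → a < b → ∃ (RibbonTail a α μ)
  rows⇒tail []       []       _          _    _   = 0 , stop
  rows⇒tail {a = a} (a₁ ∷ α) (b₁ ∷ μ) (a₁≤a ∷ d) rows a<b with a₁ ℕ.<? b₁
  ... | yes a₁<b₁ with h , t ← rows⇒tail α μ d (tail-rows rows) a₁<b₁
                  with refl ← ℕ.≤-antisym (narrow rows 0) (joined rows {0} {1} 0 z≤n (s≤s z≤n) a<b a₁<b₁) = suc h , next t
  -- The ribbon ends here: a nonempty row further down would, by `joined`, give `a < b₁` and hence
  -- `a₁ < b₁`.
  ... | no a₁≮b₁ = 0 , subst (λ μ → RibbonTail a (a₁ ∷ α) μ 0) (at-extensional _ _ equal) stop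
    where
    empty : ∀ i → ¬ at (a₁ ∷ α) i < at (b₁ ∷ μ) i
    empty i nonempty = a₁≮b₁ (ℕ.≤-<-trans a₁≤a (joined rows {0} {suc i} 0 z≤n (s≤s z≤n) a<b nonempty))
    equal : ∀ i → at (a₁ ∷ α) i ≡ at (b₁ ∷ μ) i
    equal i = ℕ.≤-antisym (contained rows (suc i)) (ℕ.≮⇒≥ (empty i))

  -- The inequality of sizes supplies a first nonempty row. It excludes the empty skew shape, which
  -- is vacuously connected and free of squares.
  rows⇒ribbon : ∀ {ℓ M} (α μ : Vec ℕ ℓ) → Part M α → RibbonRows α μ → Vec.sum α < Vec.sum μ → ∃ (Ribbon α μ)
  rows⇒ribbon (a ∷ α) (b ∷ μ) (_ ∷ d) rows α<μ with a ℕ.<? b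
  ... | yes a<b with h , t ← rows⇒tail α μ d rows a<b = h , start a<b t
  ... | no a≮b with refl ← ℕ.≤-antisym (contained rows 0) (ℕ.≮⇒≥ a≮b)
               with h , rib ← rows⇒ribbon α μ d (tail-rows rows) (ℕ.+-cancelˡ-< a _ _ α<μ) = h , skip rib

  edge-down : ∀ {i i₁ i₂} j₁ j₂ → i₁ ≤ i → i < i₂ → ∣ i₁ - i₂ ∣ + ∣ j₁ - j₂ ∣ ≡ 1 → i₁ ≡ i × i₂ ≡ suc i × j₁ ≡ j₂
  edge-down {i} {i₁} {i₂} j₁ j₂ i₁≤i i<i₂ edge = i₁≡i , i₂≡ , ℕ.∣m-n∣≡0⇒m≡n (ℕ.n≤0⇒n≡0 (s≤s⁻¹ (begin
      suc ∣ j₁ - j₂ ∣               ≤⟨ ℕ.+-monoˡ-≤ ∣ j₁ - j₂ ∣ gap≥1 ⟩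
      ∣ i₁ - i₂ ∣ + ∣ j₁ - j₂ ∣     ≡⟨ edge ⟩
      1                             ∎)))
    where
    open ℕ.≤-Reasoning
    i₁<i₂ : i₁ < i₂
    i₁<i₂ = ℕ.≤-<-trans i₁≤i i<i₂
    gap : ∣ i₁ - i₂ ∣ ≡ i₂ ∸ i₁
    gap = ℕ.m≤n⇒∣m-n∣≡n∸m (ℕ.<⇒≤ i₁<i₂)
    gap≥1 : 1 ≤ ∣ i₁ - i₂ ∣
    gap≥1 = subst (1 ≤_) (sym gap) (ℕ.m<n⇒0<n∸m i₁<i₂)
    i₂≤ : i₂ ≤ suc i₁
    i₂≤ = begin
      i₂              ≡⟨ ℕ.m∸n+n≡m (ℕ.<⇒≤ i₁<i₂) ⟨
      i₂ ∸ i₁ + i₁    ≡⟨ cong (_+ i₁) gap ⟨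
      ∣ i₁ - i₂ ∣ + i₁ ≤⟨ ℕ.+-monoˡ-≤ i₁ (ℕ.m+n≤o⇒m≤o _ (ℕ.≤-reflexive edge)) ⟩
      suc i₁          ∎
    i₁≡i : i₁ ≡ i
    i₁≡i = ℕ.≤-antisym i₁≤i (s≤s⁻¹ (ℕ.≤-trans i<i₂ i₂≤))
    i₂≡ : i₂ ≡ suc i
    i₂≡ = ℕ.≤-antisym (ℕ.≤-trans i₂≤ (s≤s i₁≤i)) i<i₂

  -- A discrete intermediate value argument: the first step that leaves the rows up to `i` changes
  -- the row, hence by exactly one and within one column.
  crossing : ∀ {S i₁ j₁ i₂ j₂} i → i₁ ≤ i → i < i₂ → Star (Step S) (i₁ , j₁) (i₂ , j₂) →
    ∃ λ j → (i , j) ∈ S × (suc i , j) ∈ S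
  crossing i i₁≤i i<i₂ ε = contradiction i₁≤i (ℕ.<⇒≱ i<i₂)
  crossing {j₁ = j₁} i i₁≤i i<i₂ (_◅_ {j = i′ , j′} (a∈ , b∈ , edge) path) with i ℕ.<? i′
  ... | no i≮i′  = crossing i (ℕ.≮⇒≥ i≮i′) i<i₂ path
  ... | yes i<i′ with refl , refl , refl ← edge-down j₁ j′ i₁≤i i<i′ edge = j₁ , a∈ , b∈

  isRibbon⇒rows : ∀ {ℓ M M′} (α μ : Vec ℕ ℓ) → Part M α → Part M′ μ → diagram α ⊆ diagram μ → IsRibbon (μ / α) → RibbonRows α μ
  isRibbon⇒rows α μ dα dμ α⊆μ (connected , noSquare) = record
    { contained = λ i → ℕ.≮⇒≥ λ μ<α → ℕ.n≮n _ (to (∈-diagram-at μ) (α⊆μ (from (∈-diagram-at α) μ<α)))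
    -- If the row `suc i` reached past column `at α i`, then this column and the next one would form
    -- a square with the row `i`.
    ; narrow    = λ i → ℕ.≮⇒≥ λ wide → let a<b = ℕ.<-trans ℕ.≤-refl wide in noSquare ((i , at α i) ,
        box ℕ.≤-refl (ℕ.≤-trans a<b (part-at μ dμ i)) ,
        box (ℕ.n≤1+n _) (ℕ.≤-trans wide (part-at μ dμ i)) ,
        box (part-at α dα i) a<b ,
        box (ℕ.m≤n⇒m≤1+n (part-at α dα i)) wide)
    ; joined    = λ i i₁≤i i<i₂ ne₁ ne₂ →
        let j , up∈ , down∈ = crossing i i₁≤i i<i₂ (connected _ _ (box ℕ.≤-refl ne₁) (box ℕ.≤-refl ne₂))
        in ℕ.≤-<-trans (proj₁ (to (∈-skew α μ) up∈)) (proj₂ (to (∈-skew α μ) down∈))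
    }
    where
    open Equivalence
    box : ∀ {i j} → at α i ≤ j → j < at μ i → (i , j) ∈ μ / α
    box α≤j j<μ = from (∈-skew α μ) (α≤j , j<μ)

  moves⇒ribbonExtension : ∀ {ℓ M} N .{{_ : NonZero N}} (α : Vec ℕ ℓ) → Part M α → ∀ {h μ} → (h , μ) ∈ moves N α →
    RibbonExtension α N μ × height (μ / α) ≡ h
  moves⇒ribbonExtension N α d {h} {μ} z∈
    with rib , dμ , size ← moves-sound N α d z∈
    with t , strip ← ribbon⇒strip d rib =
      (part⇒isPartition μ dμ , contained′ , (connected , noSquare) ,
        ℕ.+-cancelʳ-≡ (Vec.sum α) _ N (trans (skew-size α μ contained′) (trans size (ℕ.+-comm _ N)))) , height≡
    where open FromStrip α μ d strip renaming (contained to contained′)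

  ribbonExtension⇒moves : ∀ {ℓ M} N .{{_ : NonZero N}} (α : Vec ℕ ℓ) → Part M α → ∀ {μ} → RibbonExtension α N μ →
    ∃ λ h → (h , μ) ∈ moves N α
  ribbonExtension⇒moves N α d {μ} (p , α⊆μ , ribbon , size) =
    let h , rib = rows⇒ribbon α μ d (isRibbon⇒rows α μ d dμ α⊆μ ribbon)
                    (subst (Vec.sum α <_) (sym sum≡) (ℕ.m<m+n _ (>-nonZero⁻¹ N)))
    in h , moves-complete N α μ rib d dμ sum≡
    where
    dμ = isPartition⇒part μ p
    sum≡ : Vec.sum μ ≡ Vec.sum α + N
    sum≡ = trans (sym (skew-size α μ α⊆μ)) (trans (cong (_+ Vec.sum α) size) (ℕ.+-comm N _))

  -- Semistandardness as a condition on adjacent rows.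

  -- As lists of naturals, rows of all lengths and over all alphabets have the same type, so
  -- removing the largest letter needs no coercion.
  word : ∀ {m a} → Vec (Fin m) a → List ℕ
  word []      = []
  word (e ∷ v) = toℕ e ∷ word v

  ≤ᵇ-true⇒≤ : ∀ {a b} → (a ≤ᵇ b) ≡ true → a ≤ b
  ≤ᵇ-true⇒≤ {a} {b} eq = ℕ.≤ᵇ⇒≤ a b (subst T (sym eq) tt)

  increasing⁻ : ∀ {m a} (v : Vec (Fin m) a) → increasing (word v) ≡ true →
    ∀ j j′ → j Fin.≤ j′ → lookup v j Fin.≤ lookup v j′
  increasing⁻ (e ∷ v)     inc Fin.zero    Fin.zero     _    = ℕ.≤-refl
  increasing⁻ (e ∷ v)     inc (Fin.suc j) (Fin.suc j′) j≤j′ =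
    increasing⁻ v (∧-conicalʳ _ _ inc) j j′ (s≤s⁻¹ j≤j′)
  increasing⁻ (e ∷ f ∷ v) inc Fin.zero    (Fin.suc j′) _    =
    ℕ.≤-trans (≤ᵇ-true⇒≤ (∧-conicalˡ (toℕ e ≤ᵇ toℕ f) _ inc)) (increasing⁻ (f ∷ v) (∧-conicalʳ (toℕ e ≤ᵇ toℕ f) _ inc) Fin.zero j′ z≤n)

  increasing⁺ : ∀ {m a} (v : Vec (Fin m) a) → (∀ j j′ → j Fin.≤ j′ → lookup v j Fin.≤ lookup v j′) →
    increasing (word v) ≡ true
  increasing⁺ []          mono = refl
  increasing⁺ (e ∷ [])    mono = refl
  increasing⁺ (e ∷ f ∷ v) mono = cong₂ _∧_ (≤⇒≤ᵇ-true (mono Fin.zero (Fin.suc Fin.zero) z≤n))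
    (increasing⁺ (f ∷ v) λ j j′ j≤j′ → mono (Fin.suc j) (Fin.suc j′) (s≤s j≤j′))

  above⁻ : ∀ {m a b} (u : Vec (Fin m) a) (v : Vec (Fin m) b) → above (word u) (word v) ≡ true →
    ∀ j j′ → toℕ j ≡ toℕ j′ → lookup u j Fin.< lookup v j′
  above⁻ (e ∷ u) (f ∷ v) ab Fin.zero    Fin.zero     _  = ≤ᵇ-true⇒≤ (∧-conicalˡ (toℕ e <ᵇ toℕ f) _ ab)
  above⁻ (e ∷ u) (f ∷ v) ab (Fin.suc j) (Fin.suc j′) eq = above⁻ u v (∧-conicalʳ _ _ ab) j j′ (ℕ.suc-injective eq)

  above⁺ : ∀ {m a b} (u : Vec (Fin m) a) (v : Vec (Fin m) b) → b ≤ a →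
    (∀ j j′ → toℕ j ≡ toℕ j′ → lookup u j Fin.< lookup v j′) → above (word u) (word v) ≡ true
  above⁺ u       []      _         lt = refl
  above⁺ (e ∷ u) (f ∷ v) (s≤s b≤a) lt = cong₂ _∧_ (≤⇒≤ᵇ-true (lt Fin.zero Fin.zero refl))
    (above⁺ u v b≤a λ j j′ eq → lt (Fin.suc j) (Fin.suc j′) (cong suc eq))

  -- `A` is the condition that the row above imposes on the first row; the recursion is that of
  -- `tableauSum`.
  valid : ∀ {m ℓ} {α : Vec ℕ ℓ} → (List ℕ → Bool) → Filling m α → Bool
  valid A []      = true
  valid A (v ∷ T) = increasing (word v) ∧ (A (word v) ∧ valid (above (word v)) T)

  valid⇒semistandard : ∀ {m ℓ M} {α : Vec ℕ ℓ} (A : List ℕ → Bool) (T : Filling m α) → Part M α →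
    valid A T ≡ true → IsSemistandard T
  valid⇒semistandard A []      _       _  = (λ ()) , λ ()
  valid⇒semistandard {m} {suc ℓ} {α = a ∷ α} A (v ∷ T) (_ ∷ d) ok = rows , columns
    where
    inc = ∧-conicalˡ (increasing (word v)) _ ok
    ok′ = ∧-conicalʳ (A (word v)) _ (∧-conicalʳ (increasing (word v)) _ ok)
    ss : IsSemistandard T
    ss = valid⇒semistandard (above (word v)) T d ok′
    rows : ∀ i j j′ → j Fin.≤ j′ → entry (v ∷ T) i j Fin.≤ entry (v ∷ T) i j′
    rows Fin.zero    = increasing⁻ v inc
    rows (Fin.suc i) = proj₁ ss i
    first : ∀ {M ℓ} {α : Vec ℕ ℓ} (T : Filling m α) → Part M α → IsSemistandard T → valid (above (word v)) T ≡ true →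
      ∀ i (j : Fin a) (j′ : Fin (lookup α i)) → toℕ j ≡ toℕ j′ → lookup v j Fin.< entry T i j′
    first (u ∷ T) _ ss ok Fin.zero j j′ eq =
      above⁻ v u (∧-conicalˡ (above (word v) (word u)) _ (∧-conicalʳ (increasing (word u)) _ ok)) j j′ eq
    -- Distant rows are compared through the row just below `v`, which has a box in that column
    -- because the parts decrease.
    first {α = b ∷ β} (u ∷ T) d ss ok (Fin.suc i) j j′ eq = ℕ.<-trans
      (first (u ∷ T) d ss ok Fin.zero j j″ (trans eq (sym j″≡)))
      (proj₂ ss Fin.zero (Fin.suc i) j″ j′ (s≤s z≤n) j″≡)
      where
      j′<b : toℕ j′ < b
      j′<b = ℕ.≤-trans (Fin.toℕ<n j′) (part⇒isPartition (b ∷ β) d Fin.zero (Fin.suc i) z≤n)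
      j″ : Fin b
      j″ = Fin.fromℕ< j′<b
      j″≡ : toℕ j″ ≡ toℕ j′
      j″≡ = Fin.toℕ-fromℕ< j′<b
    columns : ∀ i i′ j j′ → i Fin.< i′ → toℕ j ≡ toℕ j′ → entry (v ∷ T) i j Fin.< entry (v ∷ T) i′ j′
    columns Fin.zero    (Fin.suc i′) j j′ _    eq = first T d ss ok′ i′ j j′ eq
    columns (Fin.suc i) (Fin.suc i′) j j′ i<i′ eq = proj₂ ss i i′ j j′ (s≤s⁻¹ i<i′) eq

  semistandard⇒valid : ∀ {m ℓ M a} {α : Vec ℕ ℓ} A (v : Vec (Fin m) a) (T : Filling m α) → Part M (a ∷ α) →
    A (word v) ≡ true → IsSemistandard {α = a ∷ α} (v ∷ T) → valid {α = a ∷ α} A (v ∷ T) ≡ true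
  semistandard⇒valid A v T d Av (rows , columns) = cong₂ _∧_ (increasing⁺ v (rows Fin.zero)) (cong₂ _∧_ Av (below T d rows columns))
    where
    below : ∀ {ℓ M} {α : Vec ℕ ℓ} (T : Filling _ α) → Part M (_ ∷ α) →
      (∀ i j j′ → j Fin.≤ j′ → entry {α = _ ∷ α} (v ∷ T) i j Fin.≤ entry {α = _ ∷ α} (v ∷ T) i j′) →
      (∀ i i′ j j′ → i Fin.< i′ → toℕ j ≡ toℕ j′ → entry {α = _ ∷ α} (v ∷ T) i j Fin.< entry {α = _ ∷ α} (v ∷ T) i′ j′) →
      valid (above (word v)) T ≡ true
    below []      _              _    _       = refl
    below (u ∷ T) (_ ∷ b≤a ∷ d) rows columns = semistandard⇒valid (above (word v)) u T (b≤a ∷ d)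
      (above⁺ v u b≤a λ j j′ → columns Fin.zero (Fin.suc Fin.zero) j j′ (s≤s z≤n))
      ((λ i → rows (Fin.suc i)) , λ i i′ j j′ i<i′ → columns (Fin.suc i) (Fin.suc i′) j j′ (s≤s i<i′))

  does≡ : ∀ {P : Set} (P? : Dec P) {b} → (P → b ≡ true) → (b ≡ true → P) → does P? ≡ b
  does≡ (yes p) {b}     to from = sym (to p)
  does≡ (no ¬p) {true}  to from = contradiction (from refl) ¬p
  does≡ (no ¬p) {false} to from = refl

  isSemistandard?≡valid : ∀ {m ℓ M} {α : Vec ℕ ℓ} (T : Filling m α) → Part M α →
    does (isSemistandard? T) ≡ valid (const true) T
  isSemistandard?≡valid T d = does≡ (isSemistandard? T) (to T d) (valid⇒semistandard (const true) T d)
    where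
    to : ∀ {m ℓ M} {α : Vec ℕ ℓ} (T : Filling m α) → Part M α → IsSemistandard T → valid (const true) T ≡ true
    to []      _ _  = refl
    to (v ∷ T) d ss = semistandard⇒valid (const true) v T d refl ss

  -- Neither list has repetitions, so it is enough that they have the same members.
  moves↭ribbonExtensions : ∀ {ℓ} N .{{_ : NonZero N}} (α : Vec ℕ ℓ) → IsPartition α →
    map proj₂ (moves N α) ↭ ribbonExtensions α N
  moves↭ribbonExtensions N α p = ∼bag⇒↭ (unique∧set⇒bag (moves-unique N α d) (ribbonExtensions-unique α N)
    λ {μ} → mk⇔
      (λ μ∈ → let _ , z∈ , eq = ∈-map⁻ proj₂ μ∈ in subst (_∈ ribbonExtensions α N) (sym eq)
        (Equivalence.from (∈-ribbonExtensions α N _) (proj₁ (moves⇒ribbonExtension N α d z∈))))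
      (λ μ∈ → ∈-map⁺ proj₂ (proj₂ (ribbonExtension⇒moves N α d (Equivalence.to (∈-ribbonExtensions α N μ) μ∈)))))
    where d = isPartition⇒part α p

  positionsᵛ : ∀ {ℓ} → Vec ℕ ℓ → List ℕ
  positionsᵛ []              = []
  positionsᵛ {suc ℓ} (a ∷ α) = a + ℓ ∷ positionsᵛ α

  positionsᵛ≡ : ∀ {ℓ} (α : Vec ℕ ℓ) → positionsᵛ α ≡ positions (toList α)
  positionsᵛ≡ []      = refl
  positionsᵛ≡ (a ∷ α) = cong₂ _∷_ (cong (a +_) (sym (Vec.length-toList α))) (positionsᵛ≡ α)

-- Arithmetic of the superscripts modulo n.

module Residues where

  open import Data.Integer.Base using (ℤ; +_; -[1+_]) renaming (_+_ to _+ℤ_; _*_ to _*ℤ_; _-_ to _-ℤ_; -_ to -ℤ_)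
  open import Data.Nat.Base using (_+_; _*_)
  open ≡ using (refl; sym; trans; cong; cong₂; module ≡-Reasoning)

  residue-unique : ∀ {n a b} q → a < n → b < n → + a ≡ + b +ℤ q *ℤ + n → a ≡ b
  residue-unique {n} {a} {b} (+ zero) _ _ eq =
    ℤ.+-injective (trans eq (trans (cong (+ b +ℤ_) (ℤ.*-zeroˡ (+ n))) (ℤ.+-identityʳ (+ b))))
  residue-unique {n} {a} {b} (+ suc k) a<n _ eq = contradiction
    (ℕ.≤-trans (ℕ.m≤m+n n (k * n)) (ℕ.≤-trans (ℕ.m≤n+m _ b)
      (ℕ.≤-reflexive (sym (ℤ.+-injective (trans eq (cong (+ b +ℤ_) (sym (ℤ.pos-* (suc k) n)))))))))
    (ℕ.<⇒≱ a<n)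
  residue-unique {n} {a} {b} -[1+ k ] _ b<n eq = contradiction
    (ℕ.≤-trans (ℕ.m≤m+n n (k * n)) (ℕ.≤-trans (ℕ.m≤n+m _ a) (ℕ.≤-reflexive (ℤ.+-injective moved))))
    (ℕ.<⇒≱ b<n)
    where
    open ≡-Reasoning
    open ℤ.+-*-Solver
    moved : + (a + suc k * n) ≡ + b
    moved = begin
      + a +ℤ + (suc k * n)                                 ≡⟨ cong₂ _+ℤ_ eq (ℤ.pos-* (suc k) n) ⟩
      (+ b +ℤ (-ℤ (+ suc k)) *ℤ + n) +ℤ + suc k *ℤ + n
        ≡⟨ solve 3 (λ b k n → (b :+ (:- k) :* n) :+ k :* n := b) refl (+ b) (+ suc k) (+ n) ⟩
      + b ∎

  module _ {n : ℕ} .{{_ : NonZero n}} (r : Fin n) where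

    content : ℕ → ℕ → ℤ
    content i j = + toℕ r +ℤ + i -ℤ + j

    superscript-spec : ∀ i j → ∃ λ q → content i j ≡ + toℕ (superscript r i j) +ℤ q *ℤ + n
    superscript-spec i j = content i j /ℕ n , trans (a≡a%ℕn+[a/ℕn]*n (content i j) n)
      (cong (λ a → + a +ℤ (content i j /ℕ n) *ℤ + n) (sym (Fin.toℕ-fromℕ< (n%ℕd<d (content i j) n))))

    -- With this, each property of superscripts below reduces to naming a quotient and checking a
    -- linear identity over the integers.
    superscript-unique : ∀ i j (c : Fin n) q → content i j ≡ + toℕ c +ℤ q *ℤ + n → superscript r i j ≡ c
    superscript-unique i j c q eq with q′ , eq′ ← superscript-spec i j =
      Fin.toℕ-injective (residue-unique (q +ℤ -ℤ q′) (Fin.toℕ<n _) (Fin.toℕ<n c) (begin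
        + a                                        ≡⟨ solve 3 (λ a q n → a := (a :+ q :* n) :- q :* n) refl (+ a) q′ (+ n) ⟩
        (+ a +ℤ q′ *ℤ + n) -ℤ q′ *ℤ + n            ≡⟨ cong (_-ℤ q′ *ℤ + n) (trans (sym eq′) eq) ⟩
        (+ toℕ c +ℤ q *ℤ + n) -ℤ q′ *ℤ + n
          ≡⟨ solve 4 (λ c q q′ n → (c :+ q :* n) :- q′ :* n := c :+ (q :+ (:- q′)) :* n) refl (+ toℕ c) q q′ (+ n) ⟩
        + toℕ c +ℤ (q +ℤ -ℤ q′) *ℤ + n             ∎))
      where
      open ≡-Reasoning
      open ℤ.+-*-Solver
      a = toℕ (superscript r i j)

    superscript-diagonal : ∀ i j → superscript r (suc i) (suc j) ≡ superscript r i j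
    superscript-diagonal i j with q , eq ← superscript-spec i j =
      superscript-unique (suc i) (suc j) (superscript r i j) q (trans
        (solve 3 (λ r i j → (r :+ (con (+ 1) :+ i)) :- (con (+ 1) :+ j) := (r :+ i) :- j) refl (+ toℕ r) (+ i) (+ j)) eq)
      where open ℤ.+-*-Solver

    superscript-periodic : ∀ i j k → superscript r i (j + k * n) ≡ superscript r i j
    superscript-periodic i j k with q , eq ← superscript-spec i j =
      superscript-unique i (j + k * n) (superscript r i j) (q -ℤ + k) (begin
        + toℕ r +ℤ + i -ℤ (+ j +ℤ + (k * n))
          ≡⟨ cong (λ z → + toℕ r +ℤ + i -ℤ (+ j +ℤ z)) (ℤ.pos-* k n) ⟩
        + toℕ r +ℤ + i -ℤ (+ j +ℤ + k *ℤ + n)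
          ≡⟨ solve 5 (λ r i j k n → (r :+ i) :- (j :+ k :* n) := ((r :+ i) :- j) :- k :* n) refl (+ toℕ r) (+ i) (+ j) (+ k) (+ n) ⟩
        content i j -ℤ + k *ℤ + n
          ≡⟨ cong (_-ℤ + k *ℤ + n) eq ⟩
        + a +ℤ q *ℤ + n -ℤ + k *ℤ + n
          ≡⟨ solve 4 (λ a q k n → (a :+ q :* n) :- k :* n := a :+ (q :- k) :* n) refl (+ a) q (+ k) (+ n) ⟩
        + a +ℤ (q -ℤ + k) *ℤ + n ∎)
      where
      open ≡-Reasoning
      open ℤ.+-*-Solver
      a = toℕ (superscript r i j)

    -- The map taking j to r + i - j is a reflection of the residues. It permutes the factors of π
    -- into the order in which a path meets them.
    superscript-involutive : ∀ i (j : Fin n) → superscript r i (toℕ (superscript r i (toℕ j))) ≡ j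
    superscript-involutive i j with q , eq ← superscript-spec i (toℕ j) =
      superscript-unique i a j q (begin
        + toℕ r +ℤ + i -ℤ + a
          ≡⟨ solve 4 (λ r i a j → (r :+ i) :- a := ((r :+ i) :- j) :+ (j :- a)) refl (+ toℕ r) (+ i) (+ a) (+ toℕ j) ⟩
        content i (toℕ j) +ℤ (+ toℕ j -ℤ + a)
          ≡⟨ cong (_+ℤ (+ toℕ j -ℤ + a)) eq ⟩
        + a +ℤ q *ℤ + n +ℤ (+ toℕ j -ℤ + a)
          ≡⟨ solve 4 (λ a q n j → (a :+ q :* n) :+ (j :- a) := j :+ q :* n) refl (+ a) q (+ n) (+ toℕ j) ⟩
        + toℕ j +ℤ q *ℤ + n ∎)
      where
      open ≡-Reasoning
      open ℤ.+-*-Solver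
      a = toℕ (superscript r i (toℕ j))

open Shapes
open Residues
open import Data.Nat.Base using () renaming (_+_ to _+ℕ_; _*_ to _*ℕ_)

-- Alternating forms, exterior products, and the operator that moves one argument.

module Forms {c ℓ} (R : CommutativeRing c ℓ) where

  open CommutativeRing R
  open Algebra.Properties.Ring ring public
    using (-0#≈0#; -‿involutive; -‿+-comm; -‿distribˡ-*; -‿distribʳ-*; -1*x≈-x)
  open Algebra.Properties.CommutativeSemigroup +-commutativeSemigroup public
    using () renaming (interchange to +-interchange; x∙yz≈y∙xz to x+yz≈y+xz)
  open Algebra.Properties.CommutativeSemigroup *-commutativeSemigroup public
    using () renaming (x∙yz≈y∙xz to x*yz≈y*xz)
  open Relation.Binary.Reasoning.Setoid setoid

  Form : Set c
  Form = List ℕ → Carrier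

  infixl 9 _⌞_
  _⌞_ : Form → ℕ → Form
  (F ⌞ q) qs = F (q ∷ qs)

  -- Operators on forms are treated at a fixed list of arguments, as linear functionals; finite sums
  -- and transfers can then be pulled through any of them.
  record IsLinear (L : Form → Carrier) : Set (c ⊔ ℓ) where
    field
      cong-≈ : ∀ {F G} → (∀ qs → F qs ≈ G qs) → L F ≈ L G
      +-homo : ∀ F G → L (λ qs → F qs + G qs) ≈ L F + L G
      *-homo : ∀ a F → L (λ qs → a * F qs) ≈ a * L F

    0-homo : L (λ _ → 0#) ≈ 0#
    0-homo = begin
      L (λ _ → 0#)      ≈⟨ cong-≈ (λ _ → zeroˡ 0#) ⟨
      L (λ _ → 0# * 0#) ≈⟨ *-homo 0# (λ _ → 0#) ⟩
      0# * L (λ _ → 0#) ≈⟨ zeroˡ _ ⟩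
      0#                ∎

    -‿homo : ∀ F → L (λ qs → - F qs) ≈ - L F
    -‿homo F = begin
      L (λ qs → - F qs)      ≈⟨ cong-≈ (λ qs → -1*x≈-x (F qs)) ⟨
      L (λ qs → - 1# * F qs) ≈⟨ *-homo (- 1#) F ⟩
      - 1# * L F             ≈⟨ -1*x≈-x (L F) ⟩
      - L F                  ∎

  -- `repeat` is a separate law because 2 may be a zero divisor in `R`: `swap` alone shows only that
  -- twice the value vanishes.
  record Alternating (F : Form) : Set ℓ where
    field
      swap   : ∀ us a b vs → F (us ++ a ∷ b ∷ vs) ≈ - F (us ++ b ∷ a ∷ vs)
      repeat : ∀ us a vs → F (us ++ a ∷ a ∷ vs) ≈ 0#

  open IsLinear
  open Alternating

  ⌞-alternating : ∀ {F} → Alternating F → ∀ q → Alternating (F ⌞ q)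
  ⌞-alternating alt q = record
    { swap   = λ us → swap alt (q ∷ us)
    ; repeat = λ us → repeat alt (q ∷ us)
    }

  *-alternating : ∀ {F} a → Alternating F → Alternating (λ qs → a * F qs)
  *-alternating a alt = record
    { swap   = λ us p q vs → trans (*-congˡ (swap alt us p q vs)) (sym (-‿distribʳ-* _ _))
    ; repeat = λ us p vs → trans (*-congˡ (repeat alt us p vs)) (zeroʳ a)
    }

  -- The exterior product of φ and `F`: a signed sum over the argument handed to φ, as in expanding
  -- a determinant along a row.
  wedge : (ℕ → Carrier) → Form → Form
  wedge φ F []       = 0#
  wedge φ F (q ∷ qs) = φ q * F qs - wedge φ (F ⌞ q) qs

  -‿distrib-+ : ∀ x y → - (x + y) ≈ - x + - y
  -‿distrib-+ x y = sym (-‿+-comm x y)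

  *-distribˡ-- : ∀ a x y → a * (x - y) ≈ a * x - a * y
  *-distribˡ-- a x y = trans (distribˡ a x (- y)) (+-congˡ (sym (-‿distribʳ-* a y)))

  wedge-linear : ∀ φ qs → IsLinear (λ F → wedge φ F qs)
  wedge-linear φ [] = record
    { cong-≈ = λ _ → refl
    ; +-homo = λ _ _ → sym (+-identityˡ 0#)
    ; *-homo = λ a _ → sym (zeroʳ a)
    }
  wedge-linear φ (q ∷ qs) = record
    { cong-≈ = λ eq → +-cong (*-congˡ (eq qs)) (-‿cong (cong-≈ ih λ ps → eq (q ∷ ps)))
    ; +-homo = λ F G → begin
        φ q * (F qs + G qs) - wedge φ (λ ps → F (q ∷ ps) + G (q ∷ ps)) qs
          ≈⟨ +-cong (distribˡ _ _ _) (-‿cong (+-homo ih (F ⌞ q) (G ⌞ q))) ⟩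
        φ q * F qs + φ q * G qs - (wedge φ (F ⌞ q) qs + wedge φ (G ⌞ q) qs)
          ≈⟨ +-congˡ (-‿distrib-+ _ _) ⟩
        φ q * F qs + φ q * G qs + (- wedge φ (F ⌞ q) qs + - wedge φ (G ⌞ q) qs)
          ≈⟨ +-interchange _ _ _ _ ⟩
        φ q * F qs - wedge φ (F ⌞ q) qs + (φ q * G qs - wedge φ (G ⌞ q) qs) ∎
    ; *-homo = λ a F → begin
        φ q * (a * F qs) - wedge φ (λ ps → a * F (q ∷ ps)) qs
          ≈⟨ +-cong (x*yz≈y*xz _ _ _) (-‿cong (*-homo ih a (F ⌞ q))) ⟩
        a * (φ q * F qs) - a * wedge φ (F ⌞ q) qs
          ≈⟨ *-distribˡ-- _ _ _ ⟨
        a * (φ q * F qs - wedge φ (F ⌞ q) qs) ∎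
    }
    where ih = wedge-linear φ qs

  wedge-∷∷ : ∀ φ F a b qs →
    wedge φ F (a ∷ b ∷ qs) ≈ (φ a * F (b ∷ qs) - φ b * F (a ∷ qs)) + wedge φ (F ⌞ a ⌞ b) qs
  wedge-∷∷ φ F a b qs = begin
    φ a * F (b ∷ qs) - (φ b * F (a ∷ qs) - wedge φ (F ⌞ a ⌞ b) qs)
      ≈⟨ +-congˡ (-‿distrib-+ _ _) ⟩
    φ a * F (b ∷ qs) + (- (φ b * F (a ∷ qs)) + - - wedge φ (F ⌞ a ⌞ b) qs)
      ≈⟨ +-assoc _ _ _ ⟨
    φ a * F (b ∷ qs) - φ b * F (a ∷ qs) + - - wedge φ (F ⌞ a ⌞ b) qs
      ≈⟨ +-congˡ (-‿involutive _) ⟩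
    φ a * F (b ∷ qs) - φ b * F (a ∷ qs) + wedge φ (F ⌞ a ⌞ b) qs ∎

  x-y≈-[y-x] : ∀ x y → x - y ≈ - (y - x)
  x-y≈-[y-x] x y = begin
    x - y         ≈⟨ +-comm _ _ ⟩
    - y + x       ≈⟨ +-congˡ (-‿involutive x) ⟨
    - y + - - x   ≈⟨ -‿distrib-+ y (- x) ⟨
    - (y - x)     ∎

  -- The two terms in which φ takes one of the exchanged arguments turn into each other up to sign;
  -- all the others inherit alternation from `F`.
  wedge-alternating : ∀ φ {F} → Alternating F → Alternating (wedge φ F)
  wedge-alternating φ alt = record { swap = sw alt ; repeat = rp alt }
    where
    sw : ∀ {F} → Alternating F → ∀ us a b vs → wedge φ F (us ++ a ∷ b ∷ vs) ≈ - wedge φ F (us ++ b ∷ a ∷ vs)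
    sw {F} alt [] a b vs = begin
      wedge φ F (a ∷ b ∷ vs)
        ≈⟨ wedge-∷∷ φ F a b vs ⟩
      (φ a * F (b ∷ vs) - φ b * F (a ∷ vs)) + wedge φ (F ⌞ a ⌞ b) vs
        ≈⟨ +-cong (x-y≈-[y-x] _ _) (cong-≈ (wedge-linear φ vs) (swap alt [] a b)) ⟩
      - (φ b * F (a ∷ vs) - φ a * F (b ∷ vs)) + wedge φ (λ ps → - F (b ∷ a ∷ ps)) vs
        ≈⟨ +-congˡ (-‿homo (wedge-linear φ vs) (F ⌞ b ⌞ a)) ⟩
      - (φ b * F (a ∷ vs) - φ a * F (b ∷ vs)) + - wedge φ (F ⌞ b ⌞ a) vs
        ≈⟨ -‿distrib-+ _ _ ⟨
      - ((φ b * F (a ∷ vs) - φ a * F (b ∷ vs)) + wedge φ (F ⌞ b ⌞ a) vs)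
        ≈⟨ -‿cong (wedge-∷∷ φ F b a vs) ⟨
      - wedge φ F (b ∷ a ∷ vs) ∎
    sw {F} alt (u ∷ us) a b vs = begin
      φ u * F (us ++ a ∷ b ∷ vs) - wedge φ (F ⌞ u) (us ++ a ∷ b ∷ vs)
        ≈⟨ +-cong (*-congˡ (swap alt us a b vs)) (-‿cong (sw (⌞-alternating alt u) us a b vs)) ⟩
      φ u * - F (us ++ b ∷ a ∷ vs) - - wedge φ (F ⌞ u) (us ++ b ∷ a ∷ vs)
        ≈⟨ +-congʳ (-‿distribʳ-* _ _) ⟨
      - (φ u * F (us ++ b ∷ a ∷ vs)) - - wedge φ (F ⌞ u) (us ++ b ∷ a ∷ vs)
        ≈⟨ -‿distrib-+ _ _ ⟨
      - wedge φ F (u ∷ us ++ b ∷ a ∷ vs) ∎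
    rp : ∀ {F} → Alternating F → ∀ us a vs → wedge φ F (us ++ a ∷ a ∷ vs) ≈ 0#
    rp {F} alt [] a vs = begin
      wedge φ F (a ∷ a ∷ vs)
        ≈⟨ wedge-∷∷ φ F a a vs ⟩
      (φ a * F (a ∷ vs) - φ a * F (a ∷ vs)) + wedge φ (F ⌞ a ⌞ a) vs
        ≈⟨ +-cong (-‿inverseʳ _) (cong-≈ (wedge-linear φ vs) (repeat alt [] a)) ⟩
      0# + wedge φ (λ _ → 0#) vs
        ≈⟨ +-identityˡ _ ⟩
      wedge φ (λ _ → 0#) vs
        ≈⟨ 0-homo (wedge-linear φ vs) ⟩
      0# ∎
    rp {F} alt (u ∷ us) a vs = begin
      φ u * F (us ++ a ∷ a ∷ vs) - wedge φ (F ⌞ u) (us ++ a ∷ a ∷ vs)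
        ≈⟨ +-cong (*-congˡ (repeat alt us a vs)) (-‿cong (rp (⌞-alternating alt u) us a vs)) ⟩
      φ u * 0# - 0#
        ≈⟨ +-cong (zeroʳ _) -0#≈0# ⟩
      0# + 0#
        ≈⟨ +-identityˡ 0# ⟩
      0# ∎

  -- The first argument may go to the outer or to the inner φ, with opposite signs. What remains,
  -- where it goes to `G`, is a double wedge of `G ⌞ q`.
  wedge-wedge : ∀ φ G qs → wedge φ (wedge φ G) qs ≈ 0#
  wedge-wedge φ G []       = refl
  wedge-wedge φ G (q ∷ qs) = begin
    φ q * wedge φ G qs - wedge φ (λ ps → φ q * G ps - wedge φ (G ⌞ q) ps) qs
      ≈⟨ +-congˡ (-‿cong (+-homo lin _ _)) ⟩
    φ q * wedge φ G qs - (wedge φ (λ ps → φ q * G ps) qs + wedge φ (λ ps → - wedge φ (G ⌞ q) ps) qs)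
      ≈⟨ +-congˡ (-‿cong (+-cong (*-homo lin _ _) (trans (-‿homo lin _) (-‿cong (wedge-wedge φ (G ⌞ q) qs))))) ⟩
    φ q * wedge φ G qs - (φ q * wedge φ G qs - 0#)
      ≈⟨ +-congˡ (-‿cong (trans (+-congˡ -0#≈0#) (+-identityʳ _))) ⟩
    φ q * wedge φ G qs - φ q * wedge φ G qs
      ≈⟨ -‿inverseʳ _ ⟩
    0# ∎
    where lin = wedge-linear φ qs

  wedge-scale : ∀ a φ F qs → wedge (λ q → a * φ q) F qs ≈ a * wedge φ F qs
  wedge-scale a φ F []       = sym (zeroʳ a)
  wedge-scale a φ F (q ∷ qs) = begin
    a * φ q * F qs - wedge (λ q → a * φ q) (F ⌞ q) qs ≈⟨ +-cong (*-assoc _ _ _) (-‿cong (wedge-scale a φ (F ⌞ q) qs)) ⟩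
    a * (φ q * F qs) - a * wedge φ (F ⌞ q) qs         ≈⟨ *-distribˡ-- _ _ _ ⟨
    a * wedge φ F (q ∷ qs)                            ∎

  wedge-congˡ : ∀ {φ ψ} → (∀ q → φ q ≈ ψ q) → ∀ F qs → wedge φ F qs ≈ wedge ψ F qs
  wedge-congˡ eq F []       = refl
  wedge-congˡ eq F (q ∷ qs) = +-cong (*-congʳ (eq q)) (-‿cong (wedge-congˡ eq (F ⌞ q) qs))

  shift : ℕ → Form → Form
  shift N F []       = 0#
  shift N F (q ∷ qs) = F (q +ℕ N ∷ qs) + shift N (F ⌞ q) qs

  shift-linear : ∀ N qs → IsLinear (λ F → shift N F qs)
  shift-linear N [] = record
    { cong-≈ = λ _ → refl
    ; +-homo = λ _ _ → sym (+-identityˡ 0#)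
    ; *-homo = λ a _ → sym (zeroʳ a)
    }
  shift-linear N (q ∷ qs) = record
    { cong-≈ = λ eq → +-cong (eq _) (cong-≈ ih λ ps → eq (q ∷ ps))
    ; +-homo = λ F G → trans (+-congˡ (+-homo ih (F ⌞ q) (G ⌞ q))) (+-interchange _ _ _ _)
    ; *-homo = λ a F → trans (+-congˡ (*-homo ih a (F ⌞ q))) (sym (distribˡ a _ _))
    }
    where ih = shift-linear N qs

  -- Leibniz rule: the argument that moves is either the one taken by φ or one of those left to `F`.
  shift-wedge : ∀ N φ F qs →
    shift N (wedge φ F) qs ≈ wedge (λ q → φ (q +ℕ N)) F qs + wedge φ (shift N F) qs
  shift-wedge N φ F []       = sym (+-identityˡ 0#)
  shift-wedge N φ F (q ∷ qs) = begin
    (φ (q +ℕ N) * F qs - w₁) + shift N (λ ps → φ q * F ps - wedge φ (F ⌞ q) ps) qs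
      ≈⟨ +-congˡ (trans (+-homo lin _ _) (+-cong (*-homo lin _ _)
           (trans (-‿homo lin _) (-‿cong (shift-wedge N φ (F ⌞ q) qs))))) ⟩
    (φ (q +ℕ N) * F qs - w₁) + (φ q * shift N F qs - (w₂ + w₃))
      ≈⟨ +-interchange _ _ _ _ ⟩
    (φ (q +ℕ N) * F qs + φ q * shift N F qs) + (- w₁ - (w₂ + w₃))
      ≈⟨ +-congˡ (trans (sym (-‿distrib-+ _ _)) (trans (-‿cong (x+yz≈y+xz _ _ _)) (-‿distrib-+ _ _))) ⟩
    (φ (q +ℕ N) * F qs + φ q * shift N F qs) + (- w₂ - (w₁ + w₃))
      ≈⟨ +-interchange _ _ _ _ ⟩
    (φ (q +ℕ N) * F qs - w₂) + (φ q * shift N F qs - (w₁ + w₃))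
      ≈⟨ +-congˡ (+-congˡ (-‿cong (+-homo (wedge-linear φ qs) _ _))) ⟨
    (φ (q +ℕ N) * F qs - w₂) + (φ q * shift N F qs - wedge φ (shift N F ⌞ q) qs) ∎
    where
    lin = shift-linear N qs
    w₁ = wedge φ (F ⌞ (q +ℕ N)) qs
    w₂ = wedge (λ q → φ (q +ℕ N)) (F ⌞ q) qs
    w₃ = wedge φ (shift N (F ⌞ q)) qs

  sum< : ℕ → (ℕ → Carrier) → Carrier
  sum< zero    f = 0#
  sum< (suc n) f = sum< n f + f n

  sum<-cong : ∀ n {f g} → (∀ p → p < n → f p ≈ g p) → sum< n f ≈ sum< n g
  sum<-cong zero    eq = refl
  sum<-cong (suc n) eq = +-cong (sum<-cong n λ p p<n → eq p (ℕ.m<n⇒m<1+n p<n)) (eq n ℕ.≤-refl)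

  sum<-0 : ∀ n → sum< n (λ _ → 0#) ≈ 0#
  sum<-0 zero    = refl
  sum<-0 (suc n) = trans (+-identityʳ _) (sum<-0 n)

  sum<-zero : ∀ n {f} → (∀ p → p < n → f p ≈ 0#) → sum< n f ≈ 0#
  sum<-zero n eq = trans (sum<-cong n eq) (sum<-0 n)

  sum<-+ : ∀ n f g → sum< n (λ p → f p + g p) ≈ sum< n f + sum< n g
  sum<-+ zero    f g = sym (+-identityˡ 0#)
  sum<-+ (suc n) f g = trans (+-congʳ (sum<-+ n f g)) (+-interchange _ _ _ _)

  sum<-* : ∀ n a f → sum< n (λ p → a * f p) ≈ a * sum< n f
  sum<-* zero    a f = sym (zeroʳ a)
  sum<-* (suc n) a f = trans (+-congʳ (sum<-* n a f)) (sym (distribˡ _ _ _))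

  sum<-exchange : ∀ m n (f : ℕ → ℕ → Carrier) →
    sum< m (λ i → sum< n (f i)) ≈ sum< n (λ j → sum< m (λ i → f i j))
  sum<-exchange zero    n f = sym (sum<-0 n)
  sum<-exchange (suc m) n f = trans (+-congʳ (sum<-exchange m n f)) (sym (sum<-+ n _ _))

  sum<-head : ∀ n f → sum< (suc n) f ≈ f 0 + sum< n (f ∘ suc)
  sum<-head zero    f = +-comm _ _
  sum<-head (suc n) f = trans (+-congʳ (sum<-head n f)) (+-assoc _ _ _)

  linear-sum< : ∀ {L} → IsLinear L → ∀ n (G : ℕ → Form) →
    L (λ qs → sum< n (λ p → G p qs)) ≈ sum< n (λ p → L (G p))
  linear-sum< lin zero    G = 0-homo lin
  linear-sum< lin (suc n) G = trans (+-homo lin _ _) (+-congʳ (linear-sum< lin n G))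

  -- The transfer matrix of one letter.

  module Transfer (y : ℕ → Carrier) where

    path : ℕ → Carrier
    path zero    = 1#
    path (suc q) = y q * path q

    -- In closed form, the sum over `p < q` of `f p` times all `y s` with `p < s < q`. The step from
    -- `p` to `suc p` is free: it only records that one more row now lies below.
    transfer : (ℕ → Carrier) → ℕ → Carrier
    transfer f zero    = 0#
    transfer f (suc q) = f q + y q * transfer f q

    transfer-cong : ∀ {f g} → (∀ p → f p ≈ g p) → ∀ q → transfer f q ≈ transfer g q
    transfer-cong eq zero    = refl
    transfer-cong eq (suc q) = +-cong (eq q) (*-congˡ (transfer-cong eq q))

    transfer-+ : ∀ f g q → transfer (λ p → f p + g p) q ≈ transfer f q + transfer g q
    transfer-+ f g zero    = sym (+-identityˡ 0#)
    transfer-+ f g (suc q) = begin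
      f q + g q + y q * transfer (λ p → f p + g p) q        ≈⟨ +-congˡ (*-congˡ (transfer-+ f g q)) ⟩
      f q + g q + y q * (transfer f q + transfer g q)       ≈⟨ +-congˡ (distribˡ _ _ _) ⟩
      f q + g q + (y q * transfer f q + y q * transfer g q) ≈⟨ +-interchange _ _ _ _ ⟩
      transfer f (suc q) + transfer g (suc q)               ∎

    transfer-* : ∀ a f q → transfer (λ p → a * f p) q ≈ a * transfer f q
    transfer-* a f zero    = sym (zeroʳ a)
    transfer-* a f (suc q) = begin
      a * f q + y q * transfer (λ p → a * f p) q ≈⟨ +-congˡ (*-congˡ (transfer-* a f q)) ⟩
      a * f q + y q * (a * transfer f q)         ≈⟨ +-congˡ (x*yz≈y*xz _ _ _) ⟩
      a * f q + a * (y q * transfer f q)         ≈⟨ distribˡ _ _ _ ⟨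
      a * transfer f (suc q)                     ∎

    transfer-0 : ∀ q → transfer (λ _ → 0#) q ≈ 0#
    transfer-0 zero    = refl
    transfer-0 (suc q) = begin
      0# + y q * transfer (λ _ → 0#) q ≈⟨ +-identityˡ _ ⟩
      y q * transfer (λ _ → 0#) q      ≈⟨ *-congˡ (transfer-0 q) ⟩
      y q * 0#                         ≈⟨ zeroʳ _ ⟩
      0#                               ∎

    transfer-neg : ∀ f q → transfer (λ p → - f p) q ≈ - transfer f q
    transfer-neg f q = begin
      transfer (λ p → - f p) q      ≈⟨ transfer-cong (λ p → -1*x≈-x (f p)) q ⟨
      transfer (λ p → - 1# * f p) q ≈⟨ transfer-* (- 1#) f q ⟩
      - 1# * transfer f q           ≈⟨ -1*x≈-x _ ⟩
      - transfer f q                ∎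

    linear-transfer : ∀ {L} → IsLinear L → ∀ (G : ℕ → Form) q →
      L (λ qs → transfer (λ p → G p qs) q) ≈ transfer (λ p → L (G p)) q
    linear-transfer lin G zero    = 0-homo lin
    linear-transfer lin G (suc q) =
      trans (+-homo lin _ _) (+-congˡ (trans (*-homo lin _ _) (*-congˡ (linear-transfer lin G q))))

    transfer-exchange : ∀ (g : ℕ → ℕ → Carrier) a b →
      transfer (λ p → transfer (g p) b) a ≈ transfer (λ p′ → transfer (λ p → g p p′) a) b
    transfer-exchange g zero    b = sym (transfer-0 b)
    transfer-exchange g (suc a) b = begin
      transfer (g a) b + y a * transfer (λ p → transfer (g p) b) a
        ≈⟨ +-congˡ (*-congˡ (transfer-exchange g a b)) ⟩
      transfer (g a) b + y a * transfer (λ p′ → transfer (λ p → g p p′) a) b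
        ≈⟨ +-congˡ (transfer-* _ _ b) ⟨
      transfer (g a) b + transfer (λ p′ → y a * transfer (λ p → g p p′) a) b
        ≈⟨ transfer-+ _ _ b ⟨
      transfer (λ p′ → transfer (λ p → g p p′) (suc a)) b ∎

    -- An antisymmetric double sum. Peeling off the last row and column together exhibits the
    -- cancellation in pairs without dividing by 2.
    transfer-diagonal : ∀ (g : ℕ → ℕ → Carrier) → (∀ p p′ → g p p′ ≈ - g p′ p) → (∀ p → g p p ≈ 0#) →
      ∀ a → transfer (λ p → transfer (g p) a) a ≈ 0#
    transfer-diagonal g anti diag zero    = refl
    transfer-diagonal g anti diag (suc a) = begin
      (g a a + y a * u) + y a * transfer (λ p → g p a + y a * transfer (g p) a) a
        ≈⟨ +-cong (trans (+-congʳ (diag a)) (+-identityˡ _)) (*-congˡ (transfer-+ _ _ a)) ⟩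
      y a * u + y a * (transfer (λ p → g p a) a + transfer (λ p → y a * transfer (g p) a) a)
        ≈⟨ +-congˡ (*-congˡ (+-cong
             (trans (transfer-cong (λ p → anti p a) a) (transfer-neg (g a) a))
             (trans (transfer-* _ _ a) (trans (*-congˡ (transfer-diagonal g anti diag a)) (zeroʳ _))))) ⟩
      y a * u + y a * (- u + 0#)
        ≈⟨ distribˡ _ _ _ ⟨
      y a * (u + (- u + 0#))
        ≈⟨ *-congˡ (trans (+-congˡ (+-identityʳ _)) (-‿inverseʳ u)) ⟩
      y a * 0#
        ≈⟨ zeroʳ _ ⟩
      0# ∎
      where u = transfer (g a) a

    transferAll : Form → Form
    transferAll F []       = F []
    transferAll F (q ∷ qs) = transfer (λ p → transferAll (F ⌞ p) qs) q

    transferAll-linear : ∀ qs → IsLinear (λ F → transferAll F qs)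
    transferAll-linear [] = record
      { cong-≈ = λ eq → eq []
      ; +-homo = λ _ _ → refl
      ; *-homo = λ _ _ → refl
      }
    transferAll-linear (q ∷ qs) = record
      { cong-≈ = λ eq → transfer-cong (λ p → cong-≈ ih λ ps → eq (p ∷ ps)) q
      ; +-homo = λ F G → trans (transfer-cong (λ p → +-homo ih (F ⌞ p) (G ⌞ p)) q) (transfer-+ _ _ q)
      ; *-homo = λ a F → trans (transfer-cong (λ p → *-homo ih a (F ⌞ p)) q) (transfer-* _ _ q)
      }
      where ih = transferAll-linear qs

    transferAll-alternating : ∀ {F} → Alternating F → Alternating (transferAll F)
    transferAll-alternating alt = record { swap = sw alt ; repeat = rp alt }
      where
      anti : ∀ {F} → Alternating F → ∀ vs p p′ →
             transferAll (F ⌞ p ⌞ p′) vs ≈ - transferAll (F ⌞ p′ ⌞ p) vs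
      anti alt vs p p′ = trans
        (cong-≈ (transferAll-linear vs) (swap alt [] p p′)) (-‿homo (transferAll-linear vs) _)
      sw : ∀ {F} → Alternating F → ∀ us a b vs →
           transferAll F (us ++ a ∷ b ∷ vs) ≈ - transferAll F (us ++ b ∷ a ∷ vs)
      sw {F} alt [] a b vs = begin
        transfer (λ p → transfer (λ p′ → transferAll (F ⌞ p ⌞ p′) vs) b) a
          ≈⟨ transfer-exchange _ a b ⟩
        transfer (λ p′ → transfer (λ p → transferAll (F ⌞ p ⌞ p′) vs) a) b
          ≈⟨ transfer-cong (λ p′ → trans (transfer-cong (λ p → anti alt vs p p′) a) (transfer-neg _ a)) b ⟩
        transfer (λ p′ → - transfer (λ p → transferAll (F ⌞ p′ ⌞ p) vs) a) b
          ≈⟨ transfer-neg _ b ⟩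
        - transferAll F (b ∷ a ∷ vs) ∎
      sw alt (u ∷ us) a b vs =
        trans (transfer-cong (λ p → sw (⌞-alternating alt p) us a b vs) u) (transfer-neg _ u)
      rp : ∀ {F} → Alternating F → ∀ us a vs → transferAll F (us ++ a ∷ a ∷ vs) ≈ 0#
      rp alt [] a vs = transfer-diagonal _ (anti alt vs)
        (λ p → trans (cong-≈ (transferAll-linear vs) (repeat alt [] p)) (0-homo (transferAll-linear vs))) a
      rp alt (u ∷ us) a vs =
        trans (transfer-cong (λ p → rp (⌞-alternating alt p) us a vs) u) (transfer-0 u)

    module Periodic (N : ℕ) (y-periodic : ∀ q → y (q +ℕ N) ≈ y q) where

      path-shift : ∀ q → path (q +ℕ N) ≈ path N * path q
      path-shift zero    = sym (*-identityʳ _)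
      path-shift (suc q) = trans (*-cong (y-periodic q) (path-shift q)) (x*yz≈y*xz _ _ _)

      -- Starts from `N` on are translates by periodicity. A start below `N` first has to reach `N`,
      -- and the rest of its way weighs `path q`, again by periodicity.
      transfer-shift : ∀ f q →
        transfer f (q +ℕ N) ≈ path q * transfer f N + transfer (λ p → f (p +ℕ N)) q
      transfer-shift f zero    = sym (trans (+-identityʳ _) (*-identityˡ _))
      transfer-shift f (suc q) = begin
        f (q +ℕ N) + y (q +ℕ N) * transfer f (q +ℕ N)
          ≈⟨ +-congˡ (*-cong (y-periodic q) (transfer-shift f q)) ⟩
        f (q +ℕ N) + y q * (path q * transfer f N + v)
          ≈⟨ +-congˡ (trans (distribˡ _ _ _) (+-congʳ (sym (*-assoc _ _ _)))) ⟩
        f (q +ℕ N) + (path (suc q) * transfer f N + y q * v)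
          ≈⟨ x+yz≈y+xz _ _ _ ⟩
        path (suc q) * transfer f N + (f (q +ℕ N) + y q * v) ∎
        where v = transfer (λ p → f (p +ℕ N)) q

      -- The boundary term of the commutator is divisible by the eigenvector
      -- path, so it is killed by a further wedge with path.
      shift-transferAll : ∀ {F} → Alternating F → ∀ qs →
        shift N (transferAll F) qs ≈ transferAll (shift N F) qs + wedge path (transferAll F ⌞ N) qs
      shift-transferAll alt []           = sym (+-identityˡ 0#)
      shift-transferAll {F} alt (q ∷ qs) = begin
        transferAll F (q +ℕ N ∷ qs) + shift N (λ ps → transfer (λ p → transferAll (F ⌞ p) ps) q) qs
          ≈⟨ +-cong (transfer-shift _ q) (trans (linear-transfer (shift-linear N qs) (λ p → transferAll (F ⌞ p)) q)
               (trans (transfer-cong (λ p → shift-transferAll (⌞-alternating alt p) qs) q) (transfer-+ _ _ q))) ⟩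
        (A + B) + (C + D)
          ≈⟨ +-congʳ (+-comm A B) ⟩
        (B + A) + (C + D)
          ≈⟨ +-interchange _ _ _ _ ⟩
        (B + C) + (A + D)
          ≈⟨ +-cong (trans (transfer-cong (λ p → +-homo (transferAll-linear qs) _ _) q) (transfer-+ _ _ q))
                    (+-congˡ D′) ⟨
        transferAll (shift N F) (q ∷ qs) + wedge path (transferAll F ⌞ N) (q ∷ qs) ∎
        where
        A = path q * transferAll F (N ∷ qs)
        B = transfer (λ p → transferAll (F ⌞ (p +ℕ N)) qs) q
        C = transfer (λ p → transferAll (shift N (F ⌞ p)) qs) q
        D = transfer (λ p → wedge path (transferAll (F ⌞ p) ⌞ N) qs) q
        lin = wedge-linear path qs
        D′ : - wedge path (transferAll F ⌞ N ⌞ q) qs ≈ D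
        D′ = begin
          - wedge path (transferAll F ⌞ N ⌞ q) qs
            ≈⟨ -‿homo lin _ ⟨
          wedge path (λ ps → - transferAll F (N ∷ q ∷ ps)) qs
            ≈⟨ cong-≈ lin (λ ps → swap (transferAll-alternating alt) [] q N ps) ⟨
          wedge path (transferAll F ⌞ q ⌞ N) qs
            ≈⟨ linear-transfer lin (λ p → transferAll (F ⌞ p) ⌞ N) q ⟩
          D ∎

      -- Eigenvalues add up: the old particles contribute `a`, the new one `path N`.
      shift-wedge-transferAll : ∀ {F} a → Alternating F → (∀ qs → shift N F qs ≈ a * F qs) →
        ∀ qs → shift N (wedge path (transferAll F)) qs ≈ (a + path N) * wedge path (transferAll F) qs
      shift-wedge-transferAll {F} a alt eig qs = begin
        shift N (wedge path (transferAll F)) qs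
          ≈⟨ shift-wedge N path _ qs ⟩
        wedge (λ q → path (q +ℕ N)) (transferAll F) qs + wedge path (shift N (transferAll F)) qs
          ≈⟨ +-cong (trans (wedge-congˡ path-shift _ qs) (wedge-scale _ _ _ qs))
               (trans (cong-≈ lin (shift-transferAll alt)) (+-homo lin _ _)) ⟩
        path N * W + (wedge path (transferAll (shift N F)) qs + wedge path (wedge path (transferAll F ⌞ N)) qs)
          ≈⟨ +-congˡ (trans (+-cong (cong-≈ lin λ ps → trans (cong-≈ (transferAll-linear ps) eig)
               (*-homo (transferAll-linear ps) a F)) (wedge-wedge path _ qs)) (+-identityʳ _)) ⟩
        path N * W + wedge path (λ ps → a * transferAll F ps) qs
          ≈⟨ +-congˡ (*-homo lin a _) ⟩
        path N * W + a * W
          ≈⟨ +-comm _ _ ⟩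
        a * W + path N * W
          ≈⟨ distribʳ _ _ _ ⟨
        (a + path N) * W ∎
        where
        lin = wedge-linear path qs
        W = wedge path (transferAll F) qs

-- From unrestricted transfers to interlacing ones, and the resulting alternating forms.

module SlaterForms {c ℓ} (R : CommutativeRing c ℓ) where

  open CommutativeRing R
  open Forms R
  open IsLinear
  open Alternating
  open Relation.Binary.Reasoning.Setoid setoid
  open Algebra.Definitions.RawSemiring (RawRing.rawSemiring rawRing) using (_^_)

  when : Bool → Carrier → Carrier
  when b x = if b then x else 0#

  when-cong : ∀ b {x y} → (b ≡ true → x ≈ y) → when b x ≈ when b y
  when-cong true  eq = eq ≡.refl
  when-cong false eq = refl

  when-* : ∀ b a x → when b (a * x) ≈ a * when b x
  when-* true  a x = refl
  when-* false a x = sym (zeroʳ a)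

  when-0 : ∀ b → when b 0# ≈ 0#
  when-0 true  = refl
  when-0 false = refl

  when-∧ : ∀ a b x → when (a ∧ b) x ≈ when b (when a x)
  when-∧ true  b x = refl
  when-∧ false b x = sym (when-0 b)

  when-≡ : ∀ {a b x} → a ≡ b → when a x ≈ when b x
  when-≡ ≡.refl = refl

  linear-when : ∀ {L} → IsLinear L → ∀ b F → L (λ qs → when b (F qs)) ≈ when b (L F)
  linear-when lin true  F = refl
  linear-when lin false F = 0-homo lin

  sign : ℕ → Carrier
  sign h = (- 1#) ^ h

  sign-suc : ∀ h x → sign (suc h) * x ≈ - (sign h * x)
  sign-suc h x = trans (*-congʳ (-1*x≈-x (sign h))) (sym (-‿distribˡ-* _ _))

  sign-square : ∀ h x → sign h * (sign h * x) ≈ x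
  sign-square zero    x = trans (*-identityˡ _) (*-identityˡ x)
  sign-square (suc h) x = begin
    sign (suc h) * (sign (suc h) * x) ≈⟨ sign-suc h _ ⟩
    - (sign h * (sign (suc h) * x))   ≈⟨ -‿cong (*-congˡ (sign-suc h x)) ⟩
    - (sign h * - (sign h * x))       ≈⟨ -‿cong (-‿distribʳ-* _ _) ⟨
    - - (sign h * (sign h * x))       ≈⟨ -‿involutive _ ⟩
    sign h * (sign h * x)             ≈⟨ sign-square h x ⟩
    x                                 ∎

  module Branch (y : ℕ → Carrier) where
    open Transfer y

    from : ℕ → (ℕ → Carrier) → ℕ → Carrier
    from b f p = when (b ≤ᵇ p) (f p)

    transfer-from-≤ : ∀ b f a → a ≤ b → transfer (from b f) a ≈ 0#
    transfer-from-≤ b f zero    _   = refl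
    transfer-from-≤ b f (suc a) a<b rewrite ≰⇒≤ᵇ-false (ℕ.<⇒≱ a<b) = begin
      0# + y a * transfer (from b f) a ≈⟨ +-identityˡ _ ⟩
      y a * transfer (from b f) a      ≈⟨ *-congˡ (transfer-from-≤ b f a (ℕ.<⇒≤ a<b)) ⟩
      y a * 0#                         ≈⟨ zeroʳ _ ⟩
      0#                               ∎

    -- Here `z` is the product of the weights from `b` up to `a`. That `path` and the starts below
    -- `b` acquire the same factor is what makes the cancellation in `wedge-transferAll-∷∷`
    -- possible.
    transfer-split : ∀ {b a} → b ≤′ a → ∃ λ z → path a ≈ z * path b ×
      (∀ f → transfer f a ≈ z * transfer f b + transfer (from b f) a)
    transfer-split {b} ≤′-refl = 1# , sym (*-identityˡ _) , λ f → sym (begin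
      1# * transfer f b + transfer (from b f) b ≈⟨ +-cong (*-identityˡ _) (transfer-from-≤ b f b ℕ.≤-refl) ⟩
      transfer f b + 0#                         ≈⟨ +-identityʳ _ ⟩
      transfer f b                              ∎)
    transfer-split {b} (≤′-step {a} b≤′a) with z , path≈ , split ← transfer-split b≤′a =
      y a * z , trans (*-congˡ path≈) (sym (*-assoc _ _ _)) , step
      where
      step : ∀ f → transfer f (suc a) ≈ y a * z * transfer f b + transfer (from b f) (suc a)
      step f rewrite ≤⇒≤ᵇ-true (ℕ.≤′⇒≤ b≤′a) = begin
        f a + y a * transfer f a
          ≈⟨ +-congˡ (trans (*-congˡ (split f)) (distribˡ _ _ _)) ⟩
        f a + (y a * (z * transfer f b) + y a * transfer (from b f) a)
          ≈⟨ x+yz≈y+xz _ _ _ ⟩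
        y a * (z * transfer f b) + (f a + y a * transfer (from b f) a)
          ≈⟨ +-congʳ (*-assoc _ _ _) ⟨
        y a * z * transfer f b + (f a + y a * transfer (from b f) a) ∎

    -- The interlacing sum: between consecutive new positions `a` and `b` sits one old particle `p`
    -- with `b ≤ p < a`, and the lowest new particle has no predecessor.
    branch : Form → Form
    branch F []           = 0#
    branch F (a ∷ [])     = path a * F []
    branch F (a ∷ b ∷ qs) = transfer (from b λ p → branch (F ⌞ p) (b ∷ qs)) a

    -- The term in which `path` takes `a` and the terms with starts `p < b` share the factor `z`.
    -- Together they are `z` times the wedge at `b ∷ b ∷ qs`, which vanishes by alternation.
    wedge-transferAll-∷∷ : ∀ {F} → Alternating F → ∀ a b qs → b ≤ a →
      wedge path (transferAll F) (a ∷ b ∷ qs) ≈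
      - transfer (from b λ p → wedge path (transferAll (F ⌞ p)) (b ∷ qs)) a
    wedge-transferAll-∷∷ {F} alt a b qs b≤a with z , path≈ , split ← transfer-split (ℕ.≤⇒≤′ b≤a) = begin
      path a * H (b ∷ qs) - wedge path (λ ps → transfer (λ p → transferAll (F ⌞ p) ps) a) (b ∷ qs)
        ≈⟨ +-congˡ (-‿cong (linear-transfer lin (λ p → transferAll (F ⌞ p)) a)) ⟩
      path a * H (b ∷ qs) - transfer g a
        ≈⟨ +-cong (trans (*-congʳ path≈) (*-assoc _ _ _)) (-‿cong (split g)) ⟩
      z * (path b * H (b ∷ qs)) - (z * transfer g b + rest)
        ≈⟨ +-congˡ (-‿cong (+-congʳ (*-congˡ (linear-transfer lin (λ p → transferAll (F ⌞ p)) b)))) ⟨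
      z * (path b * H (b ∷ qs)) - (z * (path b * H (b ∷ qs) - wedge path (H ⌞ b ⌞ b) qs) + rest)
        ≈⟨ +-congˡ (-‿cong (+-congʳ (*-congˡ (trans (+-congˡ (trans (-‿cong vanish) -0#≈0#)) (+-identityʳ _))))) ⟩
      u - (u + rest)
        ≈⟨ +-congˡ (-‿distrib-+ u rest) ⟩
      u + (- u - rest)
        ≈⟨ +-assoc _ _ _ ⟨
      (u - u) - rest
        ≈⟨ trans (+-congʳ (-‿inverseʳ u)) (+-identityˡ _) ⟩
      - rest ∎
      where
      H = transferAll F
      lin = wedge-linear path (b ∷ qs)
      g : ℕ → Carrier
      g p = wedge path (transferAll (F ⌞ p)) (b ∷ qs)
      rest = transfer (from b g) a
      u = z * (path b * H (b ∷ qs))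
      vanish : wedge path (H ⌞ b ⌞ b) qs ≈ 0#
      vanish = trans (cong-≈ (wedge-linear path qs) (repeat (transferAll-alternating alt) [] b))
        (0-homo (wedge-linear path qs))

    -- Each use of `wedge-transferAll-∷∷` costs a sign, until `path` takes the last argument, the
    -- particle of the lowest row.
    wedge-transferAll : ∀ {F M} → Alternating F → ∀ a qs → Descending M (a ∷ qs) →
      wedge path (transferAll F) (a ∷ qs) ≈ sign (length qs) * branch F (a ∷ qs)
    wedge-transferAll alt a []       _ = trans (+-congˡ -0#≈0#) (trans (+-identityʳ _) (sym (*-identityˡ _)))
    wedge-transferAll {F} alt a (b ∷ qs) (_ ∷ b≤a ∷ desc) = begin
      wedge path (transferAll F) (a ∷ b ∷ qs)
        ≈⟨ wedge-transferAll-∷∷ alt a b qs b≤a ⟩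
      - transfer (from b λ p → wedge path (transferAll (F ⌞ p)) (b ∷ qs)) a
        ≈⟨ -‿cong (transfer-cong (λ p → trans
             (when-cong (b ≤ᵇ p) (λ _ → wedge-transferAll (⌞-alternating alt p) b qs (b≤a ∷ desc)))
             (when-* (b ≤ᵇ p) _ _)) a) ⟩
      - transfer (λ p → sign (length qs) * from b (λ p → branch (F ⌞ p) (b ∷ qs)) p) a
        ≈⟨ -‿cong (transfer-* _ _ a) ⟩
      - (sign (length qs) * branch F (a ∷ b ∷ qs))
        ≈⟨ sign-suc (length qs) _ ⟨
      sign (suc (length qs)) * branch F (a ∷ b ∷ qs) ∎

  module Levels (y : ℕ → ℕ → Carrier) where
    open module T j = Transfer (y j)
    open module B j = Branch (y j)

    -- The factor `sign j` compensates for the new particle standing last, behind `j` older ones.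
    -- The form is supported on lists whose length is the level.
    slater : ℕ → Form
    slater zero    []      = 1#
    slater zero    (_ ∷ _) = 0#
    slater (suc j) qs      = sign j * wedge (path j) (transferAll j (slater j)) qs

    slater-alternating : ∀ j → Alternating (slater j)
    slater-alternating zero = record
      { swap   = λ { [] _ _ _ → sym -0#≈0# ; (_ ∷ _) _ _ _ → sym -0#≈0# }
      ; repeat = λ { [] _ _ → refl ; (_ ∷ _) _ _ → refl }
      }
    slater-alternating (suc j) = *-alternating _ (wedge-alternating _ (transferAll-alternating j (slater-alternating j)))

    slater-branch : ∀ {M} a qs → Descending M (a ∷ qs) →
      slater (suc (length qs)) (a ∷ qs) ≈ branch (length qs) (slater (length qs)) (a ∷ qs)
    slater-branch a qs desc = trans
      (*-congˡ (wedge-transferAll (length qs) (slater-alternating (length qs)) a qs desc))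
      (sign-square (length qs) _)

    pathSum : ℕ → ℕ → Carrier
    pathSum N m = sum< m λ j → path j N

    shift-slater : ∀ N → (∀ j q → y j (q +ℕ N) ≈ y j q) →
      ∀ m qs → shift N (slater m) qs ≈ pathSum N m * slater m qs
    shift-slater N per zero [] = sym (zeroˡ _)
    shift-slater N per zero (q ∷ qs) = trans (+-identityˡ _)
      (trans (0-homo (shift-linear N qs)) (sym (zeroˡ _)))
    shift-slater N per (suc j) qs = begin
      shift N (λ ps → sign j * wedge (path j) (transferAll j (slater j)) ps) qs
        ≈⟨ *-homo (shift-linear N qs) _ _ ⟩
      sign j * shift N (wedge (path j) (transferAll j (slater j))) qs
        ≈⟨ *-congˡ (T.Periodic.shift-wedge-transferAll j N (per j) (pathSum N j) (slater-alternating j) (shift-slater N per j) qs) ⟩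
      sign j * (pathSum N (suc j) * wedge (path j) (transferAll j (slater j)) qs)
        ≈⟨ x*yz≈y*xz _ _ _ ⟩
      pathSum N (suc j) * slater (suc j) qs ∎

-- Sums over tableaux and the removal of the largest letter.

module TableauSums {c ℓ} (R : CommutativeRing c ℓ) (w : ℕ → ℕ → ℕ → CommutativeRing.Carrier R) where

  open CommutativeRing R
  open Forms R
  open SlaterForms R
  open IsLinear
  open Relation.Binary.Reasoning.Setoid setoid

  sumWords : ℕ → ℕ → (List ℕ → Carrier) → Carrier
  sumWords m zero    f = f []
  sumWords m (suc a) f = sum< m λ e → sumWords m a λ v → f (e ∷ v)

  sumWords-cong : ∀ m a {f g} → (∀ v → length v ≡ a → All (_< m) v → f v ≈ g v) →
    sumWords m a f ≈ sumWords m a g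
  sumWords-cong m zero    eq = eq [] ≡.refl []
  sumWords-cong m (suc a) eq = sum<-cong m λ e e<m → sumWords-cong m a λ v l v<m →
    eq (e ∷ v) (≡.cong suc l) (e<m ∷ v<m)

  sumWords-0 : ∀ m a → sumWords m a (λ _ → 0#) ≈ 0#
  sumWords-0 m zero    = refl
  sumWords-0 m (suc a) = sum<-zero m λ _ _ → sumWords-0 m a

  sumWords-* : ∀ m a x f → sumWords m a (λ v → x * f v) ≈ x * sumWords m a f
  sumWords-* m zero    x f = refl
  sumWords-* m (suc a) x f = trans (sum<-cong m λ e _ → sumWords-* m a x _) (sum<-* m x _)

  linear-sumWords : ∀ {L} → IsLinear L → ∀ m a (G : List ℕ → Form) →
    L (λ qs → sumWords m a (λ v → G v qs)) ≈ sumWords m a (λ v → L (G v))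
  linear-sumWords lin m zero    G = refl
  linear-sumWords lin m (suc a) G = trans (linear-sum< lin m _)
    (sum<-cong m λ e _ → linear-sumWords lin m a _)

  sumWords-largest : ∀ m a (f : List ℕ → Carrier) →
    sumWords (suc m) a (λ v → when (leHead m v ∧ increasing v) (f v)) ≈ f (replicate a m)
  sumWords-largest m zero    f = refl
  sumWords-largest m (suc a) f = begin
    sum< m g + g m ≈⟨ +-cong (sum<-zero m smaller) refl ⟩
    0# + g m       ≈⟨ +-identityˡ _ ⟩
    g m            ≈⟨ largest ⟩
    f (replicate (suc a) m) ∎
    where
    g : ℕ → Carrier
    g e = sumWords (suc m) a λ v → when ((m ≤ᵇ e) ∧ (leHead e v ∧ increasing v)) (f (e ∷ v))
    smaller : ∀ e → e < m → g e ≈ 0#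
    smaller e e<m rewrite ≰⇒≤ᵇ-false (ℕ.<⇒≱ e<m) = sumWords-0 (suc m) a
    largest : g m ≈ f (replicate (suc a) m)
    largest rewrite ≤⇒≤ᵇ-true (ℕ.≤-refl {m}) = sumWords-largest m a (λ v → f (m ∷ v))

  -- In a weakly increasing row the letters `m` form a final block; `p` is the length of what
  -- precedes it.
  sumWords-split : ∀ m a (f : List ℕ → Carrier) →
    sumWords (suc m) a (λ v → when (increasing v) (f v)) ≈
    sum< (suc a) λ p → sumWords m p λ v → when (increasing v) (f (v ++ replicate (a ∸ p) m))
  sumWords-split m zero    f = sym (+-identityˡ _)
  sumWords-split m (suc a) f = begin
    sum< m (λ e → sumWords (suc m) a λ v → when (leHead e v ∧ increasing v) (f (e ∷ v)))
      + sumWords (suc m) a (λ v → when (leHead m v ∧ increasing v) (f (m ∷ v)))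
      ≈⟨ +-cong (sum<-cong m small) (sumWords-largest m a (λ v → f (m ∷ v))) ⟩
    sum< m (λ e → sum< (suc a) λ p → h e p) + f (replicate (suc a) m)
      ≈⟨ +-comm _ _ ⟩
    f (replicate (suc a) m) + sum< m (λ e → sum< (suc a) λ p → h e p)
      ≈⟨ +-congˡ (sum<-exchange m (suc a) h) ⟩
    f (replicate (suc a) m) + sum< (suc a) (λ p → sum< m λ e → h e p)
      ≈⟨ sum<-head (suc a) _ ⟨
    sum< (suc (suc a)) (λ p → sumWords m p λ v → when (increasing v) (f (v ++ replicate (suc a ∸ p) m))) ∎
    where
    h : ℕ → ℕ → Carrier
    h e p = sumWords m p λ v → when (increasing (e ∷ v)) (f (e ∷ v ++ replicate (a ∸ p) m))
    small : ∀ e → e < m →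
      sumWords (suc m) a (λ v → when (leHead e v ∧ increasing v) (f (e ∷ v))) ≈ sum< (suc a) (h e)
    small e e<m = begin
      sumWords (suc m) a (λ v → when (leHead e v ∧ increasing v) (f (e ∷ v)))
        ≈⟨ sumWords-cong (suc m) a (λ v _ _ → when-∧ (leHead e v) (increasing v) _) ⟩
      sumWords (suc m) a (λ v → when (increasing v) (when (leHead e v) (f (e ∷ v))))
        ≈⟨ sumWords-split m a _ ⟩
      sum< (suc a) (λ p → sumWords m p λ v → when (increasing v)
        (when (leHead e (v ++ replicate (a ∸ p) m)) (f (e ∷ v ++ replicate (a ∸ p) m))))
        ≈⟨ sum<-cong (suc a) (λ p _ → sumWords-cong m p λ v _ _ →
             trans (when-cong (increasing v) λ _ → when-≡ (leHead-++ v (a ∸ p) e<m))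
               (sym (when-∧ (leHead e v) (increasing v) _))) ⟩
      sum< (suc a) (h e) ∎

  rowWeight : ℕ → ℕ → List ℕ → Carrier
  rowWeight i j []      = 1#
  rowWeight i j (e ∷ v) = w e i j * rowWeight i (suc j) v

  rowWeight-++ : ∀ i j u v → rowWeight i j (u ++ v) ≈ rowWeight i j u * rowWeight i (j +ℕ length u) v
  rowWeight-++ i j []      v rewrite ℕ.+-identityʳ j = sym (*-identityˡ _)
  rowWeight-++ i j (e ∷ u) v rewrite ℕ.+-suc j (length u) =
    trans (*-congˡ (rowWeight-++ i (suc j) u v)) (sym (*-assoc _ _ _))

  -- Sum over the fillings of rows i, i + 1, … of lengths α by letters below m,
  -- where the row of index i moreover satisfies A.
  tableauSum : ℕ → ℕ → (List ℕ → Bool) → Form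
  tableauSum m i A []      = 1#
  tableauSum m i A (a ∷ α) = sumWords m a λ v → when (increasing v) (when (A v)
    (rowWeight i 0 v * tableauSum m (suc i) (above v) α))

  power : ℕ → ℕ → ℕ → ℕ → Carrier
  power m i p d = rowWeight i p (replicate d m)

  -- The counterpart of `branch` in terms of parts: `p` is the length of a row after its letters `m`
  -- are removed. The last row is still allowed to keep smaller letters; that this contributes
  -- nothing is shown in `branchParts≈branch`.
  branchParts : ℕ → ℕ → Form → Form
  branchParts m i F []          = 0#
  branchParts m i F (a ∷ [])    = sum< (suc a) λ p → power m i p (a ∸ p) * F (p ∷ [])
  branchParts m i F (a ∷ b ∷ α) = sum< (suc a) λ p →
    when (b ≤ᵇ p) (power m i p (a ∸ p) * branchParts m (suc i) (F ⌞ p) (b ∷ α))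

  branchParts-linear-∷∷ : ∀ m i a b α → IsLinear (λ F → branchParts m (suc i) F (b ∷ α)) →
    IsLinear (λ F → branchParts m i F (a ∷ b ∷ α))
  branchParts-linear-∷∷ m i a b α ih = record
    { cong-≈ = λ eq → sum<-cong (suc a) λ p _ → when-cong (b ≤ᵇ p) λ _ → *-congˡ (cong-≈ ih λ ps → eq (p ∷ ps))
    ; +-homo = λ F G → trans
        (sum<-cong (suc a) λ p _ → trans
          (when-cong (b ≤ᵇ p) λ _ → trans (*-congˡ (+-homo ih _ _)) (distribˡ _ _ _)) (when-+ (b ≤ᵇ p) _ _))
        (sum<-+ (suc a) _ _)
    ; *-homo = λ x F → trans
        (sum<-cong (suc a) λ p _ → trans
          (when-cong (b ≤ᵇ p) λ _ → trans (*-congˡ (*-homo ih _ _)) (x*yz≈y*xz _ _ _)) (when-* (b ≤ᵇ p) _ _))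
        (sum<-* (suc a) _ _)
    }
    where
    when-+ : ∀ b x y → when b (x + y) ≈ when b x + when b y
    when-+ true  x y = refl
    when-+ false x y = sym (+-identityˡ 0#)

  branchParts-linear : ∀ m i α → IsLinear (λ F → branchParts m i F α)
  branchParts-linear m i [] = record
    { cong-≈ = λ _ → refl
    ; +-homo = λ _ _ → sym (+-identityˡ 0#)
    ; *-homo = λ a _ → sym (zeroʳ a)
    }
  branchParts-linear m i (a ∷ []) = record
    { cong-≈ = λ eq → sum<-cong (suc a) λ p _ → *-congˡ (eq _)
    ; +-homo = λ F G → trans (sum<-cong (suc a) λ p _ → distribˡ _ _ _) (sum<-+ (suc a) _ _)
    ; *-homo = λ x F → trans (sum<-cong (suc a) λ p _ → x*yz≈y*xz _ _ _) (sum<-* (suc a) _ _)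
    }
  branchParts-linear m i (a ∷ b ∷ α) = branchParts-linear-∷∷ m i a b α (branchParts-linear m (suc i) (b ∷ α))

  -- Removes the letter `m` from all rows at once. The condition coming from above splits into `g`,
  -- which concerns lengths only, and `A′`, which concerns the remaining letters and passes into the
  -- form.
  tableauSum-branch : ∀ m i A A′ g a α →
    (∀ v d → length v +ℕ d ≡ a → All (_< m) v → A (v ++ replicate d m) ≡ g ∧ A′ v) →
    tableauSum (suc m) i A (a ∷ α) ≈ when g (branchParts m i (tableauSum m i A′) (a ∷ α))
  tableauSum-branch m i A A′ g a α A≡ = trans (sumWords-split m a _) (trans
    (sum<-cong (suc a) λ p p≤a → sumWords-cong m p λ v l v<m → when-cong (increasing v) λ _ →
      trans (when-≡
        (A≡ v (a ∸ p) (≡.trans (≡.cong (_+ℕ (a ∸ p)) l) (ℕ.m+[n∸m]≡n (s≤s⁻¹ p≤a))) v<m))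
      (trans (when-∧ g (A′ v) _) (when-cong (A′ v) λ _ → when-cong g λ _ →
        *-congʳ (trans (rowWeight-++ i 0 v _) (*-congˡ (reflexive (≡.cong (λ j → rowWeight i j (replicate (a ∸ p) m)) l)))))))
    (main g α))
    where
    main : ∀ g α →
      sum< (suc a) (λ p → sumWords m p λ v → when (increasing v) (when (A′ v) (when g
        (rowWeight i 0 v * power m i p (a ∸ p) *
          tableauSum (suc m) (suc i) (above (v ++ replicate (a ∸ p) m)) α)))) ≈
      when g (branchParts m i (tableauSum m i A′) (a ∷ α))
    main false α = sum<-zero (suc a) λ p _ → trans
      (sumWords-cong m p λ v _ _ → trans (when-cong (increasing v) λ _ → when-0 (A′ v)) (when-0 (increasing v)))
      (sumWords-0 m p)
    main true [] = sum<-cong (suc a) λ p _ → trans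
      (sumWords-cong m p λ v _ _ → trans
        (when-cong (increasing v) λ _ → trans
          (when-cong (A′ v) λ _ → trans (*-congʳ (*-comm _ _)) (*-assoc _ _ _)) (when-* (A′ v) _ _))
        (when-* (increasing v) _ _))
      (sumWords-* m p _ _)
    main true (b ∷ α) = sum<-cong (suc a) λ p _ → trans
      (sumWords-cong m p λ v l v<m → trans
        (when-cong (increasing v) λ _ → trans
          (when-cong (A′ v) λ _ → trans (*-cong (*-comm _ _)
            -- The lower row has full length `b` and the trimmed upper row has length `p`, so the
            -- length condition of `above-++` reads `b ≤ p`.
            (tableauSum-branch m (suc i) _ (above v) (b ≤ᵇ p) b α λ v′ d eq v′<m → ≡.trans
              (above-++ v v′ (a ∸ p) d v<m v′<m)
              (≡.cong (_∧ above v v′) (≡.cong₂ _≤ᵇ_ eq l))))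
            (trans (*-assoc _ _ _) (trans (*-congˡ (sym (when-* (b ≤ᵇ p) _ _))) (sym (when-* (b ≤ᵇ p) _ _)))))
          (when-swap (A′ v) (b ≤ᵇ p) _))
        (when-swap (increasing v) (b ≤ᵇ p) _))
      (trans (sumWords-when m p (b ≤ᵇ p) _) (when-cong (b ≤ᵇ p) λ _ → let lin = branchParts-linear m (suc i) (b ∷ α) in
        trans (sumWords-cong m p λ v _ _ → trans
          (when-cong (increasing v) λ _ → when-* (A′ v) _ _) (when-* (increasing v) _ _))
        (trans (sumWords-* m p _ _) (*-congˡ (sym (trans (linear-sumWords lin m p _)
          (sumWords-cong m p λ v _ _ → trans (linear-when lin (increasing v) _)
            (when-cong (increasing v) λ _ → trans (linear-when lin (A′ v) _)
              (when-cong (A′ v) λ _ → *-homo lin _ _)))))))))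
      where
      when-swap : ∀ a b x → when a (when b x) ≈ when b (when a x)
      when-swap true  b x = refl
      when-swap false b x = sym (when-0 b)
      sumWords-when : ∀ m p b f → sumWords m p (λ v → when b (f v)) ≈ when b (sumWords m p f)
      sumWords-when m p true  f = refl
      sumWords-when m p false f = sumWords-0 m p

  -- The first column increases strictly from `e`, so it runs out of letters within `length α`
  -- further rows.
  tableauSum-tooMany : ∀ m i e v α → e < m → m ≤ e +ℕ length α → All (1 ≤_) α →
    tableauSum m i (above (e ∷ v)) α ≈ 0#
  tableauSum-tooMany m i e v []          e<m m≤e _        =
    contradiction (ℕ.≤-trans m≤e (ℕ.≤-reflexive (ℕ.+-identityʳ e))) (ℕ.<⇒≱ e<m)
  tableauSum-tooMany m i e v (suc a ∷ α) e<m m≤e (_ ∷ 1≤) = sum<-zero m λ f f<m → trans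
    (sumWords-cong m a λ v′ _ _ → trans
      (when-cong (increasing (f ∷ v′)) λ _ → zero-when f v′ f<m) (when-0 (increasing (f ∷ v′))))
    (sumWords-0 m a)
    where
    zero-when : ∀ f v′ → f < m → when (above (e ∷ v) (f ∷ v′))
      (rowWeight i 0 (f ∷ v′) * tableauSum m (suc i) (above (f ∷ v′)) α) ≈ 0#
    zero-when f v′ f<m with e <ᵇ f in eq
    ... | false = refl
    ... | true  = trans (when-cong (above v v′) λ _ → trans (*-congˡ
      (tableauSum-tooMany m (suc i) f v′ α f<m
        (ℕ.≤-trans m≤e (ℕ.≤-trans (ℕ.≤-reflexive (ℕ.+-suc e (length α)))
          (ℕ.+-monoˡ-≤ (length α) (ℕ.<ᵇ⇒< e f (≡.subst T (≡.sym eq) tt))))) 1≤))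
      (zeroʳ _)) (when-0 (above v v′))

  tableauSum-zero : ∀ m i A α → A [] ≡ true → tableauSum m i A (α ∷ʳ 0) ≈ tableauSum m i A α
  tableauSum-zero m i A []      A[] rewrite A[] = *-identityˡ _
  tableauSum-zero m i A (a ∷ α) A[] = sumWords-cong m a λ v _ _ →
    when-cong (increasing v) λ _ → when-cong (A v) λ _ → *-congˡ (tableauSum-zero m (suc i) (above v) α ≡.refl)

  schur : ℕ → Form
  schur m = tableauSum m 0 (const true)

  schur-tooMany : ∀ {M} m ν p → length ν ≡ m → Descending M (ν ∷ʳ suc p) → schur m (ν ∷ʳ suc p) ≈ 0#
  schur-tooMany m ν p l d = first (ν ∷ʳ suc p)
    (≡.trans (length-++ ν) (≡.trans (ℕ.+-comm _ 1) (≡.cong suc l))) (descending-∷ʳ-suc ν p d)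
    where
    first : ∀ α → length α ≡ suc m → All (1 ≤_) α → schur m α ≈ 0#
    first (suc a ∷ α) l (_ ∷ 1≤) = sum<-zero m λ e e<m → trans
      (sumWords-cong m a λ v _ _ → trans (when-cong (increasing (e ∷ v)) λ _ → trans
        (*-congˡ (tableauSum-tooMany m 1 e v α e<m
          (ℕ.≤-trans (ℕ.≤-reflexive (≡.sym (ℕ.suc-injective l))) (ℕ.m≤n+m _ e)) 1≤)) (zeroʳ _)) (when-0 (increasing (e ∷ v))))
      (sumWords-0 m a)

  module Contents (w-content : ∀ e i j → w e (suc i) (suc j) ≈ w e i j) where

    -- The step q → q + 1 of the level-e particle adds a box of row i in the
    -- column j with j + e = q + i.
    y : ℕ → ℕ → Carrier
    y e q = w e e q

    open Levels y
    open module T′ j = Transfer (y j)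
    open module B′ j = Branch (y j)

    w-shift : ∀ e i j k → w e (i +ℕ k) (j +ℕ k) ≈ w e i j
    w-shift e i j zero    rewrite ℕ.+-identityʳ i | ℕ.+-identityʳ j = refl
    w-shift e i j (suc k) rewrite ℕ.+-suc i k | ℕ.+-suc j k = trans (w-content e _ _) (w-shift e i j k)

    -- `rowWeight` takes its factors from the left end of a row, `path` and `transfer` from the
    -- right end.
    power-snoc : ∀ m i p d → power m i p (suc d) ≈ w m i (p +ℕ d) * power m i p d
    power-snoc m i p zero    rewrite ℕ.+-identityʳ p = refl
    power-snoc m i p (suc d) rewrite ℕ.+-suc p d =
      trans (*-congˡ (power-snoc m i (suc p) d)) (x*yz≈y*xz _ _ _)

    power≈path : ∀ m a → power m m 0 a ≈ path m a
    power≈path m zero    = refl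
    power≈path m (suc a) = trans (power-snoc m m 0 a) (*-congˡ (power≈path m a))

    -- From parts to positions: the row has `k` rows below it before the letter `m` is added and
    -- `suc k` afterwards. Positions below `k` belong to no part, so `f` must vanish there.
    sum-power≈transfer : ∀ m i k f → i +ℕ suc k ≡ m → (∀ q → q < k → f q ≈ 0#) → ∀ a →
      sum< (suc a) (λ p → power m i p (a ∸ p) * f (p +ℕ k)) ≈ transfer m f (a +ℕ suc k)
    sum-power≈transfer m i k f ≡.refl f-zero = go
      where
      below : ∀ q → q ≤ k → transfer m f q ≈ 0#
      below zero    _   = refl
      below (suc q) q<k = trans (+-cong (f-zero q q<k) (trans (*-congˡ (below q (ℕ.<⇒≤ q<k))) (zeroʳ _))) (+-identityˡ 0#)
      go : ∀ a → sum< (suc a) (λ p → power m i p (a ∸ p) * f (p +ℕ k)) ≈ transfer m f (a +ℕ suc k)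
      go zero = begin
        0# + 1# * f k                 ≈⟨ trans (+-identityˡ _) (*-identityˡ _) ⟩
        f k                           ≈⟨ +-identityʳ _ ⟨
        f k + 0#                      ≈⟨ +-congˡ (trans (*-congˡ (below k ℕ.≤-refl)) (zeroʳ _)) ⟨
        f k + y m k * transfer m f k  ∎
      go (suc a) = begin
        sum< (suc a) (λ p → power m i p (suc a ∸ p) * f (p +ℕ k)) + power m i (suc a) (a ∸ a) * f (suc a +ℕ k)
          ≈⟨ +-cong (trans (sum<-cong (suc a) extend) (sum<-* (suc a) _ _)) last ⟩
        w m i a * sum< (suc a) (λ p → power m i p (a ∸ p) * f (p +ℕ k)) + f (suc a +ℕ k)
          ≈⟨ +-cong (*-cong (sym (w-shift m i a (suc k))) (go a)) (reflexive (≡.cong f (≡.sym (ℕ.+-suc a k)))) ⟩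
        y m (a +ℕ suc k) * transfer m f (a +ℕ suc k) + f (a +ℕ suc k)
          ≈⟨ +-comm _ _ ⟩
        transfer m f (suc a +ℕ suc k) ∎
        where
        extend : ∀ p → p < suc a →
          power m i p (suc a ∸ p) * f (p +ℕ k) ≈ w m i a * (power m i p (a ∸ p) * f (p +ℕ k))
        extend p p≤a rewrite ℕ.+-∸-assoc 1 (s≤s⁻¹ p≤a) = trans
          (*-congʳ (trans (power-snoc m i p (a ∸ p))
            (*-congʳ (reflexive (≡.cong (w m i) (ℕ.m+[n∸m]≡n (s≤s⁻¹ p≤a)))))))
          (*-assoc _ _ _)
        last : power m i (suc a) (a ∸ a) * f (suc a +ℕ k) ≈ f (suc a +ℕ k)
        last rewrite ℕ.n∸n≡0 a = *-identityˡ _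

    -- Without its letters `m` the shape still has one row more than there are letters. `F` agrees
    -- with `G` if that last row is empty and vanishes otherwise.
    branchParts≈branch : ∀ m i {M} (F G : Form) a α → i +ℕ length α ≡ m → Descending M (a ∷ α) →
      (∀ ν → length ν ≡ length α → Descending M ν → F (ν ∷ʳ 0) ≈ G (positions ν)) →
      (∀ ν p → length ν ≡ length α → Descending M (ν ∷ʳ suc p) → F (ν ∷ʳ suc p) ≈ 0#) →
      branchParts m i F (a ∷ α) ≈ branch m G (positions (a ∷ α))
    branchParts≈branch m i {M} F G a [] i≡m (a≤M ∷ _) F≈G F≈0
      rewrite ℕ.+-identityʳ i | i≡m | ℕ.+-identityʳ a = begin
      sum< (suc a) (λ p → power m m p (a ∸ p) * F (p ∷ []))
        ≈⟨ sum<-head a _ ⟩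
      power m m 0 a * F (0 ∷ []) + sum< a (λ p → power m m (suc p) (a ∸ suc p) * F (suc p ∷ []))
        ≈⟨ +-cong (*-cong (power≈path m a) (F≈G [] ≡.refl []))
             -- Only `p = 0` survives, so the lowest row consists of letters `m` throughout.
             (sum<-zero a λ p p<a → trans (*-congˡ (F≈0 [] p ≡.refl (ℕ.≤-trans p<a a≤M ∷ []))) (zeroʳ _)) ⟩
      path m a * G [] + 0#
        ≈⟨ +-identityʳ _ ⟩
      path m a * G [] ∎
    branchParts≈branch m i {M} F G a (b ∷ α) i≡m (a≤M ∷ b≤a ∷ d) F≈G F≈0 = begin
      sum< (suc a) (λ p → when (b ≤ᵇ p) (power m i p (a ∸ p) * branchParts m (suc i) (F ⌞ p) (b ∷ α)))
        ≈⟨ sum<-cong (suc a) (λ p p≤a → trans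
             (when-cong (b ≤ᵇ p) λ b≤ᵇp → *-congˡ (ih p (s≤s⁻¹ p≤a) (ℕ.≤ᵇ⇒≤ b p (≡.subst T (≡.sym b≤ᵇp) tt))))
             (trans (when-* (b ≤ᵇ p) _ _) (*-congˡ (when-≡ (≡.sym (≤ᵇ-+ʳ b p k)))))) ⟩
      sum< (suc a) (λ p → power m i p (a ∸ p) * from m (b +ℕ k) H (p +ℕ k))
        ≈⟨ sum-power≈transfer m i k (from m (b +ℕ k) H) i≡m
             (λ q q<k → when-≡ (≰⇒≤ᵇ-false (ℕ.<⇒≱ (ℕ.≤-trans q<k (ℕ.m≤n+m k b))))) a ⟩
      transfer m (from m (b +ℕ k) H) (a +ℕ suc k) ∎
      where
      k = length α
      H : ℕ → Carrier
      H q = branch m (G ⌞ q) (positions (b ∷ α))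
      ih : ∀ p → p ≤ a → b ≤ p →
        branchParts m (suc i) (F ⌞ p) (b ∷ α) ≈ branch m (G ⌞ (p +ℕ k)) (positions (b ∷ α))
      ih p p≤a b≤p = branchParts≈branch m (suc i) (F ⌞ p) (G ⌞ (p +ℕ k)) b α
        (≡.trans (≡.sym (ℕ.+-suc i k)) i≡m) (b≤p ∷ d)
        (λ ν l dν → trans (F≈G (p ∷ ν) (≡.cong suc l) (ℕ.≤-trans p≤a a≤M ∷ dν))
          (reflexive (≡.cong (λ t → G (p +ℕ t ∷ positions ν)) l)))
        (λ ν p′ l dν → F≈0 (p ∷ ν) p′ (≡.cong suc l) (ℕ.≤-trans p≤a a≤M ∷ dν))

    schur≈slater : ∀ m {M} α → length α ≡ m → Descending M α → schur m α ≈ slater m (positions α)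
    schur≈slater zero    []      _ _ = refl
    schur≈slater (suc m) (a ∷ α) l d = begin
      schur (suc m) (a ∷ α)
        ≈⟨ tableauSum-branch m 0 _ (const true) true a α (λ _ _ _ _ → ≡.refl) ⟩
      branchParts m 0 (schur m) (a ∷ α)
        ≈⟨ branchParts≈branch m 0 (schur m) (slater m) a α l′ d
             (λ ν lν dν → trans (tableauSum-zero m 0 _ ν ≡.refl) (schur≈slater m ν (≡.trans lν l′) dν))
             (λ ν p lν dν → schur-tooMany m ν p (≡.trans lν l′) dν) ⟩
      branch m (slater m) (positions (a ∷ α))
        ≈⟨ ≡.subst (λ m → slater (suc m) (positions (a ∷ α)) ≈ branch m (slater m) (positions (a ∷ α)))
             (≡.trans (positions-length α) l′)
             (slater-branch (a +ℕ length α) (positions α) (positions-descending (a ∷ α) d)) ⟨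
      slater (suc m) (positions (a ∷ α)) ∎
      where l′ = ℕ.suc-injective l

-- Formal sums of terms, compared by coefficients, form a commutative ring.

module PolynomialLaws (v : ℕ) where

  open import Data.Nat.Base using (_+_)
  open ≡ using (refl; sym; trans; cong; cong₂; module ≡-Reasoning)
  open Algebra.Properties.CommutativeSemigroup (CommutativeRing.+-commutativeSemigroup ℚ.+-*-commutativeRing) using () renaming (x∙yz≈y∙xz to x+yz≡y+xz)

  open RawRing (polynomialRing v) using (_≈_; 1#) renaming (_*_ to _·_; -_ to neg)

  P = Polynomial v

  termAt : ℚ × Monomial v → Monomial v → ℚ
  termAt (c , d) e = if does (Vec.≡-dec ℕ._≟_ d e) then c else 0ℚ

  coefficient-++ : ∀ (p q : P) e → coefficient (p ++ q) e ≡ coefficient p e +ℚ coefficient q e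
  coefficient-++ []            q e = sym (ℚ.+-identityˡ (coefficient q e))
  coefficient-++ ((c , d) ∷ p) q e = trans
    (cong (termAt (c , d) e +ℚ_) (coefficient-++ p q e))
    (sym (ℚ.+-assoc (termAt (c , d) e) (coefficient p e) (coefficient q e)))

  coefficient-neg : ∀ (p : P) e → coefficient (neg p) e ≡ -ℚ coefficient p e
  coefficient-neg []            e = refl
  coefficient-neg ((c , d) ∷ p) e with does (Vec.≡-dec ℕ._≟_ d e)
  ... | true  = trans (cong (-ℚ c +ℚ_) (coefficient-neg p e)) (sym (ℚ.neg-distrib-+ c (coefficient p e)))
  ... | false = trans (cong (0ℚ +ℚ_) (coefficient-neg p e)) (sym (ℚ.neg-distrib-+ 0ℚ (coefficient p e)))

  +-cong : ∀ {p p′ q q′ : P} → p ≈ p′ → q ≈ q′ → p ++ q ≈ p′ ++ q′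
  +-cong {p} {p′} {q} {q′} p≈ q≈ e =
    trans (coefficient-++ p q e) (trans (cong₂ _+ℚ_ (p≈ e) (q≈ e)) (sym (coefficient-++ p′ q′ e)))

  +-comm : ∀ (p q : P) → p ++ q ≈ q ++ p
  +-comm p q e = trans (coefficient-++ p q e) (trans (ℚ.+-comm (coefficient p e) (coefficient q e)) (sym (coefficient-++ q p e)))

  neg-inverseʳ : ∀ (p : P) → p ++ neg p ≈ []
  neg-inverseʳ p e = trans (coefficient-++ p (neg p) e)
    (trans (cong (coefficient p e +ℚ_) (coefficient-neg p e)) (ℚ.+-inverseʳ (coefficient p e)))

  neg-inverseˡ : ∀ (p : P) → neg p ++ p ≈ []
  neg-inverseˡ p e = trans (+-comm (neg p) p e) (neg-inverseʳ p e)

  neg-cong : ∀ {p q : P} → p ≈ q → neg p ≈ neg q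
  neg-cong {p} {q} p≈q e = trans (coefficient-neg p e) (trans (cong -ℚ_ (p≈q e)) (sym (coefficient-neg q e)))

  mulTerm-comm : ∀ (s t : ℚ × Monomial v) → mulTerm s t ≡ mulTerm t s
  mulTerm-comm (c , d) (c′ , d′) = cong₂ _,_ (ℚ.*-comm c c′) (Vec.zipWith-comm ℕ.+-comm d d′)

  mulTerm-assoc : ∀ (s t u : ℚ × Monomial v) → mulTerm (mulTerm s t) u ≡ mulTerm s (mulTerm t u)
  mulTerm-assoc (c , d) (c′ , d′) (c″ , d″) = cong₂ _,_ (ℚ.*-assoc c c′ c″) (Vec.zipWith-assoc ℕ.+-assoc d d′ d″)

  ·-distribʳ : ∀ (p q r : P) → (q ++ r) · p ≡ (q · p) ++ (r · p)
  ·-distribʳ p []      r = refl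
  ·-distribʳ p (t ∷ q) r = trans (cong (map (mulTerm t) p ++_) (·-distribʳ p q r)) (sym (++-assoc (map (mulTerm t) p) _ _))

  map-mulTerm : ∀ t (q r : P) → map (mulTerm t) q · r ≡ map (mulTerm t) (q · r)
  map-mulTerm t []      r = refl
  map-mulTerm t (s ∷ q) r = trans (cong₂ _++_ (go r) (map-mulTerm t q r)) (sym (map-++ (mulTerm t) (map (mulTerm s) r) _))
    where
    go : ∀ r → map (mulTerm (mulTerm t s)) r ≡ map (mulTerm t) (map (mulTerm s) r)
    go []      = refl
    go (u ∷ r) = cong₂ _∷_ (mulTerm-assoc t s u) (go r)

  ·-assoc : ∀ (p q r : P) → (p · q) · r ≡ p · (q · r)
  ·-assoc []      q r = refl
  ·-assoc (t ∷ p) q r = trans (·-distribʳ r (map (mulTerm t) q) (p · q)) (cong₂ _++_ (map-mulTerm t q r) (·-assoc p q r))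

  ·-identityˡ : ∀ (p : P) → 1# · p ≡ p
  ·-identityˡ p = trans (++-identityʳ _) (go p)
    where
    go : ∀ p → map (mulTerm (1ℚ , Vec.replicate v 0)) p ≡ p
    go []            = refl
    go ((c , d) ∷ p) = cong₂ _∷_ (cong₂ _,_ (ℚ.*-identityˡ c) (Vec.zipWith-identityˡ ℕ.+-identityˡ d)) (go p)

  ·-∷ʳ : ∀ (p : P) t q → p · (t ∷ q) ≈ map (mulTerm t) p ++ (p · q)
  ·-∷ʳ []      t q e = refl
  ·-∷ʳ (s ∷ p) t q e = begin
    coefficient (mulTerm s t ∷ (map (mulTerm s) q ++ (p · (t ∷ q)))) e
      ≡⟨ cong (λ u → coefficient (u ∷ (map (mulTerm s) q ++ (p · (t ∷ q)))) e) (mulTerm-comm s t) ⟩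
    m +ℚ coefficient (map (mulTerm s) q ++ (p · (t ∷ q))) e
      ≡⟨ cong (m +ℚ_) (trans (coefficient-++ (map (mulTerm s) q) (p · (t ∷ q)) e) (cong (coefficient (map (mulTerm s) q) e +ℚ_)
           (trans (·-∷ʳ p t q e) (coefficient-++ (map (mulTerm t) p) (p · q) e)))) ⟩
    m +ℚ (coefficient (map (mulTerm s) q) e +ℚ (coefficient (map (mulTerm t) p) e +ℚ coefficient (p · q) e))
      ≡⟨ cong (m +ℚ_) (x+yz≡y+xz (coefficient (map (mulTerm s) q) e) (coefficient (map (mulTerm t) p) e) (coefficient (p · q) e)) ⟩
    m +ℚ (coefficient (map (mulTerm t) p) e +ℚ (coefficient (map (mulTerm s) q) e +ℚ coefficient (p · q) e))
      ≡⟨ cong (m +ℚ_) (trans (coefficient-++ (map (mulTerm t) p) (map (mulTerm s) q ++ (p · q)) e)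
           (cong (coefficient (map (mulTerm t) p) e +ℚ_) (coefficient-++ (map (mulTerm s) q) (p · q) e))) ⟨
    m +ℚ coefficient (map (mulTerm t) p ++ (map (mulTerm s) q ++ (p · q))) e ∎
    where
    open ≡-Reasoning
    m = termAt (mulTerm t s) e

  ·-zeroʳ : ∀ (p : P) → p · [] ≡ []
  ·-zeroʳ []      = refl
  ·-zeroʳ (t ∷ p) = ·-zeroʳ p

  ·-comm : ∀ (p q : P) → p · q ≈ q · p
  ·-comm p []      e = cong (λ p → coefficient p e) (·-zeroʳ p)
  ·-comm p (t ∷ q) e = trans (·-∷ʳ p t q e) (+-cong {map (mulTerm t) p} {map (mulTerm t) p} {p · q} {q · p} (λ _ → refl) (·-comm p q) e)

  subtract? : ∀ {v} (d e : Monomial v) → Dec (∃ λ e′ → zipWith _+_ d e′ ≡ e)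
  subtract? []      []      = yes ([] , refl)
  subtract? (a ∷ d) (b ∷ e) with a ℕ.≤? b | subtract? d e
  ... | no a≰b  | _              = no λ { (c ∷ _ , eq) → a≰b (ℕ.m+n≤o⇒m≤o a (ℕ.≤-reflexive (proj₁ (Vec.∷-injective eq)))) }
  ... | yes _   | no d≰e         = no λ { (_ ∷ e′ , eq) → d≰e (e′ , proj₂ (Vec.∷-injective eq)) }
  ... | yes a≤b | yes (e′ , refl) with c , refl ← ℕ.m≤n⇒∃[o]m+o≡n a≤b = yes (c ∷ e′ , refl)

  zipWith-+-cancelˡ : ∀ {v} (d e e′ : Monomial v) → zipWith _+_ d e ≡ zipWith _+_ d e′ → e ≡ e′
  zipWith-+-cancelˡ []      []      []        _  = refl
  zipWith-+-cancelˡ (a ∷ d) (b ∷ e) (b′ ∷ e′) eq = cong₂ _∷_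
    (ℕ.+-cancelˡ-≡ a b b′ (proj₁ (Vec.∷-injective eq))) (zipWith-+-cancelˡ d e e′ (proj₂ (Vec.∷-injective eq)))

  coefficient-mulTerm : ∀ c (d e : Monomial v) q → coefficient (map (mulTerm (c , d)) q) (zipWith _+_ d e) ≡ c *ℚ coefficient q e
  coefficient-mulTerm c d e []              = sym (ℚ.*-zeroʳ c)
  coefficient-mulTerm c d e ((c′ , d′) ∷ q) = trans (cong₂ _+ℚ_ term (coefficient-mulTerm c d e q)) (sym (ℚ.*-distribˡ-+ c (termAt (c′ , d′) e) (coefficient q e)))
    where
    term : termAt (mulTerm (c , d) (c′ , d′)) (zipWith _+_ d e) ≡ c *ℚ termAt (c′ , d′) e
    term with Vec.≡-dec ℕ._≟_ d′ e
    ... | yes refl rewrite dec-true (Vec.≡-dec ℕ._≟_ (zipWith _+_ d d′) (zipWith _+_ d d′)) refl = refl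
    ... | no d′≢e rewrite dec-false (Vec.≡-dec ℕ._≟_ (zipWith _+_ d d′) (zipWith _+_ d e)) (λ eq → d′≢e (zipWith-+-cancelˡ d d′ e eq)) =
      sym (ℚ.*-zeroʳ c)

  coefficient-mulTerm-0 : ∀ c (d e : Monomial v) → ¬ (∃ λ e′ → zipWith _+_ d e′ ≡ e) → ∀ q → coefficient (map (mulTerm (c , d)) q) e ≡ 0ℚ
  coefficient-mulTerm-0 c d e none []              = refl
  coefficient-mulTerm-0 c d e none ((c′ , d′) ∷ q)
    rewrite dec-false (Vec.≡-dec ℕ._≟_ (zipWith _+_ d d′) e) (λ eq → none (d′ , eq)) =
    trans (ℚ.+-identityˡ (coefficient (map (mulTerm (c , d)) q) e)) (coefficient-mulTerm-0 c d e none q)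

  -- Equal coefficients do not match terms, so the coefficients of a product have to be read off
  -- from those of `q`: multiplying by a term with monomial `d` moves the coefficient at `e′` to
  -- `d + e′`, and leaves zero at monomials not divisible by `d`.
  ·-congˡ : ∀ (p : P) {q q′} → q ≈ q′ → p · q ≈ p · q′
  ·-congˡ []            q≈ e = refl
  ·-congˡ ((c , d) ∷ p) {q} {q′} q≈ e = +-cong {map (mulTerm (c , d)) q} {map (mulTerm (c , d)) q′} {p · q} {p · q′} first (·-congˡ p q≈) e
    where
    first : map (mulTerm (c , d)) q ≈ map (mulTerm (c , d)) q′
    first e with subtract? d e
    ... | yes (e′ , refl) = trans (coefficient-mulTerm c d e′ q) (trans (cong (c *ℚ_) (q≈ e′)) (sym (coefficient-mulTerm c d e′ q′)))
    ... | no none = trans (coefficient-mulTerm-0 c d e none q) (sym (coefficient-mulTerm-0 c d e none q′))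

  ·-congʳ : ∀ (q : P) {p p′} → p ≈ p′ → p · q ≈ p′ · q
  ·-congʳ q {p} {p′} p≈ e = trans (·-comm p q e) (trans (·-congˡ q p≈ e) (·-comm q p′ e))

  ≡⇒≈ : ∀ {p q : P} → p ≡ q → p ≈ q
  ≡⇒≈ p≡q e = cong (λ p → coefficient p e) p≡q

  ·-distribˡ : ∀ (p q r : P) → p · (q ++ r) ≈ (p · q) ++ (p · r)
  ·-distribˡ p q r e = trans (·-comm p (q ++ r) e) (trans (≡⇒≈ (·-distribʳ p q r) e)
    (+-cong {q · p} {p · q} {r · p} {p · r} (·-comm q p) (·-comm r p) e))

polynomialCommutativeRing : ℕ → CommutativeRing 0ℓ 0ℓ
polynomialCommutativeRing v = record
  { RawRing (polynomialRing v)
  ; isCommutativeRing = record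
    { isRing = record
      { +-isAbelianGroup = record
        { isGroup = record
          { isMonoid = record
            { isSemigroup = record
              { isMagma = record
                { isEquivalence = record
                  { refl  = λ _ → refl
                  ; sym   = λ p≈q e → sym (p≈q e)
                  ; trans = λ p≈q q≈r e → trans (p≈q e) (q≈r e)
                  }
                ; ∙-cong = λ {p} {p′} {q} {q′} → +-cong {p} {p′} {q} {q′}
                }
              ; assoc = λ p q r → ≡⇒≈ (++-assoc p q r)
              }
            ; identity = (λ _ _ → refl) , (λ p → ≡⇒≈ (++-identityʳ p))
            }
          ; inverse = neg-inverseˡ , neg-inverseʳ
          ; ⁻¹-cong = λ {p} {q} → neg-cong {p} {q}
          }
        ; comm = +-comm
        }
      ; *-cong = λ {p} {p′} {q} {q′} p≈ q≈ e → trans (·-congʳ q {p} {p′} p≈ e) (·-congˡ p′ {q} {q′} q≈ e)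
      ; *-assoc = λ p q r → ≡⇒≈ (·-assoc p q r)
      ; *-identity = (λ p → ≡⇒≈ (·-identityˡ p)) , (λ p e → trans (·-comm p 1# e) (≡⇒≈ (·-identityˡ p) e))
      ; distrib = ·-distribˡ , (λ p q r → ≡⇒≈ (·-distribʳ p q r))
      }
    ; *-comm = ·-comm
    }
  }
  where
  open ≡ using (refl; sym; trans)
  open PolynomialLaws v
  open RawRing (polynomialRing v) using (1#)

-- Loop Schur functions and loop power sums in terms of particles.

module LoopSchur {c ℓ} (R : CommutativeRing c ℓ) {m n : ℕ} .{{_ : NonZero n}} (x : Fin m → Fin n → CommutativeRing.Carrier R) (r : Fin n) where

  open CommutativeRing R
  open Forms R
  open SlaterForms R hiding (sign)
  open Alternating
  open Relation.Binary.Reasoning.Setoid setoid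
  open Loop rawRing x
  open Algebra.Definitions.RawSemiring (RawRing.rawSemiring rawRing) using (_^_)
  module *-Sum = Algebra.Properties.CommutativeMonoid.Sum *-commutativeMonoid

  -- Extended by zero, so that letters and levels can be arbitrary naturals.
  X : ℕ → Fin n → Carrier
  X e j with e ℕ.<? m
  ... | yes e<m = x (fromℕ< e<m) j
  ... | no _    = 0#

  X-toℕ : ∀ e j → X (toℕ e) j ≈ x e j
  X-toℕ e j with toℕ e ℕ.<? m
  ... | yes e<m = reflexive (≡.cong (λ e → x e j) (Fin.fromℕ<-toℕ e e<m))
  ... | no e≮m  = contradiction (Fin.toℕ<n e) e≮m

  open TableauSums R (λ e i j → X e (superscript r i j))
  open Contents (λ e i j → reflexive (≡.cong (X e) (superscript-diagonal r i j)))
  open Levels y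
  open module L j = Transfer (y j)

  ∑-cong : ∀ {A : Set} (as : List A) {f g : A → Carrier} → (∀ {a} → a ∈ as → f a ≈ g a) → ∑ as f ≈ ∑ as g
  ∑-cong []       eq = refl
  ∑-cong (a ∷ as) eq = +-cong (eq (here ≡.refl)) (∑-cong as (eq ∘ there))

  ∑-++ : ∀ {A : Set} (as bs : List A) f → ∑ (as ++ bs) f ≈ ∑ as f + ∑ bs f
  ∑-++ []       bs f = sym (+-identityˡ _)
  ∑-++ (a ∷ as) bs f = trans (+-congˡ (∑-++ as bs f)) (sym (+-assoc _ _ _))

  ∑-map : ∀ {A B : Set} (g : A → B) as (f : B → Carrier) → ∑ (map g as) f ≈ ∑ as (f ∘ g)
  ∑-map g []       f = refl
  ∑-map g (a ∷ as) f = +-congˡ (∑-map g as f)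

  ∑-concatMap : ∀ {A B : Set} (g : A → List B) as f → ∑ (concatMap g as) f ≈ ∑ as (λ a → ∑ (g a) f)
  ∑-concatMap g []       f = refl
  ∑-concatMap g (a ∷ as) f = trans (∑-++ (g a) _ f) (+-congˡ (∑-concatMap g as f))

  ∑-cartesianProductWith : ∀ {A B C : Set} (g : A → B → C) as bs f →
    ∑ (cartesianProductWith g as bs) f ≈ ∑ as (λ a → ∑ bs (λ b → f (g a b)))
  ∑-cartesianProductWith g []       bs f = refl
  ∑-cartesianProductWith g (a ∷ as) bs f = trans (∑-++ (map (g a) bs) _ f)
    (+-cong (∑-map (g a) bs f) (∑-cartesianProductWith g as bs f))

  ∑-filter : ∀ {A : Set} {P : A → Set} (P? : ∀ a → Dec (P a)) as f → ∑ (filter P? as) f ≈ ∑ as (λ a → when (does (P? a)) (f a))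
  ∑-filter P? []       f = refl
  ∑-filter P? (a ∷ as) f with does (P? a)
  ... | true  = +-congˡ (∑-filter P? as f)
  ... | false = trans (∑-filter P? as f) (sym (+-identityˡ _))

  ∑-↭ : ∀ {A : Set} {as bs : List A} → as ↭ bs → ∀ f → ∑ as f ≈ ∑ bs f
  ∑-↭ ↭.refl          f = refl
  ∑-↭ (↭.prep a p)    f = +-congˡ (∑-↭ p f)
  ∑-↭ (↭.swap a b p)  f = trans (+-congˡ (+-congˡ (∑-↭ p f))) (x+yz≈y+xz _ _ _)
  ∑-↭ (↭.trans p q)   f = trans (∑-↭ p f) (∑-↭ q f)

  ∑-* : ∀ {A : Set} z (as : List A) f → ∑ as (λ a → z * f a) ≈ z * ∑ as f
  ∑-* z []       f = sym (zeroʳ z)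
  ∑-* z (a ∷ as) f = trans (+-congˡ (∑-* z as f)) (sym (distribˡ _ _ _))

  ∑-tabulate : ∀ {A : Set} {k} (g : Fin k → A) (f : A → Carrier) (h : ℕ → Carrier) →
    (∀ i → f (g i) ≈ h (toℕ i)) → ∑ (tabulate g) f ≈ sum< k h
  ∑-tabulate {k = zero}  g f h eq = refl
  ∑-tabulate {k = suc k} g f h eq =
    trans (+-cong (eq Fin.zero) (∑-tabulate (g ∘ Fin.suc) f (h ∘ suc) (eq ∘ Fin.suc))) (sym (sum<-head k h))

  ∑-vectors : ∀ a f → ∑ (vectors (allFin m) a) (f ∘ word) ≈ sumWords m a f
  ∑-vectors zero    f = +-identityʳ _
  ∑-vectors (suc a) f = trans (∑-cartesianProductWith _∷_ (allFin m) (vectors (allFin m) a) (f ∘ word))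
    (∑-tabulate {k = m} id _ (λ e → sumWords m a λ v → f (e ∷ v)) λ e → ∑-vectors a (λ v → f (toℕ e ∷ v)))

  weightFrom : ∀ {k} {α : Vec ℕ k} → ℕ → Filling m α → Carrier
  weightFrom i []      = 1#
  weightFrom i (v ∷ T) = rowWeight i 0 (word v) * weightFrom (suc i) T

  ∑-fillings : ∀ {k} i A (α : Vec ℕ k) →
    ∑ (fillings m α) (λ T → when (valid A T) (weightFrom i T)) ≈ tableauSum m i A (toList α)
  ∑-fillings i A []      = +-identityʳ _
  ∑-fillings i A (a ∷ α) = trans (∑-cartesianProductWith _∷_ (vectors (allFin m) a) (fillings m α) _) (trans
    (∑-cong (vectors (allFin m) a) (λ {v} _ → row v))
    (∑-vectors a (λ v → when (increasing v) (when (A v) (rowWeight i 0 v * tableauSum m (suc i) (above v) (toList α))))))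
    where
    unfold : ∀ v T → when (valid {α = a ∷ α} A (v ∷ T)) (weightFrom {α = a ∷ α} i (v ∷ T)) ≈
      when (increasing (word v)) (when (A (word v)) (rowWeight i 0 (word v) * when (valid (above (word v)) T) (weightFrom (suc i) T)))
    unfold v T with increasing (word v) | A (word v)
    ... | false | _     = refl
    ... | true  | false = refl
    ... | true  | true  = when-* (valid (above (word v)) T) _ _
    pull : ∀ b {A : Set} (as : List A) f → ∑ as (λ a → when b (f a)) ≈ when b (∑ as f)
    pull true  as       f = refl
    pull false []       f = refl
    pull false (a ∷ as) f = trans (+-identityˡ _) (pull false as f)
    row : ∀ v → ∑ (fillings m α) (λ T → when (valid {α = a ∷ α} A (v ∷ T)) (weightFrom {α = a ∷ α} i (v ∷ T))) ≈
      when (increasing (word v)) (when (A (word v)) (rowWeight i 0 (word v) * tableauSum m (suc i) (above (word v)) (toList α)))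
    row v = trans (∑-cong (fillings m α) (λ {T} _ → unfold v T)) (trans
      (pull (increasing (word v)) (fillings m α) _) (when-cong (increasing (word v)) λ _ → trans
      (pull (A (word v)) (fillings m α) _) (when-cong (A (word v)) λ _ → trans
      (∑-* _ (fillings m α) _) (*-congˡ (∑-fillings (suc i) (above (word v)) α)))))

  ∏-tabulate : ∀ {A : Set} {k} (g : Fin k → A) f → ∏ (tabulate g) f ≈ ∏ (allFin k) (f ∘ g)
  ∏-tabulate g f = go g id f (f ∘ g) (λ _ → refl)
    where
    go : ∀ {A B : Set} {k} (g : Fin k → A) (g′ : Fin k → B) f f′ → (∀ i → f (g i) ≈ f′ (g′ i)) →
         ∏ (tabulate g) f ≈ ∏ (tabulate g′) f′
    go {k = zero}  g g′ f f′ eq = refl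
    go {k = suc k} g g′ f f′ eq = *-cong (eq Fin.zero) (go (g ∘ Fin.suc) (g′ ∘ Fin.suc) f f′ (eq ∘ Fin.suc))

  ∏-cong : ∀ {A : Set} (as : List A) {f g : A → Carrier} → (∀ a → f a ≈ g a) → ∏ as f ≈ ∏ as g
  ∏-cong []       eq = refl
  ∏-cong (a ∷ as) eq = *-cong (eq a) (∏-cong as eq)

  ∏-row : ∀ i o {a} (v : Vec (Fin m) a) →
    ∏ (allFin a) (λ j → x (lookup v j) (superscript r i (o +ℕ toℕ j))) ≈ rowWeight i o (word v)
  ∏-row i o []                = refl
  ∏-row i o {suc a} (e ∷ v) = *-cong
    (trans (sym (X-toℕ e _)) (reflexive (≡.cong (λ j → X (toℕ e) (superscript r i j)) (ℕ.+-identityʳ o))))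
    (trans (∏-tabulate Fin.suc (λ j → x (lookup (e ∷ v) j) (superscript r i (o +ℕ toℕ j)))) (trans
      (∏-cong (allFin a) λ j → reflexive (≡.cong (λ t → x (lookup v j) (superscript r i t)) (ℕ.+-suc o (toℕ j))))
      (∏-row i (suc o) v)))

  ∏-filling : ∀ i {k} {α : Vec ℕ k} (T : Filling m α) →
    ∏ (allFin k) (λ i′ → ∏ (allFin (lookup α i′)) λ j → x (entry T i′ j) (superscript r (i +ℕ toℕ i′) (toℕ j))) ≈
    weightFrom i T
  ∏-filling i []                              = refl
  ∏-filling i {suc k} {α = a ∷ α} (v ∷ T) = *-cong
    (trans (reflexive (≡.cong (λ i → ∏ (allFin a) λ j → x (lookup v j) (superscript r i (toℕ j))) (ℕ.+-identityʳ i))) (∏-row i 0 v))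
    (trans (∏-tabulate Fin.suc row) (trans
      (∏-cong (allFin k) λ i′ → ∏-cong (allFin (lookup α i′)) λ j →
        reflexive (≡.cong (λ t → x (entry T i′ j) (superscript r t (toℕ j))) (ℕ.+-suc i (toℕ i′))))
      (∏-filling (suc i) T)))
    where
    row : Fin (suc k) → Carrier
    row i′ = ∏ (allFin (lookup (a ∷ α) i′)) λ j → x (entry {α = a ∷ α} (v ∷ T) i′ j) (superscript r (i +ℕ toℕ i′) (toℕ j))

  s≈schur : ∀ {k M} (α : Vec ℕ k) → Part M α → s r α ≈ schur m (toList α)
  s≈schur α d = begin
    ∑ (filter isSemistandard? (fillings m α)) (weight r)
      ≈⟨ ∑-filter isSemistandard? (fillings m α) (weight r) ⟩
    ∑ (fillings m α) (λ T → when (does (isSemistandard? T)) (weight r T))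
      ≈⟨ ∑-cong (fillings m α) (λ {T} _ → trans (when-≡ (isSemistandard?≡valid T d))
           (when-cong (valid (const true) T) λ _ → ∏-filling 0 T)) ⟩
    ∑ (fillings m α) (λ T → when (valid (const true) T) (weightFrom 0 T))
      ≈⟨ ∑-fillings 0 (const true) α ⟩
    schur m (toList α) ∎

  s≈slater : ∀ {M} (α : Vec ℕ m) → Part M α → s r α ≈ slater m (positionsᵛ α)
  s≈slater α d = begin
    s r α                           ≈⟨ s≈schur α d ⟩
    schur m (toList α)              ≈⟨ schur≈slater m (toList α) (Vec.length-toList α) d ⟩
    slater m (positions (toList α)) ≡⟨ ≡.cong (slater m) (positionsᵛ≡ α) ⟨
    slater m (positionsᵛ α)         ∎

  -- After a move the list of positions is sorted again by adjacent exchanges, from the moved row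
  -- upwards; `push` performs one of them, and its counter collects the signs.
  shift-moves : ∀ {k} N {F} → Alternating F → (α : Vec ℕ k) →
    shift N F (positionsᵛ α) ≈ ∑ (moves N α) (λ (h , μ) → sign h * F (positionsᵛ μ))
  shift-moves N alt []       = refl
  shift-moves N {F} alt (a ∷ []) = +-congʳ (trans (reflexive (≡.cong (λ q → F (q ∷ [])) (xy∙z≈xz∙y a 0 N))) (sym (*-identityˡ _)))
  shift-moves {suc (suc k)} N {F} alt (a ∷ b ∷ α) = +-cong
    (trans (reflexive (≡.cong (λ q → F (q ∷ positionsᵛ (b ∷ α))) (xy∙z≈xz∙y a (suc k) N))) (sym (*-identityˡ _)))
    (trans (shift-moves N (⌞-alternating alt (a +ℕ suc k)) (b ∷ α)) (trans
      (∑-cong (moves N (b ∷ α)) λ {x} _ → pushed x)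
      (sym (∑-concatMap (push a) (moves N (b ∷ α)) _))))
    where
    pushed : ∀ x → sign (proj₁ x) * F (a +ℕ suc k ∷ positionsᵛ (proj₂ x)) ≈
      ∑ (push a x) (λ (h , μ) → sign h * F (positionsᵛ μ))
    pushed (h , b ∷ β) with ℕ.<-cmp b (suc a)
    ... | tri< _ _ _ = sym (+-identityʳ _)
    ... | tri≈ _ ≡.refl _ rewrite ℕ.+-suc a k = trans (*-congˡ (repeat alt [] _ _)) (zeroʳ _)
    pushed (h , zero ∷ β)  | tri> _ _ ()
    pushed (h , suc b ∷ β) | tri> _ _ _ rewrite ℕ.+-suc a k | ℕ.+-suc b k = begin
      sign h * F (suc a +ℕ k ∷ suc b +ℕ k ∷ positionsᵛ β)
        ≈⟨ *-congˡ (swap alt [] _ _ _) ⟩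
      sign h * - F (suc b +ℕ k ∷ suc a +ℕ k ∷ positionsᵛ β)
        ≈⟨ -‿distribʳ-* _ _ ⟨
      - (sign h * F (suc b +ℕ k ∷ suc a +ℕ k ∷ positionsᵛ β))
        ≈⟨ sign-suc h _ ⟨
      sign (suc h) * F (suc b +ℕ k ∷ suc a +ℕ k ∷ positionsᵛ β)
        ≈⟨ +-identityʳ _ ⟨
      sign (suc h) * F (suc b +ℕ k ∷ suc a +ℕ k ∷ positionsᵛ β) + 0# ∎

  path-product : ∀ (z : ℕ → Carrier) k → Transfer.path z k ≈ *-Sum.sum {k} (z ∘ toℕ)
  path-product z zero    = refl
  path-product z (suc k) = trans (head z k) (*-congˡ (path-product (z ∘ suc) k))
    where
    head : ∀ z k → Transfer.path z (suc k) ≈ z 0 * Transfer.path (z ∘ suc) k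
    head z zero    = refl
    head z (suc k) = trans (*-congˡ (head z k)) (x*yz≈y*xz _ _ _)

  ∏-product : ∀ {k} (f : Fin k → Carrier) → ∏ (allFin k) f ≈ *-Sum.sum f
  ∏-product {zero}  f = refl
  ∏-product {suc k} f = *-congˡ (trans (∏-tabulate {k = k} Fin.suc f) (∏-product (f ∘ Fin.suc)))

  -- Along n consecutive positions the superscripts r + e - q run once through all residues, only in
  -- reflected order.
  path≈π : ∀ e → path (toℕ e) n ≈ π e
  path≈π e = begin
    path (toℕ e) n                      ≈⟨ path-product (y (toℕ e)) n ⟩
    *-Sum.sum {n} (y (toℕ e) ∘ toℕ)     ≈⟨ *-Sum.sum-cong-≋ {n} (λ j → X-toℕ e (reflect j)) ⟩
    *-Sum.sum {n} (x e ∘ reflect)       ≈⟨ *-Sum.sum-permute {n} (x e) reflection ⟨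
    *-Sum.sum {n} (x e)                 ≈⟨ ∏-product (x e) ⟨
    π e                                 ∎
    where
    reflect : Fin n → Fin n
    reflect j = superscript r (toℕ e) (toℕ j)
    reflection : Permutation′ n
    reflection = permutation reflect reflect (superscript-involutive r (toℕ e)) (superscript-involutive r (toℕ e))

  y-periodic : ∀ e k q → y e (q +ℕ k *ℕ n) ≈ y e q
  y-periodic e k q = reflexive (≡.cong (X e) (superscript-periodic r e q k))

  path-^ : ∀ e k → path e (k *ℕ n) ≈ path e n ^ k
  path-^ e zero    = refl
  path-^ e (suc k) = trans
    (reflexive (≡.cong (path e) (ℕ.+-comm n (k *ℕ n))))
    (trans (L.Periodic.path-shift e n (λ q → trans (reflexive (≡.cong (λ t → y e (q +ℕ t)) (≡.sym (ℕ.*-identityˡ n)))) (y-periodic e 1 q)) (k *ℕ n))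
      (*-congˡ (path-^ e k)))

  ^-cong : ∀ {a b} k → a ≈ b → a ^ k ≈ b ^ k
  ^-cong zero    eq = refl
  ^-cong (suc k) eq = *-cong eq (^-cong k eq)

  p≈pathSum : ∀ k → p k ≈ pathSum (k *ℕ n) m
  p≈pathSum k = ∑-tabulate {k = m} id (λ e → π e ^ k) (λ e → path e (k *ℕ n)) λ e →
    sym (trans (path-^ (toℕ e) k) (^-cong k (path≈π e)))

  -- Both sides evaluate `shift N` on the alternating form at the positions of `α`: once as an
  -- eigenvalue, once move by move.
  murnaghan-nakayama : ∀ (α : Vec ℕ m) → IsPartition α → ∀ k .{{_ : NonZero k}} →
    p k * s r α ≈ ∑ (ribbonExtensions α (k *ℕ n)) (λ μ → sign (height (μ / α)) * s r μ)
  murnaghan-nakayama α part k = begin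
    p k * s r α
      ≈⟨ *-cong (p≈pathSum k) (s≈slater α d) ⟩
    pathSum N m * slater m (positionsᵛ α)
      ≈⟨ shift-slater N (λ e q → y-periodic e k q) m (positionsᵛ α) ⟨
    shift N (slater m) (positionsᵛ α)
      ≈⟨ shift-moves N (slater-alternating m) α ⟩
    ∑ (moves N α) (λ (h , μ) → sign h * slater m (positionsᵛ μ))
      ≈⟨ ∑-cong (moves N α) (λ z∈ → *-congʳ (reflexive (≡.cong sign (≡.sym (proj₂ (moves⇒ribbonExtension N α d z∈)))))) ⟩
    ∑ (moves N α) (λ (h , μ) → sign (height (μ / α)) * slater m (positionsᵛ μ))
      ≈⟨ ∑-map proj₂ (moves N α) _ ⟨
    ∑ (map proj₂ (moves N α)) (λ μ → sign (height (μ / α)) * slater m (positionsᵛ μ))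
      ≈⟨ ∑-↭ (moves↭ribbonExtensions N α part) _ ⟩
    ∑ (ribbonExtensions α N) (λ μ → sign (height (μ / α)) * slater m (positionsᵛ μ))
      ≈⟨ ∑-cong (ribbonExtensions α N) (λ {μ} μ∈ → *-congˡ (s≈slater μ
           (isPartition⇒part μ (proj₁ (Equivalence.to (∈-ribbonExtensions α N μ) μ∈))))) ⟨
    ∑ (ribbonExtensions α N) (λ μ → sign (height (μ / α)) * s r μ) ∎
    where
    N = k *ℕ n
    d = isPartition⇒part α part
    instance
      N≢0 : NonZero N
      N≢0 = ℕ.m*n≢0 k n

open import Data.Nat.Base using (_*_)

theorem4p1 : (m n : ℕ) .{{_ : NonZero m}} .{{_ : NonZero n}} (r : Fin n)
    (α : Vec ℕ m) → IsPartition α → (k : ℕ) .{{_ : NonZero k}} →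
    let open LoopPolynomials m n in
    p k · s r α ≈ ∑ (ribbonExtensions α (k * n)) (λ μ → sign (height (μ / α)) · s r μ)
theorem4p1 m n r α part k = LoopSchur.murnaghan-nakayama (polynomialCommutativeRing (m * n)) indeterminate r α part k
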